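{- For each positive integer $d$, let $g(d)$ denote the number of integers $x$ with $1 \leq x \leq d$ such that $x^2 \equiv 1 \pmod d$. Then $$\sum_{d < N} g(d) \sim \frac{6}{\pi^2} N \log N$$ as $N \rightarrow \infty$, where the sum runs over positive integers $d < N$; that is, the ratio of the two sides tends to $1$ as $N \to \infty$.
   Context: Here $\log$ is the natural logarithm. -}

module Defs where

open import Data.Integer as ℤ using (ℤ)
open import Data.Integer.Divisibility using () renaming (_∣_ to _∣ℤ_)
import Data.Integer.Properties as ℤₚ
open import Data.List using (List; filter; length; applyUpTo)
open import Data.Nat as ℕ using (ℕ; zero; suc; z≤n; s≤s)
open import Data.Nat.Divisibility using (_∣?_)
import Data.Nat.Properties as ℕₚ
open import Data.Product using (Σ; ∃; _×_; _,_; proj₁; proj₂)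
open import Data.Rational
open import Data.Rational.Literals using (fromℤ)
open import Data.Rational.Properties
open import Data.Rational.Solver using (module +-*-Solver)
import Data.Rational.Unnormalised as ℚᵘ
import Data.Rational.Unnormalised.Properties as ℚᵘₚ
open import Data.Sum using (inj₁; inj₂)
open import Relation.Binary.PropositionalEquality
open import Relation.Nullary using (Dec; yes; no; contradiction)
open +-*-Solver using (solve; _:+_; _:*_; _:-_; :-_; con; _:=_)

fromℕ : ℕ → ℚ
fromℕ n = fromℤ (ℤ.+ n)

-- Totalised with inv 0 = 0.
inv : ℚ → ℚ
inv q with q ≟ 0ℚ
... | yes _  = 0ℚ
... | no q≢0 = (1/ q) ⦃ ≢-nonZero q≢0 ⦄

*-inv : ∀ {q} → q ≢ 0ℚ → q * inv q ≡ 1ℚ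
*-inv {q} q≢0 with q ≟ 0ℚ
... | yes q≡0 = contradiction q≡0 q≢0
... | no  q≢0 = *-inverseʳ q ⦃ ≢-nonZero q≢0 ⦄

0<⇒≢0 : ∀ {q} → 0ℚ < q → q ≢ 0ℚ
0<⇒≢0 0<q q≡0 = <⇒≢ 0<q (sym q≡0)

*-inv-pos : ∀ {q} → 0ℚ < q → q * inv q ≡ 1ℚ
*-inv-pos 0<q = *-inv (0<⇒≢0 0<q)

*-cancelˡ₀ : ∀ {r p q} → 0ℚ < r → r * p ≡ r * q → p ≡ q
*-cancelˡ₀ {r} {p} {q} 0<r eq = trans (sym (strip p)) (trans (cong (inv r *_) eq) (strip q))
  where
  strip : ∀ p → inv r * (r * p) ≡ p
  strip p = trans (sym (*-assoc (inv r) r p))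
    (trans (cong (_* p) (trans (*-comm (inv r) r) (*-inv-pos 0<r))) (*-identityˡ p))

0<1 : 0ℚ < 1ℚ
0<1 = positive⁻¹ 1ℚ

*-mono-≤₀ : ∀ {p q r} → 0ℚ ≤ r → p ≤ q → r * p ≤ r * q
*-mono-≤₀ {r = r} 0≤r p≤q = *-monoˡ-≤-nonNeg r ⦃ nonNegative 0≤r ⦄ p≤q

*-mono-<₀ : ∀ {p q r} → 0ℚ < r → p < q → r * p < r * q
*-mono-<₀ {r = r} 0<r p<q = *-monoʳ-<-pos r ⦃ positive 0<r ⦄ p<q

*-nonNeg₂ : ∀ {p q} → 0ℚ ≤ p → 0ℚ ≤ q → 0ℚ ≤ p * q
*-nonNeg₂ {p} {q} 0≤p 0≤q = subst (_≤ p * q) (*-zeroʳ p) (*-mono-≤₀ 0≤p 0≤q)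

*-pos₂ : ∀ {p q} → 0ℚ < p → 0ℚ < q → 0ℚ < p * q
*-pos₂ {p} {q} 0<p 0<q = subst (_< p * q) (*-zeroʳ p) (*-mono-<₀ 0<p 0<q)

*-mono₂-≤ : ∀ {p q r s} → 0ℚ ≤ p → 0ℚ ≤ s → p ≤ q → r ≤ s → p * r ≤ q * s
*-mono₂-≤ {p} {q} {r} {s} 0≤p 0≤s p≤q r≤s =
  ≤-trans (*-mono-≤₀ 0≤p r≤s)
          (subst₂ _≤_ (*-comm s p) (*-comm s q) (*-mono-≤₀ 0≤s p≤q))

inv-pos : ∀ {q} → 0ℚ < q → 0ℚ < inv q
inv-pos {q} 0<q with q ≟ 0ℚ
... | yes q≡0 = contradiction q≡0 (0<⇒≢0 0<q)
... | no  q≢0 = positive⁻¹ _ ⦃ 1/pos⇒pos q ⦃ positive 0<q ⦄ ⦄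

inv-antitone : ∀ {p q} → 0ℚ < p → p ≤ q → inv q ≤ inv p
inv-antitone {p} {q} 0<p p≤q = subst₂ _≤_ eq₁ eq₂ (*-mono-≤₀ 0≤ii p≤q)
  where
  0<q  = <-≤-trans 0<p p≤q
  ii   = inv p * inv q
  0≤ii = <⇒≤ (*-pos₂ (inv-pos 0<p) (inv-pos 0<q))
  eq₁ : ii * p ≡ inv q
  eq₁ = trans (solve 3 (λ i j p → i :* j :* p := p :* i :* j) refl (inv p) (inv q) p)
              (trans (cong (_* inv q) (*-inv-pos 0<p)) (*-identityˡ _))
  eq₂ : ii * q ≡ inv p
  eq₂ = trans (solve 3 (λ i j q → i :* j :* q := q :* j :* i) refl (inv p) (inv q) q)
              (trans (cong (_* inv p) (*-inv-pos 0<q)) (*-identityˡ _))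

fromℕ-+ : ∀ m n → fromℕ (m ℕ.+ n) ≡ fromℕ m + fromℕ n
fromℕ-+ m n = toℚᵘ-injective (ℚᵘₚ.≃-sym (ℚᵘₚ.≃-trans (toℚᵘ-homo-+ (fromℕ m) (fromℕ n))
  (ℚᵘ.*≡* (cong (ℤ._* ℤ.+ 1) (cong₂ ℤ._+_ (ℤₚ.*-identityʳ (ℤ.+ m)) (ℤₚ.*-identityʳ (ℤ.+ n)))))))

fromℕ-* : ∀ m n → fromℕ (m ℕ.* n) ≡ fromℕ m * fromℕ n
fromℕ-* m n = toℚᵘ-injective (ℚᵘₚ.≃-sym (ℚᵘₚ.≃-trans (toℚᵘ-homo-* (fromℕ m) (fromℕ n))
  (ℚᵘ.*≡* (cong (ℤ._* ℤ.+ 1) (sym (ℤₚ.pos-* m n))))))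

fromℕ-mono-≤ : ∀ {m n} → m ℕ.≤ n → fromℕ m ≤ fromℕ n
fromℕ-mono-≤ m≤n = *≤* (ℤₚ.*-monoʳ-≤-nonNeg (ℤ.+ 1) (ℤ.+≤+ m≤n))

fromℕ-mono-< : ∀ {m n} → m ℕ.< n → fromℕ m < fromℕ n
fromℕ-mono-< m<n = *<* (ℤₚ.*-monoʳ-<-pos (ℤ.+ 1) (ℤ.+<+ m<n))

0≤fromℕ : ∀ n → 0ℚ ≤ fromℕ n
0≤fromℕ n = fromℕ-mono-≤ {0} {n} z≤n

1≤fromℕ : ∀ n → .⦃ ℕ.NonZero n ⦄ → 1ℚ ≤ fromℕ n
1≤fromℕ n@(suc _) = fromℕ-mono-≤ {1} {n} (s≤s z≤n)

0<fromℕ : ∀ n → .⦃ ℕ.NonZero n ⦄ → 0ℚ < fromℕ n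
0<fromℕ n = <-≤-trans 0<1 (1≤fromℕ n)

≤-fromℕ-∣↥∣ : ∀ q → q ≤ fromℕ ℤ.∣ ↥ q ∣
≤-fromℕ-∣↥∣ (mkℚ n d _) = *≤* (ℤₚ.≤-trans
  (subst (ℤ._≤ ℤ.+ ℤ.∣ n ∣) (sym (ℤₚ.*-identityʳ n)) (i≤∣i∣ n))
  (subst (ℤ._≤ ℤ.+ ℤ.∣ n ∣ ℤ.* ℤ.+ suc d) (ℤₚ.*-identityʳ (ℤ.+ ℤ.∣ n ∣))
    (ℤₚ.*-monoˡ-≤-nonNeg (ℤ.+ ℤ.∣ n ∣) (ℤ.+≤+ (s≤s (z≤n {d}))))))
  where
  i≤∣i∣ : ∀ i → i ℤ.≤ ℤ.+ ℤ.∣ i ∣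
  i≤∣i∣ (ℤ.+ _)        = ℤₚ.≤-refl
  i≤∣i∣ ℤ.-[1+ _ ] = ℤ.-≤+

archimedean : ∀ C ε → 0ℚ < ε → ∃ λ M → ∀ m → M ℕ.≤ m → C * inv (fromℕ (suc m)) < ε
archimedean C ε 0<ε = M , bound
  where
  M = ℤ.∣ ↥ (C * inv ε) ∣
  bound : ∀ m → M ℕ.≤ m → C * inv (fromℕ (suc m)) < ε
  bound m M≤m = subst₂ _<_ eq₁ eq₂ (*-mono-<₀ (*-pos₂ 0<ε (inv-pos 0<N)) lt)
    where
    N   = fromℕ (suc m)
    0<N = 0<fromℕ (suc m)
    lt : C * inv ε < N
    lt = ≤-<-trans (≤-fromℕ-∣↥∣ (C * inv ε)) (fromℕ-mono-< (s≤s M≤m))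
    eq₁ : (ε * inv N) * (C * inv ε) ≡ C * inv N
    eq₁ = trans (solve 4 (λ e i c j → (e :* i) :* (c :* j) := (e :* j) :* (c :* i)) refl
                   ε (inv N) C (inv ε))
                (trans (cong (_* (C * inv N)) (*-inv-pos 0<ε)) (*-identityˡ _))
    eq₂ : (ε * inv N) * N ≡ ε
    eq₂ = trans (solve 3 (λ e i n → (e :* i) :* n := e :* (n :* i)) refl ε (inv N) N)
                (trans (cong (ε *_) (*-inv-pos 0<N)) (*-identityʳ _))

half+half : ∀ ε → ε * ½ + ε * ½ ≡ ε
half+half ε = trans (sym (*-distribˡ-+ ε ½ ½)) (*-identityʳ ε)

0<half : ∀ {ε} → 0ℚ < ε → 0ℚ < ε * ½
0<half 0<ε = *-pos₂ 0<ε (positive⁻¹ ½)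

∣-∣-< : ∀ {p q c ε} → p ≤ q + c → q ≤ p + c → c < ε → ∣ p - q ∣ < ε
∣-∣-< {p} {q} {c} p≤ q≤ c<ε with ∣p∣≡p∨∣p∣≡-p (p - q)
... | inj₁ e = ≤-<-trans (subst₂ _≤_ (sym e)
  (solve 2 (λ q c → q :+ c :- q := c) refl q c) (+-monoˡ-≤ (- q) p≤)) c<ε
... | inj₂ e = ≤-<-trans (subst₂ _≤_
  (trans (solve 2 (λ p q → q :- p := :- (p :- q)) refl p q) (sym e))
  (solve 2 (λ p c → p :+ c :- p := c) refl p c) (+-monoˡ-≤ (- p) q≤)) c<ε

∣∣≤∣∣+∣-∣ : ∀ p q → ∣ p ∣ ≤ ∣ q ∣ + ∣ p - q ∣
∣∣≤∣∣+∣-∣ p q = subst (λ r → ∣ r ∣ ≤ ∣ q ∣ + ∣ p - q ∣)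
  (solve 2 (λ p q → q :+ (p :- q) := p) refl p q) (∣p+q∣≤∣p∣+∣q∣ q (p - q))

∣-∣-sym : ∀ p q → ∣ p - q ∣ ≡ ∣ q - p ∣
∣-∣-sym p q = trans (cong ∣_∣ (solve 2 (λ p q → p :- q := :- (q :- p)) refl p q))
                    (∣-p∣≡∣p∣ (q - p))

Cauchy : (ℕ → ℚ) → Set
Cauchy s = ∀ ε → 0ℚ < ε →
  ∃ λ M → ∀ m n → M ℕ.≤ m → M ℕ.≤ n → ∣ s m - s n ∣ < ε

record ℝ : Set where
  constructor mkℝ
  field
    seq    : ℕ → ℚ
    cauchy : Cauchy seq

open ℝ public

ι : ℚ → ℝ
ι q = mkℝ (λ _ → q) λ ε 0<ε →
  0 , λ _ _ _ _ → subst (_< ε) (sym (cong ∣_∣ (+-inverseʳ q))) 0<ε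

infix  8 -ᴿ_
infixl 6 _+ᴿ_ _-ᴿ_
infixl 7 _*ᴿ_
infix  4 _<ᴿ_

_+ᴿ_ : ℝ → ℝ → ℝ
x +ᴿ y = mkℝ (λ n → seq x n + seq y n) λ ε 0<ε →
  let M₁ , h₁ = cauchy x (ε * ½) (0<half 0<ε)
      M₂ , h₂ = cauchy y (ε * ½) (0<half 0<ε)
  in M₁ ℕ.⊔ M₂ , λ m n M≤m M≤n →
     subst₂ _<_ refl (half+half ε) (≤-<-trans
       (subst (λ r → ∣ r ∣ ≤ ∣ seq x m - seq x n ∣ + ∣ seq y m - seq y n ∣)
         (solve 4 (λ a b c d → (a :- b) :+ (c :- d) := (a :+ c) :- (b :+ d)) refl
           (seq x m) (seq x n) (seq y m) (seq y n))
         (∣p+q∣≤∣p∣+∣q∣ (seq x m - seq x n) (seq y m - seq y n)))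
       (+-mono-< (h₁ m n (ℕₚ.m⊔n≤o⇒m≤o M₁ M₂ M≤m) (ℕₚ.m⊔n≤o⇒m≤o M₁ M₂ M≤n))
                 (h₂ m n (ℕₚ.m⊔n≤o⇒n≤o M₁ M₂ M≤m) (ℕₚ.m⊔n≤o⇒n≤o M₁ M₂ M≤n))))

-ᴿ_ : ℝ → ℝ
-ᴿ x = mkℝ (λ n → - seq x n) λ ε 0<ε →
  let M , h = cauchy x ε 0<ε
  in M , λ m n M≤m M≤n → subst (_< ε)
     (trans (∣-∣-sym (seq x m) (seq x n))
       (cong ∣_∣ (solve 2 (λ a b → b :- a := :- a :- :- b) refl (seq x m) (seq x n))))
     (h m n M≤m M≤n)

_-ᴿ_ : ℝ → ℝ → ℝ
x -ᴿ y = x +ᴿ (-ᴿ y)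

∣_∣ᴿ : ℝ → ℝ
∣ x ∣ᴿ = mkℝ (λ n → ∣ seq x n ∣) λ ε 0<ε →
  let M , h = cauchy x ε 0<ε
  in M , λ m n M≤m M≤n → ∣-∣-<
     (∣∣≤∣∣+∣-∣ (seq x m) (seq x n))
     (subst (λ r → ∣ seq x n ∣ ≤ ∣ seq x m ∣ + r) (∣-∣-sym (seq x n) (seq x m))
       (∣∣≤∣∣+∣-∣ (seq x n) (seq x m)))
     (h m n M≤m M≤n)

eventually-bounded : ∀ x → ∃ λ B → 0ℚ < B × ∃ λ M → ∀ n → M ℕ.≤ n → ∣ seq x n ∣ ≤ B
eventually-bounded x =
  let M , h = cauchy x 1ℚ 0<1
  in ∣ seq x M ∣ + 1ℚ
   , +-mono-≤-< (0≤∣p∣ (seq x M)) 0<1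
   , M
   , λ n M≤n → ≤-trans (∣∣≤∣∣+∣-∣ (seq x n) (seq x M))
                 (+-monoʳ-≤ ∣ seq x M ∣ (<⇒≤ (h n M M≤n ℕₚ.≤-refl)))

*-cauchy : ∀ x y → Cauchy (λ n → seq x n * seq y n)
*-cauchy x y ε 0<ε =
  let A , 0<A , Mᵃ , bx = eventually-bounded x
      B , 0<B , Mᵇ , by = eventually-bounded y
      0<ε½ = 0<half 0<ε
      δx = inv B * (ε * ½)
      δy = inv A * (ε * ½)
      Mx , hx = cauchy x δx (*-pos₂ (inv-pos 0<B) 0<ε½)
      My , hy = cauchy y δy (*-pos₂ (inv-pos 0<A) 0<ε½)
      M₁ = Mᵃ ℕ.⊔ Mᵇ
      M₂ = Mx ℕ.⊔ My
      M = M₁ ℕ.⊔ M₂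
      cancel : ∀ {C} → 0ℚ < C → C * (inv C * (ε * ½)) ≡ ε * ½
      cancel {C} 0<C = trans (sym (*-assoc C (inv C) (ε * ½)))
        (trans (cong (_* (ε * ½)) (*-inv-pos 0<C)) (*-identityˡ (ε * ½)))
      prod : ∀ {p q C δ} → 0ℚ < C → ∣ p ∣ ≤ C → ∣ q ∣ < δ → ∣ p * q ∣ < C * δ
      prod {p} {q} {C} {δ} 0<C p≤C q<δ = subst (_< C * δ) (sym (∣p*q∣≡∣p∣*∣q∣ p q))
        (≤-<-trans (*-mono₂-≤ (0≤∣p∣ p) (0≤∣p∣ q) p≤C ≤-refl) (*-mono-<₀ 0<C q<δ))
  in M , λ m n M≤m M≤n →
    let M₁≤m = ℕₚ.m⊔n≤o⇒m≤o M₁ M₂ M≤m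
        M₁≤n = ℕₚ.m⊔n≤o⇒m≤o M₁ M₂ M≤n
        M₂≤m = ℕₚ.m⊔n≤o⇒n≤o M₁ M₂ M≤m
        M₂≤n = ℕₚ.m⊔n≤o⇒n≤o M₁ M₂ M≤n
        a = seq x m ; b = seq x n ; c = seq y m ; d = seq y n
        s = a * (c - d)
        t = d * (a - b)
        ineq₁ : ∣ s ∣ < ε * ½
        ineq₁ = subst (∣ s ∣ <_) (cancel 0<A)
          (prod 0<A (bx m (ℕₚ.m⊔n≤o⇒m≤o Mᵃ Mᵇ M₁≤m))
            (hy m n (ℕₚ.m⊔n≤o⇒n≤o Mx My M₂≤m) (ℕₚ.m⊔n≤o⇒n≤o Mx My M₂≤n)))
        ineq₂ : ∣ t ∣ < ε * ½
        ineq₂ = subst (∣ t ∣ <_) (cancel 0<B)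
          (prod 0<B (by n (ℕₚ.m⊔n≤o⇒n≤o Mᵃ Mᵇ M₁≤n))
            (hx m n (ℕₚ.m⊔n≤o⇒m≤o Mx My M₂≤m) (ℕₚ.m⊔n≤o⇒m≤o Mx My M₂≤n)))
    in subst₂ _<_
         (cong ∣_∣ (solve 4 (λ a b c d → a :* (c :- d) :+ d :* (a :- b) := a :* c :- b :* d)
           refl a b c d))
         (half+half ε)
         (≤-<-trans (∣p+q∣≤∣p∣+∣q∣ s t) (+-mono-< ineq₁ ineq₂))

_*ᴿ_ : ℝ → ℝ → ℝ
x *ᴿ y = mkℝ (λ n → seq x n * seq y n) (*-cauchy x y)

_<ᴿ_ : ℝ → ℝ → Set
x <ᴿ y = ∃ λ δ → 0ℚ < δ × ∃ λ M → ∀ n → M ℕ.≤ n → seq x n + δ ≤ seq y n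

_#0 : ℝ → Set
x #0 = ∃ λ δ → 0ℚ < δ × ∃ λ M → ∀ n → M ℕ.≤ n → δ ≤ ∣ seq x n ∣

inv-cauchy : ∀ x → x #0 → Cauchy (λ n → inv (seq x n))
inv-cauchy x (δ , 0<δ , M₀ , lb) ε 0<ε =
  let M₁ , h = cauchy x (ε * (δ * δ)) (*-pos₂ 0<ε (*-pos₂ 0<δ 0<δ))
  in M₀ ℕ.⊔ M₁ , λ m n M≤m M≤n →
     close (lb m (ℕₚ.m⊔n≤o⇒m≤o M₀ M₁ M≤m)) (lb n (ℕₚ.m⊔n≤o⇒m≤o M₀ M₁ M≤n))
           (h m n (ℕₚ.m⊔n≤o⇒n≤o M₀ M₁ M≤m) (ℕₚ.m⊔n≤o⇒n≤o M₀ M₁ M≤n))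
  where
  ≢0 : ∀ {p} → δ ≤ ∣ p ∣ → p ≢ 0ℚ
  ≢0 δ≤ refl = <-irrefl refl (<-≤-trans 0<δ δ≤)
  close : ∀ {p q} → δ ≤ ∣ p ∣ → δ ≤ ∣ q ∣ → ∣ p - q ∣ < ε * (δ * δ) →
          ∣ inv p - inv q ∣ < ε
  close {p} {q} δ≤p δ≤q p-q< = *-cancelˡ-<-nonNeg (∣ p ∣ * ∣ q ∣)
    ⦃ nonNegative (*-nonNeg₂ (0≤∣p∣ p) (0≤∣p∣ q)) ⦄
    (subst₂ _<_ (sym eq) refl
      (<-≤-trans p-q< (subst (ε * (δ * δ) ≤_) (*-comm ε (∣ p ∣ * ∣ q ∣))
        (*-mono-≤₀ (<⇒≤ 0<ε) (*-mono₂-≤ (<⇒≤ 0<δ) (0≤∣p∣ q) δ≤p δ≤q)))))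
    where
    eq : ∣ p ∣ * ∣ q ∣ * ∣ inv p - inv q ∣ ≡ ∣ p - q ∣
    eq = trans (cong (_* ∣ inv p - inv q ∣) (sym (∣p*q∣≡∣p∣*∣q∣ p q)))
        (trans (sym (∣p*q∣≡∣p∣*∣q∣ (p * q) (inv p - inv q)))
        (trans (cong ∣_∣ (trans
          (solve 4 (λ p q i j → p :* q :* (i :- j) := (p :* i) :* q :- (q :* j) :* p) refl
            p q (inv p) (inv q))
          (cong₂ _-_
            (trans (cong (_* q) (*-inv (≢0 {p} δ≤p))) (*-identityˡ q))
            (trans (cong (_* p) (*-inv (≢0 {q} δ≤q))) (*-identityˡ p)))))
        (∣-∣-sym q p)))

infix  8 _⁻¹[_]

_⁻¹[_] : (x : ℝ) → x #0 → ℝ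
x ⁻¹[ x#0 ] = mkℝ (λ n → inv (seq x n)) (inv-cauchy x x#0)

infixl 7 _/ᴿ_[_]

_/ᴿ_[_] : (x y : ℝ) → y #0 → ℝ
x /ᴿ y [ y#0 ] = x *ᴿ (y ⁻¹[ y#0 ])

*-#0 : ∀ x y → x #0 → y #0 → (x *ᴿ y) #0
*-#0 x y (δ , 0<δ , M₁ , h₁) (η , 0<η , M₂ , h₂) =
  δ * η , *-pos₂ 0<δ 0<η , M₁ ℕ.⊔ M₂ , λ n M≤n →
    subst (δ * η ≤_) (sym (∣p*q∣≡∣p∣*∣q∣ (seq x n) (seq y n)))
      (*-mono₂-≤ (<⇒≤ 0<δ) (0≤∣p∣ (seq y n))
        (h₁ n (ℕₚ.m⊔n≤o⇒m≤o M₁ M₂ M≤n)) (h₂ n (ℕₚ.m⊔n≤o⇒n≤o M₁ M₂ M≤n)))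

∑ : (ℕ → ℚ) → ℕ → ℚ
∑ f zero    = 0ℚ
∑ f (suc n) = ∑ f n + f n

∑-mono : ∀ {f g} n → (∀ i → i ℕ.< n → f i ≤ g i) → ∑ f n ≤ ∑ g n
∑-mono zero    f≤g = ≤-refl
∑-mono (suc n) f≤g =
  +-mono-≤ (∑-mono n (λ i i<n → f≤g i (ℕₚ.m≤n⇒m≤1+n i<n))) (f≤g n ℕₚ.≤-refl)

∑-const : ∀ c n → ∑ (λ _ → c) n ≡ fromℕ n * c
∑-const c zero    = sym (*-zeroˡ c)
∑-const c (suc n) = trans (cong (_+ c) (∑-const c n))
  (trans (solve 2 (λ n c → n :* c :+ c := (con 1ℚ :+ n) :* c) refl (fromℕ n) c)
         (cong (_* c) (sym (fromℕ-+ 1 n))))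

∑-cong : ∀ {f g} n → (∀ i → f i ≡ g i) → ∑ f n ≡ ∑ g n
∑-cong zero    f≡g = refl
∑-cong (suc n) f≡g = cong₂ _+_ (∑-cong n f≡g) (f≡g n)

*-∑ : ∀ c f n → c * ∑ f n ≡ ∑ (λ i → c * f i) n
*-∑ c f zero    = *-zeroʳ c
*-∑ c f (suc n) = trans (*-distribˡ-+ c (∑ f n) (f n)) (cong (_+ c * f n) (*-∑ c f n))

∑-append : ∀ f k n → ∑ f (k ℕ.+ n) ≡ ∑ f k + ∑ (λ j → f (k ℕ.+ j)) n
∑-append f k zero    = trans (cong (∑ f) (ℕₚ.+-identityʳ k)) (sym (+-identityʳ (∑ f k)))
∑-append f k (suc n) = trans (cong (∑ f) (ℕₚ.+-suc k n))
  (trans (cong (_+ f (k ℕ.+ n)) (∑-append f k n))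
         (+-assoc (∑ f k) (∑ (λ j → f (k ℕ.+ j)) n) (f (k ℕ.+ n))))

∑-blocks : ∀ f m n → ∑ f (m ℕ.* n) ≡ ∑ (λ i → ∑ (λ j → f (i ℕ.* n ℕ.+ j)) n) m
∑-blocks f zero    n = refl
∑-blocks f (suc m) n = trans (cong (∑ f) (ℕₚ.+-comm n (m ℕ.* n)))
  (trans (∑-append f (m ℕ.* n) n)
         (cong (_+ ∑ (λ j → f (m ℕ.* n ℕ.+ j)) n) (∑-blocks f m n)))

∑-telescope : ∀ f n → ∑ f n + f n ≡ f 0 + ∑ (λ i → f (suc i)) n
∑-telescope f zero    = +-comm 0ℚ (f 0)
∑-telescope f (suc n) = trans (cong (_+ f (suc n)) (∑-telescope f n))
  (+-assoc (f 0) (∑ (λ i → f (suc i)) n) (f (suc n)))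

AntitoneOn : ℚ → ℚ → (ℚ → ℚ) → Set
AntitoneOn a b f = ∀ {s t} → a ≤ s → s ≤ t → t ≤ b → f t ≤ f s

mesh : ℚ → ℚ → ℕ → ℚ
mesh a b n = (b - a) * inv (fromℕ n)

-- Right endpoints of n equal subintervals of [a, b]; only meaningful for n ≥ 1.
riemannSum : ℚ → ℚ → (ℚ → ℚ) → ℕ → ℚ
riemannSum a b f n =
  mesh a b n * ∑ (λ i → f (a + fromℕ (suc i) * mesh a b n)) n

module _ {a b : ℚ} {f : ℚ → ℚ} (a≤b : a ≤ b) (anti : AntitoneOn a b f) where

  private
    R = riemannSum a b f
    Δ = mesh a b
    D = f a - f b

    0≤b-a : 0ℚ ≤ b - a
    0≤b-a = subst (_≤ b - a) (+-inverseʳ a) (+-monoˡ-≤ (- a) a≤b)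

    0≤Δ : ∀ n → .⦃ ℕ.NonZero n ⦄ → 0ℚ ≤ Δ n
    0≤Δ n = *-nonNeg₂ 0≤b-a (<⇒≤ (inv-pos (0<fromℕ n)))

    nΔ : ∀ n → .⦃ ℕ.NonZero n ⦄ → fromℕ n * Δ n ≡ b - a
    nΔ n = trans (solve 3 (λ n c i → n :* (c :* i) := c :* (n :* i)) refl
                    (fromℕ n) (b - a) (inv (fromℕ n)))
                 (trans (cong ((b - a) *_) (*-inv-pos (0<fromℕ n))) (*-identityʳ (b - a)))

    point : ℕ → ℕ → ℚ
    point n i = a + fromℕ i * Δ n

    point-mono : ∀ n → .⦃ _ : ℕ.NonZero n ⦄ → ∀ {i j} → i ℕ.≤ j → point n i ≤ point n j
    point-mono n {i} {j} i≤j = +-monoʳ-≤ a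
      (subst₂ _≤_ (*-comm (Δ n) (fromℕ i)) (*-comm (Δ n) (fromℕ j))
        (*-mono-≤₀ (0≤Δ n) (fromℕ-mono-≤ i≤j)))

    point-0 : ∀ n → point n 0 ≡ a
    point-0 n = trans (cong (a +_) (*-zeroˡ (Δ n))) (+-identityʳ a)

    point-n : ∀ n → .⦃ _ : ℕ.NonZero n ⦄ → point n n ≡ b
    point-n n = trans (cong (a +_) (nΔ n)) (solve 2 (λ a b → a :+ (b :- a) := b) refl a b)

    a≤point : ∀ n → .⦃ _ : ℕ.NonZero n ⦄ → ∀ i → a ≤ point n i
    a≤point n i = subst (_≤ point n i) (point-0 n) (point-mono n z≤n)

    point≤b : ∀ n → .⦃ _ : ℕ.NonZero n ⦄ → ∀ {i} → i ℕ.≤ n → point n i ≤ b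
    point≤b n {i} i≤n = subst (point n i ≤_) (point-n n) (point-mono n i≤n)

    module Refine (m n : ℕ) .⦃ m≢0 : ℕ.NonZero m ⦄ .⦃ n≢0 : ℕ.NonZero n ⦄ where
      instance
        mn≢0 : ℕ.NonZero (m ℕ.* n)
        mn≢0 = ℕₚ.m*n≢0 m n

      Δ-refine : Δ m ≡ fromℕ n * Δ (m ℕ.* n)
      Δ-refine = *-cancelˡ₀ (0<fromℕ m) (trans (nΔ m) (trans (sym (nΔ (m ℕ.* n)))
        (trans (cong (_* Δ (m ℕ.* n)) (fromℕ-* m n))
               (*-assoc (fromℕ m) (fromℕ n) (Δ (m ℕ.* n))))))

      point-refine : ∀ i → point m i ≡ point (m ℕ.* n) (i ℕ.* n)
      point-refine i = cong (a +_) (trans (cong (fromℕ i *_) Δ-refine)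
        (trans (sym (*-assoc (fromℕ i) (fromℕ n) (Δ (m ℕ.* n))))
               (cong (_* Δ (m ℕ.* n)) (sym (fromℕ-* i n)))))

      coarse-as-fine : ∀ h →
        Δ m * ∑ h m ≡ Δ (m ℕ.* n) * ∑ (λ i → ∑ (λ _ → h i) n) m
      coarse-as-fine h = trans (*-∑ (Δ m) h m) (trans (∑-cong m λ i →
          trans (cong (_* h i) (trans Δ-refine (*-comm (fromℕ n) (Δ (m ℕ.* n)))))
          (trans (*-assoc (Δ (m ℕ.* n)) (fromℕ n) (h i))
                 (cong (Δ (m ℕ.* n) *_) (sym (∑-const (h i) n)))))
        (sym (*-∑ (Δ (m ℕ.* n)) (λ i → ∑ (λ _ → h i) n) m)))

      fine : ℕ → ℚ
      fine k = f (point (m ℕ.* n) (suc k))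

      in+j<[1+i]n : ∀ i {j} → j ℕ.< n → suc (i ℕ.* n ℕ.+ j) ℕ.≤ suc i ℕ.* n
      in+j<[1+i]n i {j} j<n = subst (suc (i ℕ.* n ℕ.+ j) ℕ.≤_) (ℕₚ.+-comm (i ℕ.* n) n)
        (ℕₚ.+-monoʳ-< (i ℕ.* n) j<n)

      in+j<mn : ∀ {i j} → i ℕ.< m → j ℕ.< n → suc (i ℕ.* n ℕ.+ j) ℕ.≤ m ℕ.* n
      in+j<mn {i} i<m j<n = ℕₚ.≤-trans (in+j<[1+i]n i j<n) (ℕₚ.*-monoˡ-≤ n i<m)

      lower : R m ≤ R (m ℕ.* n)
      lower = subst₂ _≤_ (sym (coarse-as-fine (λ i → f (point m (suc i)))))
        (cong (Δ (m ℕ.* n) *_) (sym (∑-blocks fine m n)))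
        (*-mono-≤₀ (0≤Δ (m ℕ.* n)) (∑-mono m λ i i<m → ∑-mono n λ j j<n →
          anti (a≤point (m ℕ.* n) (suc (i ℕ.* n ℕ.+ j)))
            (subst (point (m ℕ.* n) (suc (i ℕ.* n ℕ.+ j)) ≤_) (sym (point-refine (suc i)))
              (point-mono (m ℕ.* n) (in+j<[1+i]n i j<n)))
            (point≤b m i<m)))

      upper : R (m ℕ.* n) ≤ Δ m * ∑ (λ i → f (point m i)) m
      upper = subst₂ _≤_ (cong (Δ (m ℕ.* n) *_) (sym (∑-blocks fine m n)))
        (sym (coarse-as-fine (λ i → f (point m i))))
        (*-mono-≤₀ (0≤Δ (m ℕ.* n)) (∑-mono m λ i i<m → ∑-mono n λ j j<n →
          anti (a≤point m i)
            (subst (_≤ point (m ℕ.* n) (suc (i ℕ.* n ℕ.+ j))) (sym (point-refine i))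
              (point-mono (m ℕ.* n) (ℕₚ.m≤n⇒m≤1+n (ℕₚ.m≤m+n (i ℕ.* n) j))))
            (point≤b (m ℕ.* n) (in+j<mn i<m j<n))))

    left≡right : ∀ m → .⦃ _ : ℕ.NonZero m ⦄ →
      Δ m * ∑ (λ i → f (point m i)) m ≡ R m + Δ m * D
    left≡right m = trans (cong (Δ m *_) (begin
        S₀                                   ≡⟨ solve 2 (λ s t → s := s :+ t :- t) refl S₀ (f b) ⟩
        S₀ + f b - f b                       ≡⟨ cong (λ t → S₀ + f t - f b) (point-n m) ⟨
        S₀ + f (point m m) - f b             ≡⟨ cong (_- f b) (∑-telescope (λ i → f (point m i)) m) ⟩
        f (point m 0) + S₁ - f b             ≡⟨ cong (λ t → f t + S₁ - f b) (point-0 m) ⟩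
        f a + S₁ - f b                       ≡⟨ solve 3 (λ x s y → x :+ s :- y := s :+ (x :- y)) refl (f a) S₁ (f b) ⟩
        S₁ + D                               ∎))
      (*-distribˡ-+ (Δ m) S₁ D)
      where
      open ≡-Reasoning
      S₀ = ∑ (λ i → f (point m i)) m
      S₁ = ∑ (λ i → f (point m (suc i))) m

  riemannSum-≤-refine : ∀ m n → .⦃ _ : ℕ.NonZero m ⦄ .⦃ _ : ℕ.NonZero n ⦄ →
    riemannSum a b f m ≤ riemannSum a b f (m ℕ.* n)
  riemannSum-≤-refine m n = Refine.lower m n

  riemannSum-close : ∀ m n → .⦃ _ : ℕ.NonZero m ⦄ .⦃ _ : ℕ.NonZero n ⦄ →
    riemannSum a b f m ≤ riemannSum a b f n + mesh a b n * (f a - f b)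
  riemannSum-close m n = ≤-trans (Refine.lower m n)
    (subst₂ _≤_ (cong R (ℕₚ.*-comm n m)) (left≡right n) (Refine.upper n m))

  riemannSum-cauchy : Cauchy (λ k → riemannSum a b f (suc k))
  riemannSum-cauchy ε 0<ε =
    let M , h = archimedean ((b - a) * D) ε 0<ε
    in M , λ m n M≤m M≤n →
      let rearrange k = solve 3 (λ c i d → c :* d :* i := c :* i :* d) refl
                          (b - a) (inv (fromℕ (suc k))) D
          small k M≤k = subst (_< ε) (rearrange k) (h k M≤k)
      in  max-case (R (suc m)) (R (suc n)) (Δ (suc m) * D) (Δ (suc n) * D)
            (riemannSum-close (suc m) (suc n)) (riemannSum-close (suc n) (suc m))
            (small m M≤m) (small n M≤n)
    where
    max-case : ∀ p q c d → p ≤ q + d → q ≤ p + c → c < ε → d < ε → ∣ p - q ∣ < ε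
    max-case p q c d p≤ q≤ c<ε d<ε with ≤-total c d
    ... | inj₁ c≤d = ∣-∣-< p≤ (≤-trans q≤ (+-monoʳ-≤ p c≤d)) d<ε
    ... | inj₂ d≤c = ∣-∣-< (≤-trans p≤ (+-monoʳ-≤ q d≤c)) q≤ c<ε

  -- Sequences are indexed from 0, so term k uses k + 1 subintervals.
  ∫ : ℝ
  ∫ = mkℝ (λ k → riemannSum a b f (suc k)) riemannSum-cauchy

-- ∫₁ⁿ dt / t
log : (n : ℕ) → .⦃ ℕ.NonZero n ⦄ → ℝ
log n = ∫ {a = 1ℚ} {b = fromℕ n} {f = inv} (1≤fromℕ n)
  λ 1≤s s≤t _ → inv-antitone (<-≤-trans 0<1 1≤s) s≤t

0<1+t² : ∀ t → 0ℚ ≤ t → 0ℚ < 1ℚ + t * t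
0<1+t² t 0≤t = +-mono-<-≤ 0<1 (*-nonNeg₂ 0≤t 0≤t)

[1+t²]⁻¹-antitone : AntitoneOn 0ℚ 1ℚ (λ t → inv (1ℚ + t * t))
[1+t²]⁻¹-antitone {s} {t} 0≤s s≤t _ = inv-antitone (0<1+t² s 0≤s)
  (+-monoʳ-≤ 1ℚ (*-mono₂-≤ 0≤s (≤-trans 0≤s s≤t) s≤t s≤t))

∫₀¹[1+t²]⁻¹ : ℝ
∫₀¹[1+t²]⁻¹ = ∫ {a = 0ℚ} {b = 1ℚ} {f = λ t → inv (1ℚ + t * t)} (<⇒≤ 0<1) [1+t²]⁻¹-antitone

-- 4 arctan 1 = 4 ∫₀¹ dt / (1 + t²)
π : ℝ
π = ι (fromℕ 4) *ᴿ ∫₀¹[1+t²]⁻¹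

π#0 : π #0
π#0 = *-#0 (ι (fromℕ 4)) ∫₀¹[1+t²]⁻¹
  (fromℕ 4 , 0<fromℕ 4 , 0 , λ _ _ → ≤-refl)
  (½ , positive⁻¹ ½ , 0 , λ n _ → ≤-trans (½≤seq n)
    (≤-reflexive (sym (0≤p⇒∣p∣≡p (≤-trans (<⇒≤ (positive⁻¹ ½)) (½≤seq n))))))
  where
  ½≤seq : ∀ n → ½ ≤ seq ∫₀¹[1+t²]⁻¹ n
  ½≤seq n = subst (λ k → ½ ≤ riemannSum 0ℚ 1ℚ (λ t → inv (1ℚ + t * t)) k)
    (ℕₚ.*-identityˡ (suc n))
    (riemannSum-≤-refine {f = λ t → inv (1ℚ + t * t)} (<⇒≤ 0<1) [1+t²]⁻¹-antitone 1 (suc n))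

6/π² : ℝ
6/π² = ι (fromℕ 6) /ᴿ π *ᴿ π [ *-#0 π π π#0 π#0 ]

-- f N / g N → 1. The denominator only has to be invertible for large N
-- (for instance log 1 = 0), which is part of the claim.
infix 4 _∼_

_∼_ : (f g : (N : ℕ) → .⦃ ℕ.NonZero N ⦄ → ℝ) → Set
f ∼ g = ∀ (ε : ℝ) → ι 0ℚ <ᴿ ε →
  ∃ λ N₀ → ∀ N → .⦃ _ : ℕ.NonZero N ⦄ → N₀ ℕ.≤ N →
    Σ (g N #0) λ gN#0 → ∣ f N /ᴿ g N [ gN#0 ] -ᴿ ι 1ℚ ∣ᴿ <ᴿ ε

infix 4 _≡_[mod_] _≡?_[mod_]

_≡_[mod_] : ℤ → ℤ → ℕ → Set
x ≡ y [mod d ] = ℤ.+ d ∣ℤ x ℤ.- y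

_≡?_[mod_] : ∀ x y d → Dec (x ≡ y [mod d ])
x ≡? y [mod d ] = d ∣? ℤ.∣ x ℤ.- y ∣

[1⋯_] : ℕ → List ℕ
[1⋯ n ] = applyUpTo suc n

g : ℕ → ℕ
g d = length (filter (λ x → (ℤ.+ x) ℤ.^ 2 ≡? ℤ.1ℤ [mod d ]) [1⋯ d ])

-- Substituting x = 2y + 1 gives g(d) = ρ(d) − ρ(d/2) + 2 ρ(d/4), where ρ(m) counts the y modulo m with
-- m ∣ y (y + 1) and ρ vanishes off the integers. By the Chinese remainder theorem ρ(m) counts the
-- factorisations m = a b into coprime factors, so sorting all pairs a b ≤ N by their gcd e gives, for
-- R(N) = Σ_{m ≤ N} ρ(m), the identity Σ_e R(N/e²) = Σ_{a ≤ N} ⌊N/a⌋ = N H_N + O(N). The same recursion holds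
-- up to O(N) for N H_N / ζ(2), and since Σ_{e ≥ 2} 1/e² < 1 strong induction on N bounds the difference
-- by O(N) without Möbius inversion.
--
-- For ζ(2) = π²/6, the Riemann sums of 1/(1 + t²) give Leibniz's series L for π/4, and expanding
-- 2 L² − Σ 1/(2k + 1)² by partial fractions leaves alternating tails of size O(H_n / n).
--
-- Everything is carried out over ℚ: ζ(2) is replaced by a partial sum Z J, with J depending only on ε.
module Submission where

open import Defs

-- Reals are Cauchy sequences of rationals, and `∼` is proved term by term: at a late index k the
-- quotient is a rational number, and every estimate is an inequality between rationals with
-- explicit constants. Besides the O(N) errors this leaves two errors of relative size η. Freezing Z
-- at J adds Φ(n)/J to the bound of the induction, since Z n exceeds Z J by up to 1/J; and π² at
-- index k agrees with 6 Z J only up to a multiple of η. Both are harmless because they are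
-- relative, while the O(N) terms lose against N log N through the divergence of H. The choices are
-- nested accordingly: η from ε, then J from η so that H(J)/J ≤ η, N₀ from ε, and last the index K,
-- which depends on N. The logarithm enters only through H_N - 2 ≤ log N ≤ H_N, valid for all late
-- terms of its sequence.

module Counting where
  open import Data.Nat
  open import Data.Nat.Properties
  open import Data.Nat.Divisibility
  open import Data.Nat.DivMod
  open import Data.Nat.GCD
  open import Data.Nat.Coprimality as Coprimality
    using (Coprime; coprime?; coprime-divisor; coprime-Bézout; coprime⇒gcd≡1; gcd≡1⇒coprime)
  open import Data.Nat.ListAction using (sum)
  open import Data.Nat.Tactic.RingSolver using (solve)
  import Data.Integer as ℤ
  import Data.Integer.Properties as ℤₚ
  import Data.Integer.Tactic.RingSolver as ℤ-Solver
  open import Data.List using ([]; _∷_; applyUpTo; filter; length; map)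
  open import Data.Product using (∃; ∃₂; _×_; _,_; proj₁; proj₂)
  open import Data.Sum using (_⊎_; inj₁; inj₂)
  open import Data.Bool using (if_then_else_)
  open import Function using (_∘_)
  open import Relation.Binary.PropositionalEquality
  open import Relation.Nullary using (Dec; yes; no; ¬_; does; contradiction; _×-dec_)
  open import Relation.Unary using (Decidable)

  -- Finite sums and indicator functions over ℕ

  S : (ℕ → ℕ) → ℕ → ℕ
  S f zero    = 0
  S f (suc n) = S f n + f n

  S-cong : ∀ {f h} n → (∀ i → i < n → f i ≡ h i) → S f n ≡ S h n
  S-cong zero    f≡h = refl
  S-cong (suc n) f≡h = cong₂ _+_ (S-cong n λ i i<n → f≡h i (m<n⇒m<1+n i<n)) (f≡h n ≤-refl)

  S-cong′ : ∀ {f h} n → (∀ i → f i ≡ h i) → S f n ≡ S h n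
  S-cong′ n f≡h = S-cong n λ i _ → f≡h i

  S-zero : ∀ {f} n → (∀ i → i < n → f i ≡ 0) → S f n ≡ 0
  S-zero zero    f≡0 = refl
  S-zero (suc n) f≡0 = cong₂ _+_ (S-zero n λ i i<n → f≡0 i (m<n⇒m<1+n i<n)) (f≡0 n ≤-refl)

  S-+ : ∀ f h n → S (λ i → f i + h i) n ≡ S f n + S h n
  S-+ f h zero    = refl
  S-+ f h (suc n) = trans (cong (_+ (f n + h n)) (S-+ f h n))
    (interchange (S f n) (S h n) (f n) (h n))
    where
    interchange : ∀ a b c d → a + b + (c + d) ≡ a + c + (b + d)
    interchange a b c d = solve (a ∷ b ∷ c ∷ d ∷ [])

  S-* : ∀ c f n → S (λ i → c * f i) n ≡ c * S f n
  S-* c f zero    = sym (*-zeroʳ c)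
  S-* c f (suc n) = trans (cong (_+ c * f n) (S-* c f n)) (sym (*-distribˡ-+ c (S f n) (f n)))

  S-swap : ∀ (f : ℕ → ℕ → ℕ) m n → S (λ i → S (f i) m) n ≡ S (λ j → S (λ i → f i j) n) m
  S-swap f m zero    = sym (S-zero m λ _ _ → refl)
  S-swap f m (suc n) = trans (cong (_+ S (f n) m) (S-swap f m n))
    (sym (S-+ (λ j → S (λ i → f i j) n) (f n) m))

  S-append : ∀ f m n → S f (m + n) ≡ S f m + S (λ i → f (m + i)) n
  S-append f m zero    = trans (cong (S f) (+-identityʳ m)) (sym (+-identityʳ (S f m)))
  S-append f m (suc n) = trans (cong (S f) (+-suc m n))
    (trans (cong (_+ f (m + n)) (S-append f m n)) (+-assoc (S f m) _ (f (m + n))))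

  S-front : ∀ f n → S f (suc n) ≡ f 0 + S (f ∘ suc) n
  S-front f n = S-append f 1 n

  S-parity : ∀ f m → S f (m * 2) ≡ S (λ i → f (i * 2)) m + S (λ i → f (suc (i * 2))) m
  S-parity f zero    = refl
  S-parity f (suc m) = trans (cong (λ s → s + f (m * 2) + f (suc (m * 2))) (S-parity f m))
    (rearrange (S (λ i → f (i * 2)) m) _ (f (m * 2)) (f (suc (m * 2))))
    where
    rearrange : ∀ a b c d → a + b + c + d ≡ a + c + (b + d)
    rearrange a b c d = solve (a ∷ b ∷ c ∷ d ∷ [])

  S-single : ∀ f n i → i < n → (∀ j → j < n → j ≢ i → f j ≡ 0) → S f n ≡ f i
  S-single f (suc n) i i<1+n f≡0 with i ≟ n
  ... | yes refl = cong (_+ f n) (S-zero n λ j j<n → f≡0 j (m<n⇒m<1+n j<n) (<⇒≢ j<n))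
  ... | no i≢n   = trans
    (cong₂ _+_ (S-single f n i (≤∧≢⇒< (s≤s⁻¹ i<1+n) i≢n) λ j j<n → f≡0 j (m<n⇒m<1+n j<n))
               (f≡0 n ≤-refl (≢-sym i≢n)))
    (+-identityʳ (f i))

  S-extend : ∀ f {m n} → m ≤ n → (∀ i → m ≤ i → f i ≡ 0) → S f n ≡ S f m
  S-extend f {m} {n} m≤n f≡0 = trans (cong (S f) (sym (m+[n∸m]≡n m≤n)))
    (trans (S-append f m (n ∸ m))
      (trans (cong (S f m +_) (S-zero (n ∸ m) λ i _ → f≡0 (m + i) (m≤m+n m i)))
        (+-identityʳ (S f m))))

  χ : ∀ {p} {P : Set p} → Dec P → ℕ
  χ P? = if does P? then 1 else 0

  χ-yes : ∀ {p} {P : Set p} (P? : Dec P) → P → χ P? ≡ 1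
  χ-yes (yes _) _ = refl
  χ-yes (no ¬p) p = contradiction p ¬p

  χ-no : ∀ {p} {P : Set p} (P? : Dec P) → ¬ P → χ P? ≡ 0
  χ-no (yes p) ¬p = contradiction p ¬p
  χ-no (no _)  _  = refl

  χ-cong : ∀ {p q} {P : Set p} {Q : Set q} (P? : Dec P) (Q? : Dec Q) →
    (P → Q) → (Q → P) → χ P? ≡ χ Q?
  χ-cong (yes p) Q? to from = sym (χ-yes Q? (to p))
  χ-cong (no ¬p) Q? to from = sym (χ-no Q? (¬p ∘ from))

  χ-× : ∀ {p q} {P : Set p} {Q : Set q} (P? : Dec P) (Q? : Dec Q) → χ (P? ×-dec Q?) ≡ χ P? * χ Q?
  χ-× (yes _) (yes _) = refl
  χ-× (yes _) (no _)  = refl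
  χ-× (no _)  _       = refl

  S-χ-unique : ∀ {P : ℕ → Set} (P? : Decidable P) {n i} → i < n → P i →
    (∀ {j} → j < n → P j → j ≡ i) → S (λ j → χ (P? j)) n ≡ 1
  S-χ-unique P? {n} {i} i<n pi unique = trans
    (S-single (λ j → χ (P? j)) n i i<n λ j j<n j≢i → χ-no (P? j) (j≢i ∘ unique j<n)) (χ-yes (P? i) pi)

  S-χ-unique₂ : ∀ {P : ℕ → ℕ → Set} (P? : ∀ i j → Dec (P i j)) {n i j} → i < n → j < n → P i j →
    (∀ {k l} → P k l → k ≡ i × l ≡ j) → S (λ k → S (λ l → χ (P? k l)) n) n ≡ 1
  S-χ-unique₂ P? {n} {i} {j} i<n j<n pij unique = trans
    (S-single (λ k → S (λ l → χ (P? k l)) n) n i i<n λ k _ k≢i →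
      S-zero n λ l _ → χ-no (P? k l) (k≢i ∘ proj₁ ∘ unique))
    (S-χ-unique (P? i) j<n pij λ _ → proj₂ ∘ unique)

  S-filter : ∀ {P : ℕ → Set} (P? : Decidable P) f n →
    length (filter P? (applyUpTo f n)) ≡ S (λ i → χ (P? (f i))) n
  S-filter P? f zero    = refl
  S-filter P? f (suc n) = trans (head (applyUpTo (f ∘ suc) n))
    (trans (cong (χ (P? (f 0)) +_) (S-filter P? (f ∘ suc) n))
           (sym (S-front (λ i → χ (P? (f i))) n)))
    where
    head : ∀ xs → length (filter P? (f 0 ∷ xs)) ≡ χ (P? (f 0)) + length (filter P? xs)
    head xs with P? (f 0)
    ... | yes _ = refl
    ... | no  _ = refl

  S-sum : ∀ (h f : ℕ → ℕ) n → sum (map h (applyUpTo f n)) ≡ S (h ∘ f) n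
  S-sum h f zero    = refl
  S-sum h f (suc n) = trans (cong (h (f 0) +_) (S-sum h (f ∘ suc) n)) (sym (S-front (h ∘ f) n))

  χ-∣-shift : ∀ d {a b} c → a ≡ b + d * c → χ (d ∣? a) ≡ χ (d ∣? b)
  χ-∣-shift d {a} {b} c refl = χ-cong (d ∣? (b + d * c)) (d ∣? b)
    (λ d∣ → ∣m+n∣m⇒∣n (subst (d ∣_) (+-comm b (d * c)) d∣) (m∣m*n c))
    (λ d∣b → ∣m∣n⇒∣m+n d∣b (m∣m*n c))

  χ-∣-cong : ∀ d {a b} → a ≡ b → χ (d ∣? a) ≡ χ (d ∣? b)
  χ-∣-cong d = cong (λ n → χ (d ∣? n))

  χ-∣-*ʳ : ∀ d n k .⦃ _ : NonZero k ⦄ → χ (d * k ∣? n * k) ≡ χ (d ∣? n)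
  χ-∣-*ʳ d n k = χ-cong (d * k ∣? n * k) (d ∣? n) (*-cancelʳ-∣ k) (*-monoˡ-∣ k)

  χ-∣-coprime : ∀ {d k} → Coprime d k → ∀ n → χ (d ∣? k * n) ≡ χ (d ∣? n)
  χ-∣-coprime {d} {k} c n = χ-cong (d ∣? k * n) (d ∣? n) (coprime-divisor c) (∣n⇒∣m*n k)

  χ-∣-parity : ∀ n → χ (2 ∣? n) + χ (2 ∣? suc n) ≡ 1
  χ-∣-parity zero    = refl
  χ-∣-parity (suc n) = trans
    (cong (χ (2 ∣? suc n) +_) (χ-∣-shift 2 1 (+-comm 2 n)))
    (trans (+-comm (χ (2 ∣? suc n)) (χ (2 ∣? n))) (χ-∣-parity n))

  -- Roots of y (y + 1) modulo m and their relation to g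

  ρ : ℕ → ℕ
  ρ m = S (λ y → χ (m ∣? y * suc y)) m

  odd-coprime-2 : ∀ k → Coprime (suc (k * 2)) 2
  odd-coprime-2 k {d} (d∣m , d∣2) = ∣1⇒≡1 (∣m+n∣m⇒∣n
    (subst (d ∣_) (+-comm 1 (k * 2)) d∣m) (∣n⇒∣m*n k d∣2))

  coprime-*-∣ : ∀ {a b n} → Coprime a b → a ∣ n → b ∣ n → a * b ∣ n
  coprime-*-∣ {a} {b} c (divides-refl q) b∣qa = subst (a * b ∣_) (*-comm a q)
    (*-monoʳ-∣ a (coprime-divisor (Coprimality.sym c) (subst (b ∣_) (*-comm q a) b∣qa)))

  2∣pronic : ∀ y → 2 ∣ y * suc y
  2∣pronic zero    = 2 ∣0
  2∣pronic (suc y) = subst (2 ∣_) (step y) (∣m∣n⇒∣m+n (2∣pronic y) (m∣m*n (suc y)))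
    where
    step : ∀ y → y * suc y + 2 * suc y ≡ suc y * suc (suc y)
    step y = solve (y ∷ [])

  -- With x = i + 1, the difference x² - 1 is i (i + 2).
  g-as-S : ∀ d → g d ≡ S (λ i → χ (d ∣? i * (2 + i))) d
  g-as-S d = trans (S-filter (λ x → (ℤ.+ x) ℤ.^ 2 ≡? ℤ.1ℤ [mod d ]) suc d)
    (S-cong′ d λ i → χ-∣-cong d (cong ℤ.∣_∣ (trans (square (ℤ.+ i)) (sym (ℤₚ.pos-* i (2 + i))))))
    where
    square : ∀ x → (ℤ.1ℤ ℤ.+ x) ℤ.* ((ℤ.1ℤ ℤ.+ x) ℤ.* ℤ.1ℤ) ℤ.- ℤ.1ℤ ≡ x ℤ.* (ℤ.+ 2 ℤ.+ x)
    square = ℤ-Solver.solve-∀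

  -- For odd i the product i (i + 2) is odd, so only i = 2 y survives, and there i (i + 2) = 4 y (y
  -- + 1) loses one factor 2 to the modulus.
  g-even : ∀ m → g (m * 2) ≡ S (λ y → χ (m ∣? 2 * (y * suc y))) m
  g-even m = trans (g-as-S (m * 2)) (trans (S-parity F m)
    (trans (cong₂ _+_
      (S-cong′ m λ y → trans (χ-∣-cong (m * 2) (even y)) (χ-∣-*ʳ m (2 * (y * suc y)) 2))
      (S-zero m λ y _ → χ-no (m * 2 ∣? suc (y * 2) * (2 + suc (y * 2))) (not-even y)))
    (+-identityʳ _)))
    where
    F : ℕ → ℕ
    F i = χ (m * 2 ∣? i * (2 + i))
    even : ∀ y → y * 2 * (2 + y * 2) ≡ 2 * (y * suc y) * 2
    even y = solve (y ∷ [])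
    odd : ∀ y → suc (y * 2) * (2 + suc (y * 2)) ≡ (1 + 4 * y + 2 * y * y) * 2 + 1
    odd y = solve (y ∷ [])
    not-even : ∀ y → ¬ (m * 2 ∣ suc (y * 2) * (2 + suc (y * 2)))
    not-even y m2∣ with () ← ∣1⇒≡1 (∣m+n∣m⇒∣n
      (subst (2 ∣_) (odd y) (m*n∣⇒n∣ m 2 m2∣)) (n∣m*n (1 + 4 * y + 2 * y * y)))

  -- Doubling permutes the residues modulo an odd d, and i = 2 y is a solution exactly when d
  -- divides y (y + 1). Even i are 2 y with y ≤ k; odd i are 2 y - d with y > k.
  g-odd : ∀ k → g (suc (k * 2)) ≡ ρ (suc (k * 2))
  g-odd k = begin
    g d                                                   ≡⟨ g-as-S d ⟩
    S F (k * 2) + F (k * 2)                               ≡⟨ cong (_+ F (k * 2)) (S-parity F k) ⟩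
    S (λ i → F (i * 2)) k + S F′ k + F (k * 2)            ≡⟨ rearrange (S (λ i → F (i * 2)) k) (S F′ k) (F (k * 2)) ⟩
    S (λ i → F (i * 2)) (suc k) + S F′ k                  ≡⟨ cong₂ _+_ (S-cong′ (suc k) F-double) (S-cong′ k F-wrap) ⟩
    S h (suc k) + S (λ i → h (suc k + i)) k               ≡⟨ S-append h (suc k) k ⟨
    S h (suc k + k)                                       ≡⟨ cong (S h) (halves k) ⟩
    ρ d                                                   ∎
    where
    open ≡-Reasoning
    d = suc (k * 2)
    F h F′ : ℕ → ℕ
    F i = χ (d ∣? i * (2 + i))
    h y = χ (d ∣? y * suc y)
    F′ i = F (suc (i * 2))
    rearrange : ∀ a b c → a + b + c ≡ a + c + b
    rearrange a b c = solve (a ∷ b ∷ c ∷ [])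
    halves : ∀ k → suc k + k ≡ suc (k * 2)
    halves k = solve (k ∷ [])
    F-double : ∀ y → F (y * 2) ≡ h y
    F-double y = trans (χ-∣-cong d (double y)) (trans
      (χ-∣-coprime (odd-coprime-2 k) (2 * (y * suc y))) (χ-∣-coprime (odd-coprime-2 k) (y * suc y)))
      where
      double : ∀ y → y * 2 * (2 + y * 2) ≡ 2 * (2 * (y * suc y))
      double y = solve (y ∷ [])
    F-wrap : ∀ i → F′ i ≡ h (suc k + i)
    F-wrap i = trans (sym (χ-∣-shift d (4 * i + k * 2 + 5) (wrap k i))) (F-double (suc k + i))
      where
      wrap : ∀ k i → (suc k + i) * 2 * (2 + (suc k + i) * 2) ≡
        suc (i * 2) * (2 + suc (i * 2)) + suc (k * 2) * (4 * i + k * 2 + 5)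
      wrap k i = solve (k ∷ i ∷ [])

  χ-∣-period : ∀ m y → χ (m ∣? (m + y) * suc (m + y)) ≡ χ (m ∣? y * suc y)
  χ-∣-period m y = χ-∣-shift m (m + 2 * y + 1) (shift m y)
    where
    shift : ∀ m y → (m + y) * suc (m + y) ≡ y * suc y + m * (m + 2 * y + 1)
    shift m y = solve (m ∷ y ∷ [])

  ρ-two-periods : ∀ m → S (λ y → χ (m ∣? y * suc y)) (m * 2) ≡ 2 * ρ m
  ρ-two-periods m = trans (cong (S h) (double m)) (trans (S-append h m m)
    (trans (cong (ρ m +_) (S-cong′ m (χ-∣-period m))) (cong (ρ m +_) (sym (+-identityʳ (ρ m))))))
    where
    h : ℕ → ℕ
    h y = χ (m ∣? y * suc y)
    double : ∀ m → m * 2 ≡ m + m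
    double m = solve (m ∷ [])

  -- Since y (y + 1) is always even, the extra factor 2 in the modulus imposes no condition and only
  -- doubles the range of y.
  ρ-2*odd : ∀ k → ρ (suc (k * 2) * 2) ≡ 2 * ρ (suc (k * 2))
  ρ-2*odd k = trans (S-cong′ (m * 2) λ y → χ-cong (m * 2 ∣? y * suc y) (m ∣? y * suc y)
      (m*n∣⇒m∣ m 2) λ m∣ → coprime-*-∣ (odd-coprime-2 k) m∣ (2∣pronic y))
    (ρ-two-periods m)
    where m = suc (k * 2)

  -- A root y modulo m = 2 k has the two lifts y and m + y modulo 2 m, and exactly one of them is
  -- again a root.
  ρ-2*even : ∀ k .⦃ _ : NonZero k ⦄ → ρ (k * 2 * 2) ≡ ρ (k * 2)
  ρ-2*even k = trans (cong (S h) (double m)) (trans (S-append h m m)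
    (trans (sym (S-+ h (λ y → h (m + y)) m)) (S-cong′ m combine)))
    where
    instance
      k2≢0 : NonZero (k * 2)
      k2≢0 = m*n≢0 k 2
    m = k * 2
    h : ℕ → ℕ
    h y = χ (m * 2 ∣? y * suc y)
    double : ∀ m → m * 2 ≡ m + m
    double m = solve (m ∷ [])
    shift : ∀ k y → (k * 2 + y) * suc (k * 2 + y) ≡ y * suc y + k * 2 * (k * 2 + 2 * y + 1)
    shift k y = solve (k ∷ y ∷ [])
    shift′ : ∀ k y c → c * (k * 2) + k * 2 * (k * 2 + 2 * y + 1) ≡ suc c * (k * 2) + k * 2 * 2 * (k + y)
    shift′ k y c = solve (k ∷ y ∷ c ∷ [])
    χ-m2 : ∀ c → χ (m * 2 ∣? c * m) ≡ χ (2 ∣? c)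
    χ-m2 c = trans (cong (λ d → χ (d ∣? c * m)) (*-comm m 2)) (χ-∣-*ʳ 2 c m)
    -- If y (y + 1) = c m with m even, then (m + y)(m + y + 1) ≡ (c + 1) m mod 2 m.
    combine : ∀ y → h y + h (m + y) ≡ χ (m ∣? y * suc y)
    combine y with m ∣? y * suc y
    ... | yes (divides c eq) = trans (cong₂ _+_
        (trans (χ-∣-cong (m * 2) eq) (χ-m2 c))
        (trans (χ-∣-cong (m * 2) (trans (shift k y)
                  (trans (cong (_+ k * 2 * (k * 2 + 2 * y + 1)) eq) (shift′ k y c))))
               (trans (χ-∣-shift (m * 2) (k + y) refl) (χ-m2 (suc c)))))
      (χ-∣-parity c)
    ... | no m∤ = cong₂ _+_
      (χ-no (m * 2 ∣? y * suc y) (m∤ ∘ m*n∣⇒m∣ m 2))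
      (χ-no (m * 2 ∣? (m + y) * suc (m + y)) λ m2∣ → m∤ (∣m+n∣m⇒∣n
        (subst (m ∣_) (trans (shift k y) (+-comm (y * suc y) _)) (m*n∣⇒m∣ m 2 m2∣))
        (m∣m*n (k * 2 + 2 * y + 1))))

  g-2*odd : ∀ k → g (suc (k * 2) * 2) + ρ (suc (k * 2)) ≡ ρ (suc (k * 2) * 2)
  g-2*odd k = trans (cong (_+ ρ m)
      (trans (g-even m) (S-cong′ m λ y → χ-∣-coprime (odd-coprime-2 k) (y * suc y))))
    (trans (cong (ρ m +_) (sym (+-identityʳ (ρ m)))) (sym (ρ-2*odd k)))
    where m = suc (k * 2)

  -- Already g(4 k) = 2 ρ(k); adding ρ(2 k) = ρ(4 k) brings it to the three-term shape shared by the
  -- other classes of d modulo 4.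
  g-4* : ∀ k .⦃ _ : NonZero k ⦄ → g (k * 2 * 2) + ρ (k * 2) ≡ ρ (k * 2 * 2) + 2 * ρ k
  g-4* k = trans (cong₂ _+_
      (trans (g-even (k * 2)) (trans
        (S-cong′ (k * 2) λ y → trans (χ-∣-cong (k * 2) (*-comm 2 (y * suc y))) (χ-∣-*ʳ k (y * suc y) 2))
        (ρ-two-periods k)))
      (sym (ρ-2*even k)))
    (+-comm (2 * ρ k) _)

  -- Summatory functions of g and ρ

  G R : ℕ → ℕ
  G = S (g ∘ suc)
  R = S (ρ ∘ suc)

  -- Pointwise, g(d) = ρ(d) − ρ(d/2) + 2 ρ(d/4), with ρ = 0 off the integers.
  G-R-4* : ∀ q → G (q * 2 * 2) + R (q * 2) ≡ R (q * 2 * 2) + 2 * R q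
  G-R-4* zero    = refl
  G-R-4* (suc q) = begin
    G n + g₁ + g₂ + g₃ + g₄ + (R (q * 2) + ρ m₁ + ρ m₂)
      ≡⟨ rearrange (G n) g₁ g₂ g₃ g₄ (R (q * 2)) (ρ m₁) (ρ m₂) ⟩
    (G n + R (q * 2)) + g₁ + (g₂ + ρ m₁) + g₃ + (g₄ + ρ m₂)
      ≡⟨ cong₂ _+_ (cong₂ _+_ (cong₂ _+_ (cong₂ _+_ (G-R-4* q) (g-odd (q * 2))) (g-2*odd q)) (g-odd m₁)) (g-4* (suc q)) ⟩
    (R n + 2 * R q) + ρ (1 + n) + ρ (2 + n) + ρ (3 + n) + (ρ (4 + n) + 2 * ρ (suc q))
      ≡⟨ rearrange′ (R n) (R q) (ρ (1 + n)) (ρ (2 + n)) (ρ (3 + n)) (ρ (4 + n)) (ρ (suc q)) ⟩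
    R n + ρ (1 + n) + ρ (2 + n) + ρ (3 + n) + ρ (4 + n) + 2 * (R q + ρ (suc q)) ∎
    where
    open ≡-Reasoning
    n = q * 2 * 2
    m₁ = suc (q * 2)
    m₂ = suc q * 2
    g₁ = g (1 + n)
    g₂ = g (2 + n)
    g₃ = g (3 + n)
    g₄ = g (4 + n)
    rearrange : ∀ a b c d e f h i →
      a + b + c + d + e + (f + h + i) ≡ (a + f) + b + (c + h) + d + (e + i)
    rearrange a b c d e f h i = solve (a ∷ b ∷ c ∷ d ∷ e ∷ f ∷ h ∷ i ∷ [])
    rearrange′ : ∀ a b c d e f h →
      (a + 2 * b) + c + d + e + (f + 2 * h) ≡ a + c + d + e + f + 2 * (b + h)
    rearrange′ a b c d e f h = solve (a ∷ b ∷ c ∷ d ∷ e ∷ f ∷ h ∷ [])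

  mod-4-cases : ∀ n → ∃ λ q →
    n ≡ q * 2 * 2 ⊎ n ≡ 1 + q * 2 * 2 ⊎ n ≡ 2 + q * 2 * 2 ⊎ n ≡ 3 + q * 2 * 2
  mod-4-cases 0 = 0 , inj₁ refl
  mod-4-cases 1 = 0 , inj₂ (inj₁ refl)
  mod-4-cases 2 = 0 , inj₂ (inj₂ (inj₁ refl))
  mod-4-cases 3 = 0 , inj₂ (inj₂ (inj₂ refl))
  mod-4-cases (suc (suc (suc (suc n)))) with mod-4-cases n
  ... | q , inj₁ refl               = suc q , inj₁ refl
  ... | q , inj₂ (inj₁ refl)        = suc q , inj₂ (inj₁ refl)
  ... | q , inj₂ (inj₂ (inj₁ refl)) = suc q , inj₂ (inj₂ (inj₁ refl))
  ... | q , inj₂ (inj₂ (inj₂ refl)) = suc q , inj₂ (inj₂ (inj₂ refl))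

  -- m = ⌊n/2⌋ and k = ⌊n/4⌋.
  G-via-R : ∀ n → ∃₂ λ m k →
    G n + R m ≡ R n + 2 * R k × k * 2 ≤ m × m ≤ suc (k * 2) × m * 2 ≤ n
  G-via-R n with mod-4-cases n
  ... | q , inj₁ refl = q * 2 , q , G-R-4* q , ≤-refl , n≤1+n _ , ≤-refl
  ... | q , inj₂ (inj₁ refl) = q * 2 , q , eq , ≤-refl , n≤1+n _ , n≤1+n _
    where
    N = q * 2 * 2
    swap-last : ∀ a b c → a + b + c ≡ a + c + b
    swap-last a b c = solve (a ∷ b ∷ c ∷ [])
    eq : G N + g (1 + N) + R (q * 2) ≡ R N + ρ (1 + N) + 2 * R q
    eq = trans (swap-last (G N) (g (1 + N)) (R (q * 2)))
      (trans (cong₂ _+_ (G-R-4* q) (g-odd (q * 2))) (swap-last (R N) (2 * R q) (ρ (1 + N))))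
  ... | q , inj₂ (inj₂ (inj₁ refl)) = suc (q * 2) , q , eq , n≤1+n _ , ≤-refl , ≤-refl
    where
    N = q * 2 * 2
    rearrange : ∀ a b c d e → a + b + c + (d + e) ≡ a + d + b + (c + e)
    rearrange a b c d e = solve (a ∷ b ∷ c ∷ d ∷ e ∷ [])
    rearrange′ : ∀ a b c d → a + b + c + d ≡ a + c + d + b
    rearrange′ a b c d = solve (a ∷ b ∷ c ∷ d ∷ [])
    eq : G N + g (1 + N) + g (2 + N) + (R (q * 2) + ρ (suc (q * 2))) ≡
         R N + ρ (1 + N) + ρ (2 + N) + 2 * R q
    eq = trans (rearrange (G N) (g (1 + N)) (g (2 + N)) (R (q * 2)) (ρ (suc (q * 2))))
      (trans (cong₂ _+_ (cong₂ _+_ (G-R-4* q) (g-odd (q * 2))) (g-2*odd q))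
             (rearrange′ (R N) (2 * R q) (ρ (1 + N)) (ρ (2 + N))))
  ... | q , inj₂ (inj₂ (inj₂ refl)) = suc (q * 2) , q , eq , n≤1+n _ , ≤-refl , n≤1+n _
    where
    N = q * 2 * 2
    rearrange : ∀ a b c d e f → a + b + c + f + (d + e) ≡ a + d + b + (c + e) + f
    rearrange a b c d e f = solve (a ∷ b ∷ c ∷ d ∷ e ∷ f ∷ [])
    rearrange′ : ∀ a b c d e → a + b + c + d + e ≡ a + c + d + e + b
    rearrange′ a b c d e = solve (a ∷ b ∷ c ∷ d ∷ e ∷ [])
    eq : G N + g (1 + N) + g (2 + N) + g (3 + N) + (R (q * 2) + ρ (suc (q * 2))) ≡
         R N + ρ (1 + N) + ρ (2 + N) + ρ (3 + N) + 2 * R q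
    eq = trans (rearrange (G N) (g (1 + N)) (g (2 + N)) (R (q * 2)) (ρ (suc (q * 2))) (g (3 + N)))
      (trans (cong₂ _+_ (cong₂ _+_ (cong₂ _+_ (G-R-4* q) (g-odd (q * 2))) (g-2*odd q)) (g-odd (suc (q * 2))))
             (rearrange′ (R N) (2 * R q) (ρ (1 + N)) (ρ (2 + N)) (ρ (3 + N))))

  -- Chinese remainder theorem and coprime factorisations

  crt-root : ∀ a b .⦃ _ : NonZero a ⦄ .⦃ _ : NonZero b ⦄ → Coprime a b →
    ∃ λ y → y < a * b × a ∣ y × b ∣ suc y
  crt-root a b c = reduce (solution (coprime-Bézout c))
    where
    open Bézout using (+-; -+)
    instance
      ab≢0 : NonZero (a * b)
      ab≢0 = m*n≢0 a b
    solution : Bézout.Identity 1 a b → ∃ λ y → a ∣ y × b ∣ suc y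
    solution (-+ s t eq) = s * a , n∣m*n s , subst (b ∣_) (sym eq) (n∣m*n t)
    -- Here s a = 1 + t b, so multiplying by b - 1, which is -1 modulo b, turns s a into a solution.
    solution (+- s t eq) = s * a * pred b , ∣m⇒∣m*n (pred b) (n∣m*n s)
      , subst (b ∣_) (trans (rearrange t b (pred b) (sym (suc-pred b))) (cong (λ z → suc (z * pred b)) eq))
          (m∣m*n (suc (t * pred b)))
      where
      rearrange : ∀ t b p → b ≡ suc p → b * suc (t * p) ≡ suc (suc (t * b) * p)
      rearrange t .(suc p) p refl = solve (t ∷ p ∷ [])
    reduce : (∃ λ y → a ∣ y × b ∣ suc y) → ∃ λ y → y < a * b × a ∣ y × b ∣ suc y
    reduce (y , a∣y , b∣1+y) = y % (a * b) , m%n<n y (a * b)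
      , %-presˡ-∣ a∣y (m∣m*n b)
      , ∣m+n∣m⇒∣n (subst (b ∣_) (trans (cong suc (m≡m%n+[m/n]*n y (a * b))) (+-comm (suc (y % (a * b))) _)) b∣1+y)
          (∣n⇒∣m*n (y / (a * b)) (n∣m*n a))

  crt-unique : ∀ a b {y z} → Coprime a b → y ≤ z → z < a * b →
    a ∣ y → b ∣ suc y → a ∣ z → b ∣ suc z → y ≡ z
  crt-unique a b {y} {z} c y≤z z<ab a∣y b∣1+y a∣z b∣1+z with z ∸ y in eq
  ... | zero  = ≤-antisym y≤z (m∸n≡0⇒m≤n eq)
  ... | suc k = contradiction
    (≤-trans (∣⇒≤ (coprime-*-∣ c (diff z≡y+ a∣y a∣z) (diff (cong suc z≡y+) b∣1+y b∣1+z)))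
             (subst (_≤ z) eq (m∸n≤m z y)))
    (<⇒≱ z<ab)
    where
    z≡y+ : z ≡ y + suc k
    z≡y+ = trans (sym (m+[n∸m]≡n y≤z)) (cong (y +_) eq)
    diff : ∀ {d u v} → v ≡ u + suc k → d ∣ u → d ∣ v → d ∣ suc k
    diff refl d∣u d∣v = ∣m+n∣m⇒∣n d∣v d∣u

  S-χ-crt : ∀ a b .⦃ _ : NonZero a ⦄ .⦃ _ : NonZero b ⦄ → Coprime a b →
    S (λ y → χ ((a ∣? y) ×-dec (b ∣? suc y))) (a * b) ≡ 1
  S-χ-crt a b c with crt-root a b c
  ... | y , y<ab , a∣y , b∣1+y = S-χ-unique (λ z → (a ∣? z) ×-dec (b ∣? suc z)) y<ab (a∣y , b∣1+y) unique
    where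
    unique : ∀ {z} → z < a * b → a ∣ z × b ∣ suc z → z ≡ y
    unique {z} z<ab (a∣z , b∣1+z) with ≤-total z y
    ... | inj₁ z≤y = crt-unique a b c z≤y y<ab a∣z b∣1+z a∣y b∣1+y
    ... | inj₂ y≤z = sym (crt-unique a b c y≤z z<ab a∣y b∣1+y a∣z b∣1+z)

  consecutive-coprime : ∀ {a b y} → a ∣ y → b ∣ suc y → Coprime a b
  consecutive-coprime {y = y} a∣y b∣1+y {d} (d∣a , d∣b) =
    ∣1⇒≡1 (∣m+n∣m⇒∣n (subst (d ∣_) (+-comm 1 y) (∣-trans d∣b b∣1+y)) (∣-trans d∣a a∣y))

  Factors : ℕ → ℕ → ℕ → Set
  Factors m a b = a * b ≡ m × Coprime a b

  factors? : ∀ m a b → Dec (Factors m a b)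
  factors? m a b = (a * b ≟ m) ×-dec coprime? a b

  -- Every y with m ∣ y (y + 1) splits m, uniquely, as gcd m y * gcd m (y + 1).
  Splits : ℕ → ℕ → ℕ → ℕ → Set
  Splits m y a b = Factors m a b × (a ∣ y × b ∣ suc y)

  splits? : ∀ m y a b → Dec (Splits m y a b)
  splits? m y a b = factors? m a b ×-dec ((a ∣? y) ×-dec (b ∣? suc y))

  -- From a b = c d, and a coprime to d because they divide consecutive numbers, follows a | c;
  -- exchanging the two pairs gives c | a.
  Splits-unique : ∀ {m y a b c d} .⦃ _ : NonZero a ⦄ →
    Splits m y a b → Splits m y c d → a ≡ c × b ≡ d
  Splits-unique {m} {y} {a} {b} {c} {d} ((ab≡m , _) , a∣y , b∣1+y) ((cd≡m , _) , c∣y , d∣1+y) = a≡c , b≡d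
    where
    divides-first : ∀ {a b c d} → a * b ≡ m → c * d ≡ m → a ∣ y → d ∣ suc y → a ∣ c
    divides-first {a} {b} {c} {d} ab≡m cd≡m a∣y d∣1+y = coprime-divisor (consecutive-coprime a∣y d∣1+y)
      (subst (a ∣_) (trans (trans ab≡m (sym cd≡m)) (*-comm c d)) (m∣m*n b))
    a≡c : a ≡ c
    a≡c = ∣-antisym (divides-first ab≡m cd≡m a∣y d∣1+y) (divides-first cd≡m ab≡m c∣y b∣1+y)
    b≡d : b ≡ d
    b≡d = *-cancelˡ-≡ b d a (trans ab≡m (trans (sym cd≡m) (cong (_* d) (sym a≡c))))

  -- Take a = gcd m y and b = m / a. Then b is coprime to y / a, and m | y (y + 1) gives b | (y / a)
  -- (y + 1), hence b | y + 1. `build` receives the gcd as a variable so that it can be matched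
  -- against `suc i`.
  Splits-exists : ∀ m y .⦃ _ : NonZero m ⦄ → m ∣ y * suc y →
    ∃₂ λ i j → i < m × j < m × Splits m y (suc i) (suc j)
  Splits-exists m y m∣ = build (gcd m y) refl (gcd[m,n]∣m m y) (gcd[m,n]∣n m y)
    where
    g≢0 : gcd m y ≢ 0
    g≢0 = gcd[m,n]≢0 m y (inj₁ (≢-nonZero⁻¹ m))
    build : ∀ a → a ≡ gcd m y → a ∣ m → a ∣ y →
      ∃₂ λ i j → i < m × j < m × Splits m y (suc i) (suc j)
    build zero    eq _ _ = contradiction (sym eq) g≢0
    build (suc i) eq (divides zero m≡0) _ = contradiction m≡0 (≢-nonZero⁻¹ m)
    build (suc i) eq (divides (suc j) m≡ba) (divides y′ y≡y′a) =
      i , j , ∣⇒≤ a∣m , ∣⇒≤ b∣m , (trans (*-comm a b) (sym m≡ba) , consecutive-coprime a∣y b∣1+y) , a∣y , b∣1+y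
      where
      a = suc i
      b = suc j
      a∣m : a ∣ m
      a∣m = divides b m≡ba
      b∣m : b ∣ m
      b∣m = divides a (trans m≡ba (*-comm b a))
      a∣y : a ∣ y
      a∣y = divides y′ y≡y′a
      gcd≡1 : gcd b y′ ≡ 1
      gcd≡1 = *-cancelˡ-≡ (gcd b y′) 1 a (trans (c*gcd[m,n]≡gcd[cm,cn] a b y′)
        (trans (cong₂ gcd (trans (*-comm a b) (sym m≡ba)) (trans (*-comm a y′) (sym y≡y′a)))
          (trans (sym eq) (sym (*-identityʳ a)))))
      b∣1+y : b ∣ suc y
      b∣1+y = coprime-divisor (gcd≡1⇒coprime {b} {y′} gcd≡1) (*-cancelʳ-∣ a
        (subst₂ _∣_ m≡ba (trans (cong (_* suc y) y≡y′a) (rotate y′ a (suc y))) m∣))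
        where
        rotate : ∀ p q r → p * q * r ≡ p * r * q
        rotate p q r = solve (p ∷ q ∷ r ∷ [])

  -- The square of side N, rather than m, gives all m ≤ N a common range of pairs; this is what lets
  -- `R-coprimePairs` swap the sums.
  χ-∣-pronic : ∀ N m y .⦃ _ : NonZero m ⦄ → m ≤ N →
    χ (m ∣? y * suc y) ≡ S (λ i → S (λ j → χ (splits? m y (suc i) (suc j))) N) N
  χ-∣-pronic N m y m≤N with m ∣? y * suc y
  ... | yes m∣ = let i , j , i<m , j<m , s = Splits-exists m y m∣ in sym
    (S-χ-unique₂ (λ i j → splits? m y (suc i) (suc j)) (<-≤-trans i<m m≤N) (<-≤-trans j<m m≤N) s
      λ s′ → let e₁ , e₂ = Splits-unique s′ s in suc-injective e₁ , suc-injective e₂)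
  ... | no m∤ = sym (S-zero N λ i _ → S-zero N λ j _ → χ-no (splits? m y (suc i) (suc j))
    λ ((ab≡m , _) , a∣y , b∣1+y) → m∤ (subst (_∣ y * suc y) ab≡m (*-pres-∣ a∣y b∣1+y)))

  S-χ-splits : ∀ m a b .⦃ _ : NonZero a ⦄ .⦃ _ : NonZero b ⦄ →
    S (λ y → χ (splits? m y a b)) m ≡ χ (factors? m a b)
  S-χ-splits m a b = trans (S-cong′ m λ y → χ-× (factors? m a b) ((a ∣? y) ×-dec (b ∣? suc y)))
    (trans (S-* (χ (factors? m a b)) (λ y → χ ((a ∣? y) ×-dec (b ∣? suc y))) m) (by-cases (factors? m a b)))
    where
    by-cases : ∀ (F? : Dec (Factors m a b)) →
      χ F? * S (λ y → χ ((a ∣? y) ×-dec (b ∣? suc y))) m ≡ χ F?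
    by-cases (yes (refl , c)) = trans (+-identityʳ _) (S-χ-crt a b c)
    by-cases (no _)           = refl

  ρ-factors : ∀ N m .⦃ _ : NonZero m ⦄ → m ≤ N →
    ρ m ≡ S (λ i → S (λ j → χ (factors? m (suc i) (suc j))) N) N
  ρ-factors N m m≤N = trans (S-cong′ m λ y → χ-∣-pronic N m y m≤N)
    (trans (S-swap (λ y i → S (λ j → χ (splits? m y (suc i) (suc j))) N) N m)
    (S-cong′ N λ i → trans (S-swap (λ y j → χ (splits? m y (suc i) (suc j))) N m)
    (S-cong′ N λ j → S-χ-splits m (suc i) (suc j))))

  -- Pairs under the hyperbola a b ≤ N, sorted by gcd

  coprimePair : ℕ → ℕ → ℕ → ℕ
  coprimePair n a b = χ (a * b ≤? n) * χ (coprime? a b)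

  R-coprimePairs : ∀ N n → n ≤ N →
    R n ≡ S (λ i → S (λ j → coprimePair n (suc i) (suc j)) N) N
  R-coprimePairs N n n≤N = trans (S-cong n λ k k<n → ρ-factors N (suc k) (≤-trans k<n n≤N))
    (trans (S-swap (λ k i → S (λ j → χ (factors? (suc k) (suc i) (suc j))) N) N n)
    (S-cong′ N λ i → trans (S-swap (λ k j → χ (factors? (suc k) (suc i) (suc j))) N n)
    (S-cong′ N λ j → collect (suc i) (suc j))))
    where
    products : ∀ i j → S (λ k → χ (suc i * suc j ≟ suc k)) n ≡ χ (suc i * suc j ≤? n)
    products i j = by-cases (suc i * suc j ≤? n)
      where
      by-cases : ∀ (le? : Dec (suc i * suc j ≤ n)) → S (λ k → χ (suc i * suc j ≟ suc k)) n ≡ χ le?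
      by-cases (yes ab≤n) = S-χ-unique (λ k → suc i * suc j ≟ suc k) {i = j + i * suc j} ab≤n refl
        λ _ eq → sym (suc-injective eq)
      by-cases (no ab≰n) = S-zero n λ k k<n → χ-no (suc i * suc j ≟ suc k)
        λ eq → ab≰n (subst (_≤ n) (sym eq) k<n)
    collect : ∀ a b .⦃ _ : NonZero a ⦄ .⦃ _ : NonZero b ⦄ →
      S (λ k → χ (factors? (suc k) a b)) n ≡ coprimePair n a b
    collect a@(suc i) b@(suc j) = trans
      (S-cong′ n λ k → trans (χ-× (a * b ≟ suc k) (coprime? a b)) (*-comm (χ (a * b ≟ suc k)) _))
      (trans (S-* (χ (coprime? a b)) (λ k → χ (a * b ≟ suc k)) n)
      (trans (*-comm (χ (coprime? a b)) _) (cong (_* χ (coprime? a b)) (products i j))))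

  S-multiples : ∀ (f : ℕ → ℕ) d .⦃ _ : NonZero d ⦄ → (∀ k → ¬ d ∣ k → f k ≡ 0) → ∀ n →
    S (f ∘ suc) (n * d) ≡ S (λ i → f (suc i * d)) n
  S-multiples f (suc d) f≡0 zero    = refl
  S-multiples f (suc d) f≡0 (suc n) = trans (cong (S (f ∘ suc)) (+-comm (suc d) (n * suc d)))
    (trans (S-append (f ∘ suc) (n * suc d) (suc d))
      (cong₂ _+_ (S-multiples f (suc d) f≡0 n)
        (cong₂ _+_ (S-zero d λ j j<d → f≡0 (suc (n * suc d + j)) (not-multiple j j<d))
                   (cong f (trans (sym (+-suc (n * suc d) d)) (+-comm (n * suc d) (suc d)))))))
    where
    not-multiple : ∀ j → j < d → ¬ suc d ∣ suc (n * suc d + j)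
    not-multiple j j<d d∣ = <⇒≱ (s≤s j<d) (∣⇒≤ (∣m+n∣m⇒∣n
      (subst (suc d ∣_) (sym (+-suc (n * suc d) j)) d∣) (n∣m*n n)))

  -- The range is first extended by zero terms to N d, which splits into N blocks of length d, each
  -- with one multiple of d. Keeping N on both sides avoids N / d and leaves one range for all d.
  S-multiples-bounded : ∀ (f : ℕ → ℕ) d .⦃ _ : NonZero d ⦄ N → (∀ k → ¬ d ∣ k → f k ≡ 0) →
    (∀ k → N < k → f k ≡ 0) → S (f ∘ suc) N ≡ S (λ i → f (suc i * d)) N
  S-multiples-bounded f d N f≡0 f≡0′ = trans
    (sym (S-extend (f ∘ suc) (m≤m*n N d) λ k N≤k → f≡0′ (suc k) (s≤s N≤k)))
    (S-multiples f d f≡0 N)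

  gcdPair : ℕ → ℕ → ℕ → ℕ → ℕ
  gcdPair N d a b = χ (a * b ≤? N) * χ (gcd a b ≟ d)

  gcdPair-scale : ∀ N d a b .⦃ _ : NonZero d ⦄ .⦃ _ : NonZero (d * d) ⦄ →
    gcdPair N d (a * d) (b * d) ≡ coprimePair (N / (d * d)) a b
  gcdPair-scale N d a b = cong₂ _*_
    (χ-cong (a * d * (b * d) ≤? N) (a * b ≤? N / (d * d))
      (λ le → subst (_≤ N / (d * d)) (m*n/n≡m (a * b) (d * d))
        (/-monoˡ-≤ (d * d) (subst (_≤ N) (regroup a b d) le)))
      (λ le → subst (_≤ N) (sym (regroup a b d))
        (≤-trans (*-monoˡ-≤ (d * d) le) (m/n*n≤m N (d * d)))))
    (χ-cong (gcd (a * d) (b * d) ≟ d) (coprime? a b)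
      (λ eq → gcd≡1⇒coprime (*-cancelˡ-≡ (gcd a b) 1 d
        (trans (scale a b d) (trans eq (sym (*-identityʳ d))))))
      (λ c → trans (sym (scale a b d)) (trans (cong (d *_) (coprime⇒gcd≡1 c)) (*-identityʳ d))))
    where
    regroup : ∀ a b d → a * d * (b * d) ≡ a * b * (d * d)
    regroup a b d = solve (a ∷ b ∷ d ∷ [])
    scale : ∀ a b d → d * gcd a b ≡ gcd (a * d) (b * d)
    scale a b d = trans (c*gcd[m,n]≡gcd[cm,cn] d a b) (cong₂ gcd (*-comm d a) (*-comm d b))

  S-gcdPair : ∀ N d .⦃ _ : NonZero d ⦄ .⦃ _ : NonZero (d * d) ⦄ →
    S (λ i → S (λ j → gcdPair N d (suc i) (suc j)) N) N ≡ R (N / (d * d))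
  S-gcdPair N d = trans
    (S-cong′ N λ i → S-multiples-bounded (gcdPair N d (suc i)) d N
      (λ b d∤b → vanish (suc i) b λ eq → d∤b (subst (_∣ b) eq (gcd[m,n]∣n (suc i) b)))
      (λ b N<b → cong (_* _) (χ-no (suc i * b ≤? N) (<⇒≱ (<-≤-trans N<b (m≤n*m b (suc i)))))))
    (trans (S-multiples-bounded (λ a → S (λ j → gcdPair N d a (suc j * d)) N) d N
      (λ a d∤a → S-zero N λ j _ → vanish a (suc j * d)
        λ eq → d∤a (subst (_∣ a) eq (gcd[m,n]∣m a (suc j * d))))
      (λ a N<a → S-zero N λ j _ → cong (_* _) (χ-no (a * (suc j * d) ≤? N)
        (<⇒≱ (<-≤-trans N<a (m≤m*n a (suc j * d) ⦃ m*n≢0 (suc j) d ⦄))))))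
    (trans (S-cong′ N λ i → S-cong′ N λ j → gcdPair-scale N d (suc i) (suc j))
      (sym (R-coprimePairs N (N / (d * d)) (m/n≤m N (d * d))))))
    where
    vanish : ∀ a b → gcd a b ≢ d → gcdPair N d a b ≡ 0
    vanish a b gcd≢d = trans (cong (χ (a * b ≤? N) *_) (χ-no (gcd a b ≟ d) gcd≢d)) (*-zeroʳ (χ (a * b ≤? N)))

  S-χ-≤ : ∀ {q N} → q ≤ N → S (λ j → χ (suc j ≤? q)) N ≡ q
  S-χ-≤ {q} q≤N = trans
    (S-extend (λ j → χ (suc j ≤? q)) q≤N λ j q≤j → χ-no (suc j ≤? q) (≤⇒≯ q≤j))
    (trans (S-cong q λ j j<q → χ-yes (suc j ≤? q) j<q) (S-1 q))
    where
    S-1 : ∀ n → S (λ _ → 1) n ≡ n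
    S-1 zero    = refl
    S-1 (suc n) = trans (+-comm _ 1) (cong suc (S-1 n))

  -- Sort the pairs (a, b) with a b ≤ N by their gcd e.
  S-R : ∀ N → S (λ e → R (N / (suc e * suc e))) N ≡ S (λ i → N / suc i) N
  S-R N = sym (trans (S-cong N λ i i<N → trans (row i) (S-cong′ N λ j → by-gcd i i<N j))
    (trans (S-cong′ N λ i → S-swap (λ j e → gcdPair N (suc e) (suc i) (suc j)) N N)
    (trans (S-swap (λ i e → S (λ j → gcdPair N (suc e) (suc i) (suc j)) N) N N)
    (S-cong′ N λ e → S-gcdPair N (suc e)))))
    where
    row : ∀ i → N / suc i ≡ S (λ j → χ (suc i * suc j ≤? N)) N
    row i = trans (sym (S-χ-≤ (m/n≤m N (suc i)))) (S-cong′ N λ j →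
      χ-cong (suc j ≤? N / suc i) (suc i * suc j ≤? N)
        (λ le → ≤-trans (≤-trans (≤-reflexive (*-comm (suc i) (suc j))) (*-monoˡ-≤ (suc i) le)) (m/n*n≤m N (suc i)))
        (λ le → subst (_≤ N / suc i) (m*n/n≡m (suc j) (suc i))
          (/-monoˡ-≤ (suc i) (≤-trans (≤-reflexive (*-comm (suc j) (suc i))) le))))
    by-gcd : ∀ i → i < N → ∀ j → χ (suc i * suc j ≤? N) ≡ S (λ e → gcdPair N (suc e) (suc i) (suc j)) N
    by-gcd i i<N j = sym (trans (S-* (χ (suc i * suc j ≤? N)) (λ e → χ (gcd (suc i) (suc j) ≟ suc e)) N)
      (trans (cong (χ (suc i * suc j ≤? N) *_) (one-gcd (gcd (suc i) (suc j)) refl)) (*-identityʳ _)))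
      where
      one-gcd : ∀ d → gcd (suc i) (suc j) ≡ d → S (λ e → χ (d ≟ suc e)) N ≡ 1
      one-gcd zero    eq = contradiction eq (gcd[m,n]≢0 (suc i) (suc j) (inj₁ λ ()))
      one-gcd (suc e) eq = S-χ-unique (λ e′ → suc e ≟ suc e′)
        (≤-trans (subst (_≤ suc i) eq (∣⇒≤ (gcd[m,n]∣m (suc i) (suc j)))) i<N) refl
        λ _ eq′ → sym (suc-injective eq′)

open import Data.List using ([]; _∷_; map)
open import Data.Maybe.Base using (Maybe; just; nothing)
open import Data.Nat as ℕ using (ℕ; zero; suc; _∸_; z≤n; s≤s)
open import Data.Nat.Induction using (<-rec)
open import Data.Nat.ListAction using (sum)
import Data.Integer as ℤ
import Data.Nat.DivMod as ℕ
import Data.Nat.Properties as ℕₚ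
open import Data.Product using (Σ; ∃; _×_; _,_; proj₁; proj₂)
open import Data.Rational
open import Data.Rational.Properties
open import Data.Sum using (inj₁; inj₂)
open import Function using (_∘_)
open import Level using (0ℓ)
open import Relation.Binary.PropositionalEquality hiding (J)
open import Relation.Nullary using (yes; no; contradiction)
open import Tactic.RingSolver using (solve-∀; solve)
open import Tactic.RingSolver.Core.AlmostCommutativeRing using (AlmostCommutativeRing; fromCommutativeRing)

-- Inequality certificates and finite sums over ℚ

ℚ-ring : AlmostCommutativeRing 0ℓ 0ℓ
ℚ-ring = fromCommutativeRing +-*-commutativeRing isZero
  where
  isZero : ∀ x → Maybe (0ℚ ≡ x)
  isZero x with 0ℚ ≟ x
  ... | yes p = just p
  ... | no  _ = nothing

infixl 6 _⊕_
infixl 7 _⊛_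

_⊕_ : ∀ {p q r s} → p ≤ q → r ≤ s → p + r ≤ q + s
_⊕_ = +-mono-≤

_⊛_ : ∀ {p q r} → 0ℚ ≤ r → p ≤ q → r * p ≤ r * q
_⊛_ = *-mono-≤₀

-- To prove p ≤ q, combine hypotheses into l ≤ r with r − l = q − p; the ring solver checks the latter.
lin : ∀ {p q l r} → l ≤ r → p + r ≡ q + l → p ≤ q
lin {p} {q} {l} {r} l≤r eq = subst₂ _≤_ (cancel p l) (trans (cong (_- l) eq) (cancel q l)) (+-monoˡ-≤ (- l) (+-monoʳ-≤ p l≤r))
  where
  cancel : ∀ p l → p + l - l ≡ p
  cancel = solve-∀ ℚ-ring

∣∣≤ : ∀ {p c} → p ≤ c → - p ≤ c → ∣ p ∣ ≤ c
∣∣≤ {p} p≤c -p≤c with ∣p∣≡p∨∣p∣≡-p p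
... | inj₁ eq = subst (_≤ _) (sym eq) p≤c
... | inj₂ eq = subst (_≤ _) (sym eq) -p≤c

p≤∣p∣ : ∀ p → p ≤ ∣ p ∣
p≤∣p∣ p with ∣p∣≡p∨∣p∣≡-p p
... | inj₁ eq = ≤-reflexive (sym eq)
... | inj₂ eq = flip ∣ p ∣ eq (0≤∣p∣ p)
  where
  flip : ∀ a → a ≡ - p → 0ℚ ≤ a → p ≤ a
  flip .(- p) refl 0≤-p = lin (0≤-p ⊕ 0≤-p) (solve (p ∷ []) ℚ-ring)

-p≤∣p∣ : ∀ p → - p ≤ ∣ p ∣
-p≤∣p∣ p = subst (- p ≤_) (∣-p∣≡∣p∣ p) (p≤∣p∣ (- p))

∑-+ : ∀ f h n → ∑ (λ i → f i + h i) n ≡ ∑ f n + ∑ h n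
∑-+ f h zero    = refl
∑-+ f h (suc n) = trans (cong (_+ (f n + h n)) (∑-+ f h n)) (interchange (∑ f n) (∑ h n) (f n) (h n))
  where
  interchange : ∀ a b c d → a + b + (c + d) ≡ a + c + (b + d)
  interchange = solve-∀ ℚ-ring

∑-minus : ∀ f h n → ∑ (λ i → f i - h i) n ≡ ∑ f n - ∑ h n
∑-minus f h zero    = refl
∑-minus f h (suc n) = trans (cong (_+ (f n - h n)) (∑-minus f h n)) (interchange (∑ f n) (∑ h n) (f n) (h n))
  where
  interchange : ∀ a b c d → a - b + (c - d) ≡ a + c - (b + d)
  interchange = solve-∀ ℚ-ring

∑-zero : ∀ n → ∑ (λ _ → 0ℚ) n ≡ 0ℚ
∑-zero n = trans (∑-const 0ℚ n) (*-zeroʳ (fromℕ n))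

∑-swap : ∀ (f : ℕ → ℕ → ℚ) m n → ∑ (λ i → ∑ (f i) m) n ≡ ∑ (λ j → ∑ (λ i → f i j) n) m
∑-swap f m zero    = sym (∑-zero m)
∑-swap f m (suc n) = trans (cong (_+ ∑ (f n) m) (∑-swap f m n))
  (sym (∑-+ (λ j → ∑ (λ i → f i j) n) (f n) m))

∑-cong< : ∀ {f h} n → (∀ i → i ℕ.< n → f i ≡ h i) → ∑ f n ≡ ∑ h n
∑-cong< zero    f≡h = refl
∑-cong< (suc n) f≡h = cong₂ _+_ (∑-cong< n λ i i<n → f≡h i (ℕₚ.m<n⇒m<1+n i<n)) (f≡h n ℕₚ.≤-refl)

∑-front : ∀ f n → ∑ f (suc n) ≡ f 0 + ∑ (f ∘ suc) n
∑-front f n = trans (∑-append f 1 n) (cong (_+ ∑ (f ∘ suc) n) (+-identityˡ (f 0)))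

0≤∑ : ∀ {f} n → (∀ i → 0ℚ ≤ f i) → 0ℚ ≤ ∑ f n
0≤∑ zero    0≤f = ≤-refl
0≤∑ (suc n) 0≤f = 0≤∑ n 0≤f ⊕ 0≤f n

∑-monoˡ : ∀ {f m n} → (∀ i → 0ℚ ≤ f i) → m ℕ.≤ n → ∑ f m ≤ ∑ f n
∑-monoˡ {f} {m} {n} 0≤f m≤n = subst₂ _≤_ (+-identityʳ (∑ f m))
  (trans (sym (∑-append f m (n ℕ.∸ m))) (cong (∑ f) (ℕₚ.m+[n∸m]≡n m≤n)))
  (≤-refl {∑ f m} ⊕ 0≤∑ (n ℕ.∸ m) λ i → 0≤f (m ℕ.+ i))

∣∑∣≤∑∣∣ : ∀ f n → ∣ ∑ f n ∣ ≤ ∑ (λ i → ∣ f i ∣) n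
∣∑∣≤∑∣∣ f zero    = ≤-refl
∣∑∣≤∑∣∣ f (suc n) = ≤-trans (∣p+q∣≤∣p∣+∣q∣ (∑ f n) (f n)) (∣∑∣≤∑∣∣ f n ⊕ ≤-refl)

∑-parity : ∀ f m → ∑ f (m ℕ.* 2) ≡ ∑ (λ i → f (i ℕ.* 2)) m + ∑ (λ i → f (suc (i ℕ.* 2))) m
∑-parity f zero    = refl
∑-parity f (suc m) = trans (cong (λ s → s + f (m ℕ.* 2) + f (suc (m ℕ.* 2))) (∑-parity f m))
  (rearrange (∑ (λ i → f (i ℕ.* 2)) m) _ (f (m ℕ.* 2)) (f (suc (m ℕ.* 2))))
  where
  rearrange : ∀ a b c d → a + b + c + d ≡ a + c + (b + d)
  rearrange = solve-∀ ℚ-ring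

∑-reverse : ∀ (f : ℕ → ℚ) n → ∑ (λ j → f (n ℕ.∸ j)) n ≡ ∑ (f ∘ suc) n
∑-reverse f zero    = refl
∑-reverse f (suc n) = trans (∑-front (λ j → f (suc n ℕ.∸ j)) n)
  (trans (cong (f (suc n) +_) (∑-reverse f n)) (+-comm (f (suc n)) _))

fromℕ-S : ∀ f n → fromℕ (Counting.S f n) ≡ ∑ (λ i → fromℕ (f i)) n
fromℕ-S f zero    = refl
fromℕ-S f (suc n) = trans (fromℕ-+ (Counting.S f n) (f n)) (cong (_+ fromℕ (f n)) (fromℕ-S f n))

-- Reciprocals, harmonic numbers and partial sums of ζ(2)

r : ℕ → ℚ
r n = inv (fromℕ n)

fromℕ-suc : ∀ n → fromℕ (suc n) ≡ 1ℚ + fromℕ n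
fromℕ-suc = fromℕ-+ 1

n*r : ∀ n .⦃ _ : ℕ.NonZero n ⦄ → fromℕ n * r n ≡ 1ℚ
n*r n = *-inv-pos (0<fromℕ n)

0<r : ∀ n .⦃ _ : ℕ.NonZero n ⦄ → 0ℚ < r n
0<r n = inv-pos (0<fromℕ n)

0≤r : ∀ n → 0ℚ ≤ r n
0≤r zero    = ≤-refl
0≤r (suc n) = <⇒≤ (0<r (suc n))

r-* : ∀ m n .⦃ _ : ℕ.NonZero m ⦄ .⦃ _ : ℕ.NonZero n ⦄ → r (m ℕ.* n) ≡ r m * r n
r-* m n = *-cancelˡ₀ (0<fromℕ (m ℕ.* n)) (trans (n*r (m ℕ.* n)) (sym (trans (cong (_* (r m * r n)) (fromℕ-* m n))
  (trans (interchange (fromℕ m) (fromℕ n) (r m) (r n)) (cong₂ _*_ (n*r m) (n*r n))))))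
  where
  instance
    mn≢0 : ℕ.NonZero (m ℕ.* n)
    mn≢0 = ℕₚ.m*n≢0 m n
  interchange : ∀ a b c d → (a * b) * (c * d) ≡ (a * c) * (b * d)
  interchange = solve-∀ ℚ-ring

r-antitone : ∀ {m n} .⦃ _ : ℕ.NonZero m ⦄ → m ℕ.≤ n → r n ≤ r m
r-antitone {m} m≤n = inv-antitone (0<fromℕ m) (fromℕ-mono-≤ m≤n)

r≤1 : ∀ n → r n ≤ 1ℚ
r≤1 zero    = <⇒≤ 0<1
r≤1 (suc n) = r-antitone {1} {suc n} (s≤s z≤n)

r-difference : ∀ n .⦃ _ : ℕ.NonZero n ⦄ → r n - r (suc n) ≡ r n * r (suc n)
r-difference n = trans (cong₂ _-_
    (trans (sym (*-identityʳ (r n))) (cong (r n *_) (sym (n*r (suc n)))))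
    (trans (sym (*-identityˡ (r (suc n)))) (cong (_* r (suc n)) (sym (n*r n)))))
  (trans (cong (λ s → r n * (s * r (suc n)) - fromℕ n * r n * r (suc n)) (fromℕ-suc n))
         (cancel (fromℕ n) (r n) (r (suc n))))
  where
  cancel : ∀ n x y → x * ((1ℚ + n) * y) - n * x * y ≡ x * y
  cancel = solve-∀ ℚ-ring

floor-≤ : ∀ n d .⦃ _ : ℕ.NonZero d ⦄ → fromℕ (n ℕ./ d) ≤ fromℕ n * r d
floor-≤ n d = subst (_≤ fromℕ n * r d)
  (trans (cong (r d *_) (fromℕ-* (n ℕ./ d) d)) (trans (rearrange (r d) (fromℕ (n ℕ./ d)) (fromℕ d))
    (trans (cong (fromℕ (n ℕ./ d) *_) (n*r d)) (*-identityʳ _))))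
  (subst (r d * fromℕ (n ℕ./ d ℕ.* d) ≤_) (*-comm (r d) (fromℕ n)) (0≤r d ⊛ fromℕ-mono-≤ (ℕ.m/n*n≤m n d)))
  where
  rearrange : ∀ i q d → i * (q * d) ≡ q * (d * i)
  rearrange = solve-∀ ℚ-ring

n≤[1+n/d]d : ∀ n d .⦃ _ : ℕ.NonZero d ⦄ → n ℕ.≤ suc (n ℕ./ d) ℕ.* d
n≤[1+n/d]d n d = subst (ℕ._≤ suc (n ℕ./ d) ℕ.* d) (sym (ℕ.m≡m%n+[m/n]*n n d))
  (ℕₚ.+-monoˡ-≤ (n ℕ./ d ℕ.* d) (ℕ.m%n≤n n d))

≤-floor : ∀ n d .⦃ _ : ℕ.NonZero d ⦄ → fromℕ n * r d ≤ 1ℚ + fromℕ (n ℕ./ d)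
≤-floor n d = subst₂ _≤_ (*-comm (r d) (fromℕ n))
  (trans (cong (r d *_) (fromℕ-* (suc q) d)) (trans (rearrange (r d) (fromℕ (suc q)) (fromℕ d))
    (trans (cong (fromℕ (suc q) *_) (n*r d)) (trans (*-identityʳ _) (fromℕ-suc q)))))
  (0≤r d ⊛ fromℕ-mono-≤ (n≤[1+n/d]d n d))
  where
  q = n ℕ./ d
  rearrange : ∀ i q d → i * (q * d) ≡ q * (d * i)
  rearrange = solve-∀ ℚ-ring

H : ℕ → ℚ
H = ∑ (λ i → r (suc i))

Z : ℕ → ℚ
Z = ∑ (λ i → r (suc i) * r (suc i))

0≤H : ∀ n → 0ℚ ≤ H n
0≤H n = 0≤∑ n λ i → 0≤r (suc i)

H-mono : ∀ {m n} → m ℕ.≤ n → H m ≤ H n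
H-mono = ∑-monoˡ λ i → 0≤r (suc i)

H≤n : ∀ n → H n ≤ fromℕ n
H≤n n = subst (H n ≤_) (trans (∑-const 1ℚ n) (*-identityʳ (fromℕ n))) (∑-mono n λ i _ → r≤1 (suc i))

-- Each further block of b terms, starting after c b terms, has entries at most 1/(c b) and so sums
-- to at most 1/c. This is the harmonic substitute for log (x y) = log x + log y.
H-* : ∀ a b .⦃ _ : ℕ.NonZero b ⦄ → H (suc a ℕ.* b) ≤ H a + H b
H-* zero    b = ≤-reflexive (trans (cong H (ℕₚ.+-identityʳ b)) (sym (+-identityˡ (H b))))
H-* (suc a) b = ≤-trans (≤-reflexive (trans (cong H (ℕₚ.+-comm b (suc a ℕ.* b))) (∑-append _ (suc a ℕ.* b) b)))
  (≤-trans (H-* a b ⊕ block) (≤-reflexive (swap (H a) (H b) (r (suc a)))))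
  where
  instance
    ab≢0 : ℕ.NonZero (suc a ℕ.* b)
    ab≢0 = ℕₚ.m*n≢0 (suc a) b
  swap : ∀ x y z → x + y + z ≡ x + z + y
  swap = solve-∀ ℚ-ring
  block : ∑ (λ j → r (suc (suc a ℕ.* b ℕ.+ j))) b ≤ r (suc a)
  block = ≤-trans (∑-mono b λ j _ → r-antitone {suc a ℕ.* b} (ℕₚ.m≤n⇒m≤1+n (ℕₚ.m≤m+n (suc a ℕ.* b) j)))
    (≤-reflexive (trans (∑-const (r (suc a ℕ.* b)) b) (trans (cong (fromℕ b *_) (r-* (suc a) b))
      (trans (rearrange (fromℕ b) (r (suc a)) (r b)) (trans (cong (r (suc a) *_) (n*r b)) (*-identityʳ _))))))
    where
    rearrange : ∀ b x y → b * (x * y) ≡ x * (b * y)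
    rearrange = solve-∀ ℚ-ring

0≤r² : ∀ n → 0ℚ ≤ r n * r n
0≤r² n = *-nonNeg₂ (0≤r n) (0≤r n)

Z-mono : ∀ {m n} → m ℕ.≤ n → Z m ≤ Z n
Z-mono = ∑-monoˡ λ i → 0≤r² (suc i)

-- Z n + 1/n decreases, because 1/(n + 1)² ≤ 1/(n (n + 1)) = 1/n - 1/(n + 1).
Z-tail : ∀ m k .⦃ _ : ℕ.NonZero m ⦄ → Z (m ℕ.+ k) + r (m ℕ.+ k) ≤ Z m + r m
Z-tail m zero    = ≤-reflexive (cong (λ n → Z n + r n) (ℕₚ.+-identityʳ m))
Z-tail m (suc k) = subst (λ n → Z n + r n ≤ Z m + r m) (sym (ℕₚ.+-suc m k))
  (≤-trans (step (m ℕ.+ k) ⦃ m+k≢0 m k ⦄) (Z-tail m k))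
  where
  m+k≢0 : ∀ m k .⦃ _ : ℕ.NonZero m ⦄ → ℕ.NonZero (m ℕ.+ k)
  m+k≢0 (suc m) k = _
  step : ∀ n .⦃ _ : ℕ.NonZero n ⦄ → Z (suc n) + r (suc n) ≤ Z n + r n
  step n = arith (Z n) (r n) (r (suc n)) (r-difference n)
    (0≤r (suc n)) (r-antitone (ℕₚ.n≤1+n n))
    where
    arith : ∀ z x y → x - y ≡ x * y → 0ℚ ≤ y → y ≤ x → z + y * y + y ≤ z + x
    arith z x y eq 0≤y y≤x = lin (0≤y ⊛ y≤x ⊕ ≤-reflexive (sym eq)) (solve (z ∷ x ∷ y ∷ []) ℚ-ring)

-- Stands in for Z n ≤ ζ(2) ≤ Z m + 1/m without mentioning ζ(2).
Z-bound : ∀ m n .⦃ _ : ℕ.NonZero m ⦄ → Z n ≤ Z m + r m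
Z-bound m n with ℕₚ.≤-total m n
... | inj₁ m≤n = ≤-trans (subst (_≤ Z n + r n) (+-identityʳ (Z n)) (≤-refl {Z n} ⊕ 0≤r n))
  (subst (λ n → Z n + r n ≤ Z m + r m) (ℕₚ.m+[n∸m]≡n m≤n) (Z-tail m (n ℕ.∸ m)))
... | inj₂ n≤m = ≤-trans (Z-mono n≤m) (subst (_≤ Z m + r m) (+-identityʳ (Z m)) (≤-refl {Z m} ⊕ 0≤r m))

Z≤2 : ∀ n → Z n ≤ fromℕ 2
Z≤2 n = Z-bound 1 n

1≤Z : ∀ n .⦃ _ : ℕ.NonZero n ⦄ → 1ℚ ≤ Z n
1≤Z (suc n) = Z-mono {1} {suc n} (s≤s z≤n)

¾ : ℚ
¾ = ½ + ½ * ½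

-- `Z-bound` with m = 2 leaves 1/4 + 1/2 after removing the first term. With m = 1 it would only
-- give 1, too weak for a contraction.
Z-tail-≤¾ : ∀ n → ∑ (λ i → r (suc (suc i)) * r (suc (suc i))) n ≤ ¾
Z-tail-≤¾ n = subst₂ _≤_ (cancel (∑ (λ i → r (suc (suc i)) * r (suc (suc i))) n)) refl
  (+-monoʳ-≤ (- 1ℚ) (subst (_≤ Z 2 + r 2) (∑-front (λ i → r (suc i) * r (suc i)) n) (Z-bound 2 (suc n))))
  where
  cancel : ∀ z → - 1ℚ + (1ℚ + z) ≡ z
  cancel = solve-∀ ℚ-ring

-- The main term n H_n and its approximate recursion

Φ : ℕ → ℚ
Φ n = fromℕ n * H n

0≤Φ : ∀ n → 0ℚ ≤ Φ n
0≤Φ n = *-nonNeg₂ (0≤fromℕ n) (0≤H n)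

Φ-mono : ∀ {m n} → m ℕ.≤ n → Φ m ≤ Φ n
Φ-mono {m} {n} m≤n = *-mono₂-≤ (0≤fromℕ m) (0≤H n) (fromℕ-mono-≤ m≤n) (H-mono m≤n)

-- With e = i + 1, n ω bounds the loss when Φ(n)/e² is replaced by Φ(⌊n/e²⌋): passing from H(n) to
-- H(⌊n/e²⌋) costs up to H(e²) ≤ 2 H(e), and the floor accounts for the 1.
ω : ℕ → ℚ
ω i = r (suc i) * r (suc i) * (1ℚ + (H (suc i) + H (suc i)))

-- The potential (2 H n + 5) / n decreases by at least ω n from n to n + 1.
∑ω+potential : ∀ n → ∑ ω (suc n) + (H (suc n) + H (suc n) + fromℕ 5) * r (suc n) ≤ fromℕ 10
∑ω+potential zero    = ≤-refl
∑ω+potential (suc n) = ≤-trans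
  (step (∑ ω (suc n)) (H (suc n)) (r (suc n)) (r (suc (suc n)))
    (0≤H (suc n)) (0≤r (suc (suc n))) (r-antitone (ℕₚ.n≤1+n (suc n))) (r≤1 (suc (suc n))) (r-difference (suc n)))
  (∑ω+potential n)
  where
  step : ∀ w h x y → 0ℚ ≤ h → 0ℚ ≤ y → y ≤ x → y ≤ 1ℚ → x - y ≡ x * y →
    w + y * y * (1ℚ + (h + y + (h + y))) + (h + y + (h + y) + fromℕ 5) * y ≤ w + (h + h + fromℕ 5) * x
  step w h x y 0≤h 0≤y y≤x y≤1 eq = lin
    (*-nonNeg₂ (0≤h ⊕ 0≤h ⊕ 0≤fromℕ 5) 0≤y ⊛ y≤x
      ⊕ *-nonNeg₂ (0≤fromℕ 2) (*-nonNeg₂ 0≤y 0≤y) ⊛ y≤1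
      ⊕ (0≤h ⊕ 0≤h ⊕ 0≤fromℕ 5) ⊛ ≤-reflexive (sym eq))
    (solve (w ∷ h ∷ x ∷ y ∷ []) ℚ-ring)

-- The 10 is the starting value of the decreasing quantity in `∑ω+potential`: ω 0 = 3 plus the
-- potential (2 + 5)/1 = 7.
∑ω≤10 : ∀ n → ∑ ω n ≤ fromℕ 10
∑ω≤10 zero    = 0≤fromℕ 10
∑ω≤10 (suc n) = ≤-trans (subst (_≤ ∑ ω (suc n) + (H (suc n) + H (suc n) + fromℕ 5) * r (suc n)) (+-identityʳ (∑ ω (suc n)))
  (≤-refl {∑ ω (suc n)} ⊕ *-nonNeg₂ (0≤H (suc n) ⊕ 0≤H (suc n) ⊕ 0≤fromℕ 5) (0≤r (suc n)))) (∑ω+potential n)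

H-square : ∀ e → H (suc e ℕ.* suc e) ≤ H (suc e) + H (suc e)
H-square e = ≤-trans (H-* e (suc e)) (H-mono (ℕₚ.n≤1+n e) ⊕ ≤-refl {H (suc e)})

-- Like the summands of H and Z, indexed from 0: ⌊ n ÷ e ²⌋ is the floor of n/(e + 1)².
⌊_÷_²⌋ : ℕ → ℕ → ℕ
⌊ n ÷ e ²⌋ = n ℕ./ (suc e ℕ.* suc e)

module _ (n : ℕ) where

  fromℕ-⌊n/e²⌋ : ∀ e → fromℕ ⌊ n ÷ e ²⌋ ≤ r (suc e) * r (suc e) * fromℕ n
  fromℕ-⌊n/e²⌋ e = subst (fromℕ ⌊ n ÷ e ²⌋ ≤_)
    (trans (*-comm (fromℕ n) (r (suc e ℕ.* suc e))) (cong (_* fromℕ n) (r-* (suc e) (suc e)))) (floor-≤ n (suc e ℕ.* suc e))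

  Φ-⌊n/e²⌋≤ : ∀ e → Φ ⌊ n ÷ e ²⌋ ≤ r (suc e) * r (suc e) * Φ n
  Φ-⌊n/e²⌋≤ e = ≤-trans
    (*-mono₂-≤ (0≤fromℕ ⌊ n ÷ e ²⌋) (0≤H n) (fromℕ-⌊n/e²⌋ e) (H-mono (ℕ.m/n≤m n (suc e ℕ.* suc e))))
    (≤-reflexive (*-assoc (r (suc e) * r (suc e)) (fromℕ n) (H n)))

  ≤Φ-⌊n/e²⌋ : ∀ e → r (suc e) * r (suc e) * Φ n ≤ Φ ⌊ n ÷ e ²⌋ + fromℕ n * ω e
  ≤Φ-⌊n/e²⌋ e = arith (fromℕ n) (r (suc e) * r (suc e)) (H n) (fromℕ q) (H q) (H (suc e))
    (≤-trans (H-mono (n≤[1+n/d]d n d)) (≤-trans (H-* q d) (≤-refl {H q} ⊕ H-square e)))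
    (subst (λ s → fromℕ n * s ≤ 1ℚ + fromℕ q) (r-* (suc e) (suc e)) (≤-floor n d))
    (H≤n q) (fromℕ-⌊n/e²⌋ e) (0≤fromℕ n) (0≤r² (suc e)) (0≤H q)
    where
    d = suc e ℕ.* suc e
    q = ⌊ n ÷ e ²⌋
    arith : ∀ n s h q hq he → h ≤ hq + (he + he) → n * s ≤ 1ℚ + q → hq ≤ q → q ≤ s * n →
      0ℚ ≤ n → 0ℚ ≤ s → 0ℚ ≤ hq → s * (n * h) ≤ q * hq + n * (s * (1ℚ + (he + he)))
    arith n s h q hq he h≤ ns≤ hq≤q q≤sn 0≤n 0≤s 0≤hq = lin
      (*-nonNeg₂ 0≤n 0≤s ⊛ h≤ ⊕ 0≤hq ⊛ ns≤ ⊕ hq≤q ⊕ q≤sn)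
      (solve (n ∷ s ∷ h ∷ q ∷ hq ∷ he ∷ []) ℚ-ring)

  ∑Φ≤ : ∑ (λ e → Φ ⌊ n ÷ e ²⌋) n ≤ Z n * Φ n
  ∑Φ≤ = ≤-trans (∑-mono n λ e _ → Φ-⌊n/e²⌋≤ e)
    (≤-reflexive (trans (∑-cong n λ e → *-comm (r (suc e) * r (suc e)) (Φ n))
      (trans (sym (*-∑ (Φ n) (λ e → r (suc e) * r (suc e)) n)) (*-comm (Φ n) (Z n)))))

  ≤∑Φ : Z n * Φ n ≤ ∑ (λ e → Φ ⌊ n ÷ e ²⌋) n + fromℕ 10 * fromℕ n
  ≤∑Φ = ≤-trans
    (≤-reflexive (trans (*-comm (Z n) (Φ n)) (trans (*-∑ (Φ n) (λ e → r (suc e) * r (suc e)) n)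
      (∑-cong n λ e → *-comm (Φ n) (r (suc e) * r (suc e))))))
    (≤-trans (∑-mono n λ e _ → ≤Φ-⌊n/e²⌋ e)
      (≤-trans (≤-reflexive (trans (∑-+ (λ e → Φ ⌊ n ÷ e ²⌋) (λ e → fromℕ n * ω e) n)
          (cong (∑ (λ e → Φ ⌊ n ÷ e ²⌋) n +_) (sym (*-∑ (fromℕ n) ω n)))))
        (≤-refl {∑ (λ e → Φ ⌊ n ÷ e ²⌋) n} ⊕ ≤-trans (0≤fromℕ n ⊛ ∑ω≤10 n) (≤-reflexive (*-comm (fromℕ n) (fromℕ 10))))))

  divisorSum : ℚ
  divisorSum = ∑ (λ i → fromℕ (n ℕ./ suc i)) n

  divisorSum≤ : divisorSum ≤ Φ n
  divisorSum≤ = ≤-trans (∑-mono n λ i _ → floor-≤ n (suc i)) (≤-reflexive (sym (*-∑ (fromℕ n) (λ i → r (suc i)) n)))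

  ≤divisorSum : Φ n ≤ fromℕ n + divisorSum
  ≤divisorSum = ≤-trans (≤-reflexive (*-∑ (fromℕ n) (λ i → r (suc i)) n))
    (≤-trans (∑-mono n λ i _ → ≤-floor n (suc i))
      (≤-reflexive (trans (∑-+ (λ _ → 1ℚ) (λ i → fromℕ (n ℕ./ suc i)) n)
        (cong (_+ divisorSum) (trans (∑-const 1ℚ n) (*-identityʳ (fromℕ n)))))))

Φ*r≤ : ∀ n → Φ n * r n ≤ fromℕ n
Φ*r≤ zero    = ≤-refl
Φ*r≤ (suc n) = subst (_≤ fromℕ (suc n)) (sym (trans (rearrange (fromℕ (suc n)) (H (suc n)) (r (suc n)))
  (trans (cong (H (suc n) *_) (n*r (suc n))) (*-identityʳ (H (suc n)))))) (H≤n (suc n))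
  where
  rearrange : ∀ a b c → a * b * c ≡ b * (a * c)
  rearrange = solve-∀ ℚ-ring

-- Strong induction for R and the passage to G

module Contraction (J : ℕ) .⦃ _ : ℕ.NonZero J ⦄ where

  E : ℕ → ℚ
  E n = Z J * fromℕ (Counting.R n) - Φ n

  -- In 11 n, ten come from `∑ω≤10`; the eleventh pays for Z J exceeding Z n, by at most 1/n, as
  -- Φ(n)/n ≤ n. The term Φ(n)/J pays for the opposite case, where Z n exceeds Z J by at most 1/J.
  B : ℕ → ℚ
  B n = fromℕ 11 * fromℕ n + r J * Φ n

  B-mono : ∀ {m n} → m ℕ.≤ n → B m ≤ B n
  B-mono m≤n = 0≤fromℕ 11 ⊛ fromℕ-mono-≤ m≤n ⊕ 0≤r J ⊛ Φ-mono m≤n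

  -- This scaling is what the induction rests on: it bounds all terms but the first by a fixed
  -- fraction of `B n`.
  B-⌊n/e²⌋ : ∀ n e → B ⌊ n ÷ e ²⌋ ≤ r (suc e) * r (suc e) * B n
  B-⌊n/e²⌋ n e = ≤-trans (0≤fromℕ 11 ⊛ fromℕ-⌊n/e²⌋ n e ⊕ 0≤r J ⊛ Φ-⌊n/e²⌋≤ n e)
    (≤-reflexive (rearrange (r (suc e) * r (suc e)) (fromℕ n) (r J) (Φ n)))
    where
    rearrange : ∀ s n x y → fromℕ 11 * (s * n) + x * (s * y) ≡ s * (fromℕ 11 * n + x * y)
    rearrange = solve-∀ ℚ-ring

  ∑E : ∀ n → ∑ (λ e → E ⌊ n ÷ e ²⌋) n ≡ Z J * divisorSum n - ∑ (λ e → Φ ⌊ n ÷ e ²⌋) n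
  ∑E n = trans (∑-minus (λ e → Z J * fromℕ (Counting.R ⌊ n ÷ e ²⌋)) (λ e → Φ ⌊ n ÷ e ²⌋) n)
    (cong (_- ∑ (λ e → Φ ⌊ n ÷ e ²⌋) n)
      (trans (sym (*-∑ (Z J) (λ e → fromℕ (Counting.R ⌊ n ÷ e ²⌋)) n))
      (cong (Z J *_) (trans (sym (fromℕ-S (λ e → Counting.R ⌊ n ÷ e ²⌋) n))
        (trans (cong fromℕ (Counting.S-R n)) (fromℕ-S (λ i → n ℕ./ suc i) n))))))

  ∣∑E∣≤ : ∀ n .⦃ _ : ℕ.NonZero n ⦄ → ∣ ∑ (λ e → E ⌊ n ÷ e ²⌋) n ∣ ≤ B n
  ∣∑E∣≤ n = subst (λ s → ∣ s ∣ ≤ B n) (sym (∑E n)) (∣∣≤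
    (upper (Z J) (Z n) (r J) (r n) (divisorSum n) (Φ n) _ (fromℕ n) (0≤Z J) (Z-bound n J) (divisorSum≤ n)
      (≤∑Φ n) (Φ*r≤ n) (0≤Φ n) (0≤r J))
    (lower (Z J) (Z n) (r J) (divisorSum n) (Φ n) _ (fromℕ n) (0≤Z J) (Z-bound J n) (≤divisorSum n)
      (∑Φ≤ n) (Z≤2 J) (0≤fromℕ n) (0≤Φ n)))
    where
    0≤Z : ∀ n → 0ℚ ≤ Z n
    0≤Z n = 0≤∑ n λ i → 0≤r² (suc i)
    upper : ∀ zj zn rj rn t φ s n → 0ℚ ≤ zj → zj ≤ zn + rn → t ≤ φ → zn * φ ≤ s + fromℕ 10 * n →
      φ * rn ≤ n → 0ℚ ≤ φ → 0ℚ ≤ rj → zj * t - s ≤ fromℕ 11 * n + rj * φ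
    upper zj zn rj rn t φ s n 0≤zj zj≤ t≤φ znφ≤ φrn≤ 0≤φ 0≤rj = lin
      (0≤zj ⊛ t≤φ ⊕ 0≤φ ⊛ zj≤ ⊕ znφ≤ ⊕ φrn≤ ⊕ *-nonNeg₂ 0≤rj 0≤φ)
      (solve (zj ∷ zn ∷ rj ∷ rn ∷ t ∷ φ ∷ s ∷ n ∷ []) ℚ-ring)
    lower : ∀ zj zn rj t φ s n → 0ℚ ≤ zj → zn ≤ zj + rj → φ ≤ n + t → s ≤ zn * φ → zj ≤ fromℕ 2 →
      0ℚ ≤ n → 0ℚ ≤ φ → - (zj * t - s) ≤ fromℕ 11 * n + rj * φ
    lower zj zn rj t φ s n 0≤zj zn≤ φ≤ s≤ zj≤2 0≤n 0≤φ = lin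
      (0≤zj ⊛ φ≤ ⊕ 0≤φ ⊛ zn≤ ⊕ s≤ ⊕ 0≤n ⊛ zj≤2 ⊕ 0≤fromℕ 9 ⊛ 0≤n)
      (solve (zj ∷ zn ∷ rj ∷ t ∷ φ ∷ s ∷ n ∷ []) ℚ-ring)

  -- Σ_{e ≤ n} E ⌊n/e²⌋ is O(B n) and Σ_{e ≥ 2} 1/e² ≤ ¾ < 1, so strong induction absorbs the terms e ≥ 2.
  ∣E∣≤ : ∀ n → ∣ E n ∣ ≤ fromℕ 4 * B n
  ∣E∣≤ = <-rec (λ n → ∣ E n ∣ ≤ fromℕ 4 * B n) step
    where
    step : ∀ n → (∀ {m} → m ℕ.< n → ∣ E m ∣ ≤ fromℕ 4 * B m) → ∣ E n ∣ ≤ fromℕ 4 * B n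
    step zero    ih = ≤-reflexive base
      where
      base : ∣ E 0 ∣ ≡ fromℕ 4 * B 0
      base = trans (cong ∣_∣ (left (Z J))) (sym (right (r J)))
        where
        left : ∀ z → z * 0ℚ - 0ℚ ≡ 0ℚ
        left = solve-∀ ℚ-ring
        right : ∀ x → fromℕ 4 * (fromℕ 11 * 0ℚ + x * 0ℚ) ≡ 0ℚ
        right = solve-∀ ℚ-ring
    step n@(suc n′) ih = subst (λ s → ∣ s ∣ ≤ fromℕ 4 * B n) split
      (≤-trans (∣p+q∣≤∣p∣+∣q∣ (∑ e n) (- rest)) (≤-trans
        (∣∑E∣≤ n ⊕ ≤-trans (≤-reflexive (∣-p∣≡∣p∣ rest)) rest≤)
        (≤-reflexive (combine (B n)))))
      where
      e : ℕ → ℚ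
      e i = E ⌊ n ÷ i ²⌋
      rest : ℚ
      rest = ∑ (e ∘ suc) n′
      split : ∑ e n - rest ≡ E n
      split = trans (cong (_- rest) (∑-front e n′)) (trans (cancel (e 0) rest) (cong E (ℕ.n/1≡n n)))
        where
        cancel : ∀ a b → a + b - b ≡ a
        cancel = solve-∀ ℚ-ring
      -- The constant 4 is the solution of c = 1 + ¾ c.
      combine : ∀ b → b + fromℕ 4 * (b * ¾) ≡ fromℕ 4 * b
      combine = solve-∀ ℚ-ring
      smaller : ∀ i → ⌊ n ÷ suc i ²⌋ ℕ.< n
      smaller i = ℕ.m/n<m n (suc (suc i) ℕ.* suc (suc i)) (s≤s (s≤s z≤n))
      0≤B : 0ℚ ≤ B n
      0≤B = *-nonNeg₂ (0≤fromℕ 11) (0≤fromℕ n) ⊕ *-nonNeg₂ (0≤r J) (0≤Φ n)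
      s : ℕ → ℚ
      s i = r (suc (suc i)) * r (suc (suc i))
      rest≤ : ∣ rest ∣ ≤ fromℕ 4 * (B n * ¾)
      rest≤ = ≤-trans (∣∑∣≤∑∣∣ (e ∘ suc) n′) (≤-trans
        (∑-mono n′ λ i _ → ≤-trans (ih (smaller i)) (0≤fromℕ 4 ⊛ B-⌊n/e²⌋ n (suc i)))
        (≤-trans (≤-reflexive (trans (sym (*-∑ (fromℕ 4) (λ i → s i * B n) n′)) (cong (fromℕ 4 *_)
            (trans (∑-cong n′ λ i → *-comm (s i) (B n)) (sym (*-∑ (B n) s n′))))))
          (0≤fromℕ 4 ⊛ (0≤B ⊛ Z-tail-≤¾ n′))))

  -- Since m is 2 k or 2 k + 1, the main terms 2 Φ(k) and Φ(m) of the two corrections cancel up to 2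
  -- n, so G inherits the main term of R. The 16 is 4 · 4, for E at n, at m and twice at k.
  ∣G∣≤ : ∀ n → ∣ Z J * fromℕ (Counting.G n) - Φ n ∣ ≤ fromℕ 16 * B n + fromℕ 2 * fromℕ n
  ∣G∣≤ n with Counting.G-via-R n
  ... | m , k , eq , 2k≤m , m≤1+2k , 2m≤n = subst (λ s → ∣ s ∣ ≤ fromℕ 16 * B n + fromℕ 2 * fromℕ n)
    (sym decompose) (≤-trans (≤-trans (∣p+q∣≤∣p∣+∣q∣ (E n - E m + (E k + E k)) δ)
      (≤-trans (∣p+q∣≤∣p∣+∣q∣ (E n - E m) (E k + E k))
        (≤-trans (∣p+q∣≤∣p∣+∣q∣ (E n) (- E m)) (∣E∣≤ n ⊕ ≤-trans (≤-reflexive (∣-p∣≡∣p∣ (E m))) (bound m m≤n))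
          ⊕ ≤-trans (∣p+q∣≤∣p∣+∣q∣ (E k) (E k)) (bound k k≤n ⊕ bound k k≤n)) ⊕ δ-bound))
      (≤-reflexive (total (B n) (fromℕ n))))
    where
    m≤n : m ℕ.≤ n
    m≤n = ℕₚ.≤-trans (ℕₚ.m≤m*n m 2) 2m≤n
    k≤n : k ℕ.≤ n
    k≤n = ℕₚ.≤-trans (ℕₚ.≤-trans (ℕₚ.m≤m*n k 2) 2k≤m) m≤n
    δ : ℚ
    δ = Φ k + Φ k - Φ m
    bound : ∀ l → l ℕ.≤ n → ∣ E l ∣ ≤ fromℕ 4 * B n
    bound l l≤n = ≤-trans (∣E∣≤ l) (0≤fromℕ 4 ⊛ B-mono l≤n)
    total : ∀ b n → fromℕ 4 * b + fromℕ 4 * b + (fromℕ 4 * b + fromℕ 4 * b) + fromℕ 2 * n ≡ fromℕ 16 * b + fromℕ 2 * n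
    total = solve-∀ ℚ-ring
    eqℚ : fromℕ (Counting.G n) + fromℕ (Counting.R m) ≡ fromℕ (Counting.R n) + (fromℕ (Counting.R k) + fromℕ (Counting.R k))
    eqℚ = trans (sym (fromℕ-+ (Counting.G n) (Counting.R m))) (trans (cong fromℕ eq)
      (trans (fromℕ-+ (Counting.R n) (2 ℕ.* Counting.R k)) (cong (fromℕ (Counting.R n) +_)
        (trans (cong (λ z → fromℕ (Counting.R k ℕ.+ z)) (ℕₚ.+-identityʳ (Counting.R k))) (fromℕ-+ (Counting.R k) (Counting.R k))))))
    decompose : Z J * fromℕ (Counting.G n) - Φ n ≡ E n - E m + (E k + E k) + δ
    decompose = trans (cong (λ s → Z J * s - Φ n) (isolate eqℚ)) (expand (Z J) _ _ _ (Φ n) (Φ m) (Φ k))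
      where
      isolate : ∀ {a b c} → a + b ≡ c → a ≡ c - b
      isolate {a} {b} refl = cancel a b
        where
        cancel : ∀ a b → a ≡ a + b - b
        cancel = solve-∀ ℚ-ring
      expand : ∀ z rn rm rk fn fm fk → z * (rn + (rk + rk) - rm) - fn ≡
        z * rn - fn - (z * rm - fm) + (z * rk - fk + (z * rk - fk)) + (fk + fk - fm)
      expand = solve-∀ ℚ-ring
    2k≤mℚ : fromℕ k + fromℕ k ≤ fromℕ m
    2k≤mℚ = subst (_≤ fromℕ m) (trans (cong fromℕ (double k)) (fromℕ-+ k k)) (fromℕ-mono-≤ 2k≤m)
      where
      double : ∀ k → k ℕ.* 2 ≡ k ℕ.+ k
      double k = trans (ℕₚ.*-comm k 2) (cong (k ℕ.+_) (ℕₚ.+-identityʳ k))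
    m≤1+2kℚ : fromℕ m ≤ 1ℚ + (fromℕ k + fromℕ k)
    m≤1+2kℚ = subst (fromℕ m ≤_) (trans (fromℕ-+ 1 (k ℕ.* 2)) (cong (1ℚ +_) (trans (cong fromℕ (double k)) (fromℕ-+ k k)))) (fromℕ-mono-≤ m≤1+2k)
      where
      double : ∀ k → k ℕ.* 2 ≡ k ℕ.+ k
      double k = trans (ℕₚ.*-comm k 2) (cong (k ℕ.+_) (ℕₚ.+-identityʳ k))
    Hm≤ : H m ≤ H k + fromℕ 2
    Hm≤ = ≤-trans (H-mono (ℕₚ.≤-trans m≤1+2k (ℕₚ.n≤1+n _))) (≤-trans (H-* k 2) (≤-refl {H k} ⊕ H≤n 2))
    δ-bound : ∣ δ ∣ ≤ fromℕ 2 * fromℕ n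
    δ-bound = ∣∣≤
      (upper (fromℕ k) (H k) (fromℕ m) (H m) (fromℕ n) 2k≤mℚ (H-mono (ℕₚ.≤-trans (ℕₚ.m≤m*n k 2) 2k≤m)) (0≤fromℕ m) (0≤H k) (0≤fromℕ n))
      (lower (fromℕ k) (H k) (fromℕ m) (H m) (fromℕ n) m≤1+2kℚ Hm≤ (H≤n k) 2k≤mℚ (fromℕ-mono-≤ m≤n) (0≤fromℕ m) (0≤fromℕ k) (0≤H k)
        (subst (_≤ fromℕ n) (trans (fromℕ-* m 2) (*-comm (fromℕ m) (fromℕ 2))) (fromℕ-mono-≤ 2m≤n)))
      where
      upper : ∀ k hk m hm n → k + k ≤ m → hk ≤ hm → 0ℚ ≤ m → 0ℚ ≤ hk → 0ℚ ≤ n →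
        k * hk + k * hk - m * hm ≤ fromℕ 2 * n
      upper k hk m hm n 2k≤m hk≤hm 0≤m 0≤hk 0≤n = lin
        (0≤hk ⊛ 2k≤m ⊕ 0≤m ⊛ hk≤hm ⊕ 0≤fromℕ 2 ⊛ 0≤n)
        (solve (k ∷ hk ∷ m ∷ hm ∷ n ∷ []) ℚ-ring)
      lower : ∀ k hk m hm n → m ≤ 1ℚ + (k + k) → hm ≤ hk + fromℕ 2 → hk ≤ k → k + k ≤ m → m ≤ n →
        0ℚ ≤ m → 0ℚ ≤ k → 0ℚ ≤ hk → fromℕ 2 * m ≤ n → - (k * hk + k * hk - m * hm) ≤ fromℕ 2 * n
      lower k hk m hm n m≤ hm≤ hk≤k 2k≤m m≤n 0≤m 0≤k 0≤hk 2m≤n = lin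
        (0≤m ⊛ hm≤ ⊕ 0≤hk ⊛ m≤ ⊕ hk≤k ⊕ 2k≤m ⊕ 0≤k ⊕ m≤n ⊕ 2m≤n)
        (solve (k ∷ hk ∷ m ∷ hm ∷ n ∷ []) ℚ-ring)

-- Harmonic numbers against the logarithm

H-front : ∀ n → H (suc n) ≡ 1ℚ + ∑ (λ i → r (suc (suc i))) n
H-front n = ∑-front (λ i → r (suc i)) n

module _ (n : ℕ) .⦃ _ : ℕ.NonZero n ⦄ where

  private
    b = fromℕ (suc n)
    anti : AntitoneOn 1ℚ b inv
    anti 1≤s s≤t _ = inv-antitone (<-≤-trans 0<1 1≤s) s≤t
    1≤b : 1ℚ ≤ b
    1≤b = 1≤fromℕ (suc n)

  b-1 : b - 1ℚ ≡ fromℕ n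
  b-1 = trans (cong (_- 1ℚ) (fromℕ-suc n)) (cancel (fromℕ n))
    where
    cancel : ∀ x → 1ℚ + x - 1ℚ ≡ x
    cancel = solve-∀ ℚ-ring

  mesh-unit : mesh 1ℚ b n ≡ 1ℚ
  mesh-unit = trans (cong (_* r n) b-1) (n*r n)

  -- On [1, n + 1] the mesh is 1 and the right endpoints are 2, ..., n + 1. Comparing any other term
  -- of `log` with this one by `riemannSum-close` replaces the passage to the limit.
  riemannSum-unit : riemannSum 1ℚ b inv n ≡ H (suc n) - 1ℚ
  riemannSum-unit = trans (cong₂ _*_ mesh-unit (∑-cong n λ i → cong inv (node i)))
    (trans (*-identityˡ _) (trans (cancel (∑ (λ i → r (suc (suc i))) n)) (cong (_- 1ℚ) (sym (H-front n)))))
    where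
    node : ∀ i → 1ℚ + fromℕ (suc i) * mesh 1ℚ b n ≡ fromℕ (suc (suc i))
    node i = trans (cong (λ m → 1ℚ + fromℕ (suc i) * m) mesh-unit)
      (trans (cong (1ℚ +_) (*-identityʳ (fromℕ (suc i)))) (sym (fromℕ-suc (suc i))))
    cancel : ∀ x → x ≡ 1ℚ + x - 1ℚ
    cancel = solve-∀ ℚ-ring

  log≤H : ∀ k → seq (log (suc n)) k ≤ H (suc n)
  log≤H k = ≤-trans (riemannSum-close 1≤b anti (suc k) n)
    (arith (riemannSum 1ℚ b inv n) (mesh 1ℚ b n) (r (suc n)) (H (suc n)) riemannSum-unit mesh-unit (0≤r (suc n)))
    where
    arith : ∀ R m x h → R ≡ h - 1ℚ → m ≡ 1ℚ → 0ℚ ≤ x → R + m * (1ℚ - x) ≤ h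
    arith .(h - 1ℚ) .1ℚ x h refl refl 0≤x = lin 0≤x (solve (x ∷ h ∷ []) ℚ-ring)

  -- One unit of the 2 is the first term of H, absent from the Riemann sum; the other bounds the
  -- mesh, which is at most 1 once k + 1 ≥ n.
  H≤log : ∀ k → n ℕ.≤ suc k → H (suc n) ≤ seq (log (suc n)) k + fromℕ 2
  H≤log k n≤1+k = arith (riemannSum 1ℚ b inv n) (seq (log (suc n)) k) (mesh 1ℚ b (suc k)) (r (suc n)) (H (suc n))
    riemannSum-unit (riemannSum-close 1≤b anti n (suc k)) mesh≤1 (r≤1 (suc n)) (0≤r (suc n))
    where
    mesh≤1 : mesh 1ℚ b (suc k) ≤ 1ℚ
    mesh≤1 = subst₂ _≤_ (trans (*-comm (r (suc k)) (fromℕ n)) (cong (_* r (suc k)) (sym b-1)))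
      (trans (*-comm (r (suc k)) (fromℕ (suc k))) (n*r (suc k)))
      (0≤r (suc k) ⊛ fromℕ-mono-≤ n≤1+k)
    arith : ∀ R l m x h → R ≡ h - 1ℚ → R ≤ l + m * (1ℚ - x) → m ≤ 1ℚ → x ≤ 1ℚ → 0ℚ ≤ x → h ≤ l + fromℕ 2
    arith .(h - 1ℚ) l m x h refl R≤ m≤1 x≤1 0≤x = lin (R≤ ⊕ 0≤1-x ⊛ m≤1 ⊕ 0≤x)
      (solve (l ∷ m ∷ x ∷ h ∷ []) ℚ-ring)
      where
      0≤1-x : 0ℚ ≤ 1ℚ - x
      0≤1-x = lin x≤1 (solve (x ∷ []) ℚ-ring)

-- 1/(2ⁿ + 1) + ⋯ + 1/2ⁿ⁺¹ ≥ 1/2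
H-2^ : ∀ n → fromℕ n * ½ ≤ H (2 ℕ.^ n)
H-2^ zero    = <⇒≤ 0<1
H-2^ (suc n) = subst₂ _≤_ (trans (half (fromℕ n)) (cong (_* ½) (sym (fromℕ-suc n))))
  (trans (sym (∑-append (λ i → r (suc i)) (2 ℕ.^ n) (2 ℕ.^ n)))
    (cong (λ m → H (2 ℕ.^ n ℕ.+ m)) (sym (ℕₚ.+-identityʳ (2 ℕ.^ n)))))
  (H-2^ n ⊕ block (2 ℕ.^ n) ⦃ ℕₚ.m^n≢0 2 n ⦄)
  where
  half : ∀ n → n * ½ + ½ ≡ (1ℚ + n) * ½
  half = solve-∀ ℚ-ring
  block : ∀ m .⦃ _ : ℕ.NonZero m ⦄ → ½ ≤ ∑ (λ j → r (suc (m ℕ.+ j))) m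
  block m = subst₂ _≤_ (trans (cong (fromℕ m *_) (r-* m 2)) (trans (sym (*-assoc (fromℕ m) (r m) ½))
      (trans (cong (_* ½) (n*r m)) (*-identityˡ ½)))) refl
    (subst (_≤ ∑ (λ j → r (suc (m ℕ.+ j))) m) (∑-const (r (m ℕ.* 2)) m)
      (∑-mono m λ j j<m → r-antitone (subst (suc (m ℕ.+ j) ℕ.≤_) (double m) (ℕₚ.+-monoʳ-< m j<m))))
    where
    double : ∀ m → m ℕ.+ m ≡ m ℕ.* 2
    double m = trans (cong (m ℕ.+_) (sym (ℕₚ.+-identityʳ m))) (ℕₚ.*-comm 2 m)

H-unbounded : ∀ C → ∃ λ N₀ → ∀ N → N₀ ℕ.≤ N → C ≤ H N
H-unbounded C = 2 ℕ.^ n , λ N N₀≤N → ≤-trans (arith C (fromℕ n) (≤-fromℕ-∣↥∣ (C + C)))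
  (≤-trans (H-2^ n) (H-mono N₀≤N))
  where
  n = ℤ.∣ ↥ (C + C) ∣
  arith : ∀ c n → c + c ≤ n → c ≤ n * ½
  arith c n h = lin (<⇒≤ (positive⁻¹ ½) ⊛ h) (solve (c ∷ n ∷ []) ℚ-ring)

-- H (M²) / M² ≤ 2 / M
H/n-small : ∀ η → 0ℚ < η → ∃ λ J → H (suc J) * r (suc J) ≤ η
H/n-small η 0<η = M ℕ.+ M ℕ.* suc M , ≤-trans
  (arith (H (m ℕ.* m)) (fromℕ m) (r m) (r (m ℕ.* m)) H-sq (r-* m m) (n*r m) (0≤r m))
  (<⇒≤ (proj₂ limit M ℕₚ.≤-refl))
  where
  limit : ∃ λ M → ∀ m → M ℕ.≤ m → fromℕ 2 * r (suc m) < η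
  limit = archimedean (fromℕ 2) η 0<η
  M m : ℕ
  M = proj₁ limit
  m = suc M
  H-sq : H (m ℕ.* m) ≤ fromℕ m + fromℕ m
  H-sq = ≤-trans (H-* M m) (≤-trans (H≤n M) (fromℕ-mono-≤ (ℕₚ.n≤1+n M)) ⊕ H≤n m)
  arith : ∀ h n x s → h ≤ n + n → s ≡ x * x → n * x ≡ 1ℚ → 0ℚ ≤ x → h * s ≤ fromℕ 2 * x
  arith h n x .(x * x) h≤ refl nx≡1 0≤x = lin
    (*-nonNeg₂ 0≤x 0≤x ⊛ h≤ ⊕ *-nonNeg₂ (0≤fromℕ 2) 0≤x ⊛ ≤-reflexive nx≡1)
    (solve (h ∷ n ∷ x ∷ []) ℚ-ring)

-- Counterpart of `lin` for equations: multiples of known equations are added up and the ring solver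
-- checks the remaining identity.
elin : ∀ {p q l r} → l ≡ r → p + r ≡ q + l → p ≡ q
elin refl eq = ≤-antisym (lin ≤-refl eq) (lin ≤-refl (sym eq))

0≤p*p : ∀ p → 0ℚ ≤ p * p
0≤p*p p with ≤-total 0ℚ p
... | inj₁ 0≤p = *-nonNeg₂ 0≤p 0≤p
... | inj₂ p≤0 = subst (0ℚ ≤_) (square p) (*-nonNeg₂ (0≤-p p p≤0) (0≤-p p p≤0))
  where
  square : ∀ p → - p * - p ≡ p * p
  square = solve-∀ ℚ-ring
  0≤-p : ∀ p → p ≤ 0ℚ → 0ℚ ≤ - p
  0≤-p p p≤0 = lin p≤0 (solve (p ∷ []) ℚ-ring)

-- Leibniz's series from Riemann sums

sgn : ℕ → ℚ
sgn zero    = 1ℚ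
sgn (suc n) = - sgn n

sgn-+ : ∀ m n → sgn (m ℕ.+ n) ≡ sgn m * sgn n
sgn-+ zero    n = sym (*-identityˡ (sgn n))
sgn-+ (suc m) n = trans (cong -_ (sgn-+ m n)) (neg-distribˡ-* (sgn m) (sgn n))

sgn² : ∀ n → sgn n * sgn n ≡ 1ℚ
sgn² zero    = refl
sgn² (suc n) = trans (square (sgn n)) (sgn² n)
  where
  square : ∀ p → - p * - p ≡ p * p
  square = solve-∀ ℚ-ring

sgn-*-≤ : ∀ n {p} → 0ℚ ≤ p → sgn n * p ≤ p × - p ≤ sgn n * p
sgn-*-≤ zero    {p} 0≤p = ≤-reflexive (*-identityˡ p) , lin (0≤p ⊕ 0≤p) (solve (p ∷ []) ℚ-ring)
sgn-*-≤ (suc n) {p} 0≤p = let hi , lo = sgn-*-≤ n 0≤p in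
  lin lo (upper (sgn n) p) , lin hi (lower (sgn n) p)
  where
  upper : ∀ s p → - s * p + s * p ≡ p + - p
  upper = solve-∀ ℚ-ring
  lower : ∀ s p → - p + p ≡ - s * p + s * p
  lower = solve-∀ ℚ-ring

pow : ℚ → ℕ → ℚ
pow x zero    = 1ℚ
pow x (suc n) = x * pow x n

0≤pow : ∀ {x} n → 0ℚ ≤ x → 0ℚ ≤ pow x n
0≤pow zero    0≤x = <⇒≤ 0<1
0≤pow (suc n) 0≤x = *-nonNeg₂ 0≤x (0≤pow n 0≤x)

pow-mono : ∀ {x y} n → 0ℚ ≤ x → x ≤ y → pow x n ≤ pow y n
pow-mono zero    0≤x x≤y = ≤-refl
pow-mono (suc n) 0≤x x≤y = *-mono₂-≤ 0≤x (0≤pow n (≤-trans 0≤x x≤y)) x≤y (pow-mono n 0≤x x≤y)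

pow-1 : ∀ n → pow 1ℚ n ≡ 1ℚ
pow-1 zero    = refl
pow-1 (suc n) = trans (*-identityˡ (pow 1ℚ n)) (pow-1 n)

-- Together with `≤-pow-difference` this replaces the derivative of t^(p + 1): summed over the
-- nodes, the differences telescope to 1 and squeeze the p-th moment around 1/(p + 1). The induction
-- uses y y^(p+1) - x x^(p+1) = y (y^(p+1) - x^(p+1)) + (y - x) x^(p+1).
pow-difference-≤ : ∀ {x y} p → 0ℚ ≤ x → x ≤ y →
  pow y (suc p) - pow x (suc p) ≤ fromℕ (suc p) * ((y - x) * pow y p)
pow-difference-≤ {x} {y} zero    0≤x x≤y = ≤-reflexive (base x y)
  where
  base : ∀ x y → y * 1ℚ - x * 1ℚ ≡ 1ℚ * ((y - x) * 1ℚ)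
  base = solve-∀ ℚ-ring
pow-difference-≤ {x} {y} (suc p) 0≤x x≤y = subst (λ n → pow y (suc (suc p)) - pow x (suc (suc p)) ≤ n * ((y - x) * pow y (suc p))) (sym (fromℕ-suc (suc p)))
  (step x y (pow x (suc p)) (pow y p) (fromℕ (suc p)) (pow-difference-≤ p 0≤x x≤y)
    (≤-trans 0≤x x≤y) x≤y (pow-mono (suc p) 0≤x x≤y))
  where
  step : ∀ x y a b n → y * b - a ≤ n * ((y - x) * b) → 0ℚ ≤ y → x ≤ y → a ≤ y * b →
    y * (y * b) - x * a ≤ (1ℚ + n) * ((y - x) * (y * b))
  step x y a b n h 0≤y x≤y a≤ = lin (0≤y ⊛ h ⊕ 0≤y-x ⊛ a≤) (solve (x ∷ y ∷ a ∷ b ∷ n ∷ []) ℚ-ring)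
    where
    0≤y-x : 0ℚ ≤ y - x
    0≤y-x = lin x≤y (solve (x ∷ y ∷ []) ℚ-ring)

≤-pow-difference : ∀ {x y} p → 0ℚ ≤ x → x ≤ y →
  fromℕ (suc p) * ((y - x) * pow x p) ≤ pow y (suc p) - pow x (suc p)
≤-pow-difference {x} {y} zero    0≤x x≤y = ≤-reflexive (base x y)
  where
  base : ∀ x y → 1ℚ * ((y - x) * 1ℚ) ≡ y * 1ℚ - x * 1ℚ
  base = solve-∀ ℚ-ring
≤-pow-difference {x} {y} (suc p) 0≤x x≤y = subst (λ n → n * ((y - x) * pow x (suc p)) ≤ pow y (suc (suc p)) - pow x (suc (suc p))) (sym (fromℕ-suc (suc p)))
  (step x y (pow x p) (pow y (suc p)) (fromℕ (suc p)) (≤-pow-difference p 0≤x x≤y)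
    0≤x x≤y (pow-mono (suc p) 0≤x x≤y))
  where
  step : ∀ x y a b n → n * ((y - x) * a) ≤ b - x * a → 0ℚ ≤ x → x ≤ y → x * a ≤ b →
    (1ℚ + n) * ((y - x) * (x * a)) ≤ y * b - x * (x * a)
  step x y a b n h 0≤x x≤y ≤b = lin (0≤x ⊛ h ⊕ 0≤y-x ⊛ ≤b) (solve (x ∷ y ∷ a ∷ b ∷ n ∷ []) ℚ-ring)
    where
    0≤y-x : 0ℚ ≤ y - x
    0≤y-x = lin x≤y (solve (x ∷ y ∷ []) ℚ-ring)

∑-differences : ∀ (u : ℕ → ℚ) n → ∑ (λ i → u (suc i) - u i) n ≡ u n - u 0
∑-differences u zero    = sym (+-inverseʳ (u 0))
∑-differences u (suc n) = trans (cong (_+ (u (suc n) - u n)) (∑-differences u n)) (telescope (u n) (u 0) (u (suc n)))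
  where
  telescope : ∀ a b c → a - b + (c - a) ≡ c - b
  telescope = solve-∀ ℚ-ring

-- Truncation of the geometric series in -t² for 1/(1 + t²).
partial : ℕ → ℚ → ℚ
partial J t = ∑ (λ j → sgn j * pow t (j ℕ.* 2)) J

geometric : ∀ t J → (1ℚ + t * t) * partial J t ≡ 1ℚ - sgn J * pow t (J ℕ.* 2)
geometric t zero    = *-zeroʳ (1ℚ + t * t)
geometric t (suc J) = step t (partial J t) (sgn J) (pow t (J ℕ.* 2)) (geometric t J)
  where
  step : ∀ t a s p → (1ℚ + t * t) * a ≡ 1ℚ - s * p →
    (1ℚ + t * t) * (a + s * p) ≡ 1ℚ - - s * (t * (t * p))
  step t a s p h = elin h (solve (t ∷ a ∷ s ∷ p ∷ []) ℚ-ring)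

[1+t²]⁻¹ : ℚ → ℚ
[1+t²]⁻¹ t = inv (1ℚ + t * t)

[1+t²]⁻¹-bounds : ∀ {t} → 0ℚ ≤ t → 0ℚ ≤ [1+t²]⁻¹ t × [1+t²]⁻¹ t ≤ 1ℚ
[1+t²]⁻¹-bounds {t} 0≤t = <⇒≤ (inv-pos (0<1+t² t 0≤t))
  , inv-antitone 0<1 (subst (_≤ 1ℚ + t * t) (+-identityʳ 1ℚ) (≤-refl {1ℚ} ⊕ *-nonNeg₂ 0≤t 0≤t))

-- The remainder is t^(2 J)/(1 + t²) up to sign, and 1/(1 + t²) ≤ 1.
geometric-bounds : ∀ {t} J → 0ℚ ≤ t → let a = partial J t ; p = pow t (J ℕ.* 2) in
  [1+t²]⁻¹ t ≤ a + p × a ≤ [1+t²]⁻¹ t + p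
geometric-bounds {t} J 0≤t =
  let 0≤v , v≤1 = [1+t²]⁻¹-bounds 0≤t
      hi , lo = sgn-*-≤ J (0≤pow (J ℕ.* 2) 0≤t)
  in upper (1ℚ + t * t) (partial J t) ([1+t²]⁻¹ t) (sgn J) (pow t (J ℕ.* 2)) (geometric t J) (*-inv-pos (0<1+t² t 0≤t)) 0≤v v≤1 hi (0≤pow (J ℕ.* 2) 0≤t)
   , lower (1ℚ + t * t) (partial J t) ([1+t²]⁻¹ t) (sgn J) (pow t (J ℕ.* 2)) (geometric t J) (*-inv-pos (0<1+t² t 0≤t)) 0≤v v≤1 lo (0≤pow (J ℕ.* 2) 0≤t)
  where
  upper : ∀ w a v s p → w * a ≡ 1ℚ - s * p → w * v ≡ 1ℚ → 0ℚ ≤ v → v ≤ 1ℚ → s * p ≤ p → 0ℚ ≤ p → v ≤ a + p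
  upper w a v s p wa wv 0≤v v≤1 sp≤ 0≤p = lin
    (0≤v ⊛ ≤-reflexive (sym wa) ⊕ 0≤v ⊛ sp≤ ⊕ 0≤p ⊛ v≤1 ⊕ ≤-reflexive (cong (a *_) wv))
    (solve (w ∷ a ∷ v ∷ s ∷ p ∷ []) ℚ-ring)
  lower : ∀ w a v s p → w * a ≡ 1ℚ - s * p → w * v ≡ 1ℚ → 0ℚ ≤ v → v ≤ 1ℚ → - p ≤ s * p → 0ℚ ≤ p → a ≤ v + p
  lower w a v s p wa wv 0≤v v≤1 ≤sp 0≤p = lin
    (0≤v ⊛ ≤-reflexive wa ⊕ 0≤v ⊛ ≤sp ⊕ 0≤p ⊛ v≤1 ⊕ ≤-reflexive (cong (a *_) (sym wv)))
    (solve (w ∷ a ∷ v ∷ s ∷ p ∷ []) ℚ-ring)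

-- The n-th partial sum of Leibniz's series for π/4.
L : ℕ → ℚ
L = ∑ (λ j → sgn j * r (suc (j ℕ.* 2)))

module Riemann (n : ℕ) .⦃ _ : ℕ.NonZero n ⦄ where

  node : ℕ → ℚ
  node i = fromℕ i * r n

  0≤node : ∀ i → 0ℚ ≤ node i
  0≤node i = *-nonNeg₂ (0≤fromℕ i) (0≤r n)

  node-step : ∀ i → node (suc i) - node i ≡ r n
  node-step i = trans (cong (λ s → s * r n - node i) (fromℕ-suc i)) (cancel (fromℕ i) (r n))
    where
    cancel : ∀ i x → (1ℚ + i) * x - i * x ≡ x
    cancel = solve-∀ ℚ-ring

  node-mono : ∀ i → node i ≤ node (suc i)
  node-mono i = lin (0≤r n) (trans (cong (node i +_) (sym (node-step i))) (cancel (node i) (node (suc i))))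
    where
    cancel : ∀ a b → a + (b - a) ≡ b + 0ℚ
    cancel = solve-∀ ℚ-ring

  average : (ℚ → ℚ) → ℚ
  average f = r n * ∑ (λ i → f (node (suc i))) n

  riemannSum-average : ∀ f → riemannSum 0ℚ 1ℚ f n ≡ average f
  riemannSum-average f = cong₂ _*_ (*-identityˡ (r n)) (∑-cong n λ i → cong f
    (trans (+-identityˡ _) (cong (fromℕ (suc i) *_) (*-identityˡ (r n)))))

  average-mono : ∀ f h → (∀ {t} → 0ℚ ≤ t → f t ≤ h t) → average f ≤ average h
  average-mono f h f≤h = 0≤r n ⊛ ∑-mono n λ i _ → f≤h (0≤node (suc i))

  average-+ : ∀ f h → average (λ t → f t + h t) ≡ average f + average h
  average-+ f h = trans (cong (r n *_) (∑-+ (λ i → f (node (suc i))) (λ i → h (node (suc i))) n)) (*-distribˡ-+ (r n) _ _)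

  average-1 : average (λ _ → 1ℚ) ≡ 1ℚ
  average-1 = trans (cong (r n *_) (trans (∑-const 1ℚ n) (*-identityʳ (fromℕ n)))) (trans (*-comm (r n) (fromℕ n)) (n*r n))

  average-0 : average (λ _ → 0ℚ) ≡ 0ℚ
  average-0 = trans (cong (r n *_) (∑-zero n)) (*-zeroʳ (r n))

  moment : ℕ → ℚ
  moment p = average (λ t → pow t p)

  ∑pow-differences : ∀ p → ∑ (λ i → pow (node (suc i)) (suc p) - pow (node i) (suc p)) n ≡ 1ℚ
  ∑pow-differences p = trans (∑-differences (λ i → pow (node i) (suc p)) n)
    (trans (cong₂ _-_ (trans (cong (λ t → pow t (suc p)) (n*r n)) (pow-1 (suc p)))
                      (trans (cong (_* pow (node 0) p) (*-zeroˡ (r n))) (*-zeroˡ (pow (node 0) p))))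
           refl)

  r≤moment : ∀ p → r (suc p) ≤ moment p
  r≤moment p = arith (fromℕ (suc p)) (r (suc p)) (moment p) (n*r (suc p)) (0≤r (suc p))
    (subst₂ _≤_ (∑pow-differences p)
      (trans (sym (*-∑ (fromℕ (suc p)) (λ i → r n * pow (node (suc i)) p) n))
        (cong (fromℕ (suc p) *_) (sym (*-∑ (r n) (λ i → pow (node (suc i)) p) n))))
      (∑-mono n λ i _ → subst (λ s → pow (node (suc i)) (suc p) - pow (node i) (suc p) ≤ fromℕ (suc p) * (s * pow (node (suc i)) p)) (node-step i)
        (pow-difference-≤ p (0≤node i) (node-mono i))))
    where
    arith : ∀ q x m → q * x ≡ 1ℚ → 0ℚ ≤ x → 1ℚ ≤ q * m → x ≤ m
    arith q x m qx≡1 0≤x h = lin (0≤x ⊛ h ⊕ ≤-reflexive (cong (m *_) qx≡1)) (solve (q ∷ x ∷ m ∷ []) ℚ-ring)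

  -- The lower bound for power differences involves left endpoints, where the sum is at most 1/(p +
  -- 1). Moving to right endpoints adds the last value 1 and drops a nonnegative first one, which
  -- costs at most 1/n.
  moment≤ : ∀ p → moment p ≤ r (suc p) + r n
  moment≤ p = arith (fromℕ (suc p)) (r (suc p)) (r n) (∑ (λ i → pow (node i) p) n)
      (∑ (λ i → pow (node (suc i)) p) n) (pow (node n) p) (pow (node 0) p)
    (n*r (suc p)) (0≤r (suc p)) (0≤r n) (∑-telescope (λ i → pow (node i) p) n)
    (trans (cong (λ t → pow t p) (n*r n)) (pow-1 p)) (0≤pow p (0≤node 0))
    (subst₂ _≤_
      (trans (sym (*-∑ (fromℕ (suc p)) (λ i → r n * pow (node i) p) n))
        (cong (fromℕ (suc p) *_) (sym (*-∑ (r n) (λ i → pow (node i) p) n))))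
      (∑pow-differences p)
      (∑-mono n λ i _ → subst (λ s → fromℕ (suc p) * (s * pow (node i) p) ≤ pow (node (suc i)) (suc p) - pow (node i) (suc p)) (node-step i)
        (≤-pow-difference p (0≤node i) (node-mono i))))
    where
    arith : ∀ q x y s₀ s₁ u₁ u₀ → q * x ≡ 1ℚ → 0ℚ ≤ x → 0ℚ ≤ y → s₀ + u₁ ≡ u₀ + s₁ → u₁ ≡ 1ℚ → 0ℚ ≤ u₀ →
      q * (y * s₀) ≤ 1ℚ → y * s₁ ≤ x + y
    arith q x y s₀ s₁ .1ℚ u₀ qx≡1 0≤x 0≤y tel refl 0≤u₀ h = lin
      (0≤x ⊛ h ⊕ ≤-reflexive (cong (y * s₀ *_) (sym qx≡1)) ⊕ 0≤y ⊛ ≤-reflexive (sym tel) ⊕ 0≤y ⊛ 0≤u₀)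
      (solve (q ∷ x ∷ y ∷ s₀ ∷ s₁ ∷ u₀ ∷ []) ℚ-ring)

  average-alternating : ∀ J → average (partial J) ≡ ∑ (λ j → sgn j * moment (j ℕ.* 2)) J
  average-alternating J = trans (cong (r n *_) (∑-swap (λ i j → sgn j * pow (node (suc i)) (j ℕ.* 2)) J n))
    (trans (*-∑ (r n) (λ j → ∑ (λ i → sgn j * pow (node (suc i)) (j ℕ.* 2)) n) J)
    (∑-cong J λ j → trans (cong (r n *_) (sym (*-∑ (sgn j) (λ i → pow (node (suc i)) (j ℕ.* 2)) n)))
      (swap (r n) (sgn j) _)))
    where
    swap : ∀ a b c → a * (b * c) ≡ b * (a * c)
    swap = solve-∀ ℚ-ring

  alternating-moments : ∀ J → let a = ∑ (λ j → sgn j * moment (j ℕ.* 2)) J in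
    a ≤ L J + fromℕ J * r n × L J ≤ a + fromℕ J * r n
  alternating-moments J =
      subst (∑ (λ j → sgn j * moment (j ℕ.* 2)) J ≤_) (total (λ j → sgn j * r (suc (j ℕ.* 2)))) (∑-mono J λ j _ → proj₁ (term j))
    , subst (L J ≤_) (total (λ j → sgn j * moment (j ℕ.* 2))) (∑-mono J λ j _ → proj₂ (term j))
    where
    total : ∀ f → ∑ (λ j → f j + r n) J ≡ ∑ f J + fromℕ J * r n
    total f = trans (∑-+ f (λ _ → r n) J) (cong (∑ f J +_) (∑-const (r n) J))
    term : ∀ j → let m = moment (j ℕ.* 2) ; x = r (suc (j ℕ.* 2)) in
      sgn j * m ≤ sgn j * x + r n × sgn j * x ≤ sgn j * m + r n
    term j = let m = moment (j ℕ.* 2)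
                 x = r (suc (j ℕ.* 2))
                 hi , lo = sgn-*-≤ j (0≤diff m x (r≤moment (j ℕ.* 2)))
             in upper (sgn j) m x (r n) hi (moment≤ (j ℕ.* 2)) , lower (sgn j) m x (r n) lo (moment≤ (j ℕ.* 2))
      where
      0≤diff : ∀ m x → x ≤ m → 0ℚ ≤ m - x
      0≤diff m x x≤m = lin x≤m (solve (m ∷ x ∷ []) ℚ-ring)
      upper : ∀ s m x y → s * (m - x) ≤ m - x → m ≤ x + y → s * m ≤ s * x + y
      upper s m x y h m≤ = lin (h ⊕ m≤) (solve (s ∷ m ∷ x ∷ y ∷ []) ℚ-ring)
      lower : ∀ s m x y → - (m - x) ≤ s * (m - x) → m ≤ x + y → s * x ≤ s * m + y
      lower s m x y h m≤ = lin (h ⊕ m≤) (solve (s ∷ m ∷ x ∷ y ∷ []) ℚ-ring)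

  arctanSum : ℚ
  arctanSum = riemannSum 0ℚ 1ℚ [1+t²]⁻¹ n

  0≤arctanSum : 0ℚ ≤ arctanSum
  0≤arctanSum = subst₂ _≤_ average-0 (sym (riemannSum-average [1+t²]⁻¹)) (average-mono (λ _ → 0ℚ) [1+t²]⁻¹ λ 0≤t → proj₁ ([1+t²]⁻¹-bounds 0≤t))

  arctanSum≤1 : arctanSum ≤ 1ℚ
  arctanSum≤1 = subst₂ _≤_ (sym (riemannSum-average [1+t²]⁻¹)) average-1 (average-mono [1+t²]⁻¹ (λ _ → 1ℚ) λ 0≤t → proj₂ ([1+t²]⁻¹-bounds 0≤t))

  -- J/n comes from replacing J moments by 1/(2 j + 1), and 1/(2 J + 1) + 1/n bounds the moment of
  -- the remainder t^(2 J). It becomes small by fixing a large J and then letting n grow.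
  leibnizError : ℕ → ℚ
  leibnizError J = fromℕ (suc J) * r n + r (suc (J ℕ.* 2))

  leibniz : ∀ J → arctanSum ≤ L J + leibnizError J × L J ≤ arctanSum + leibnizError J
  leibniz J =
      upper arctanSum a (moment (J ℕ.* 2)) (L J) (fromℕ J) (fromℕ (suc J)) (r n) (r (suc (J ℕ.* 2))) hi (proj₁ (alternating-moments J)) (moment≤ (J ℕ.* 2)) (fromℕ-suc J)
    , lower arctanSum a (moment (J ℕ.* 2)) (L J) (fromℕ J) (fromℕ (suc J)) (r n) (r (suc (J ℕ.* 2))) lo (proj₂ (alternating-moments J)) (moment≤ (J ℕ.* 2)) (fromℕ-suc J)
    where
    a : ℚ
    a = ∑ (λ j → sgn j * moment (j ℕ.* 2)) J
    hi : arctanSum ≤ a + moment (J ℕ.* 2)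
    hi = subst₂ _≤_ (sym (riemannSum-average [1+t²]⁻¹))
      (trans (average-+ (partial J) (λ t → pow t (J ℕ.* 2))) (cong (_+ moment (J ℕ.* 2)) (average-alternating J)))
      (average-mono [1+t²]⁻¹ (λ t → partial J t + pow t (J ℕ.* 2)) λ 0≤t → proj₁ (geometric-bounds J 0≤t))
    lo : a ≤ arctanSum + moment (J ℕ.* 2)
    lo = subst₂ _≤_ (average-alternating J)
      (trans (average-+ [1+t²]⁻¹ (λ t → pow t (J ℕ.* 2))) (cong (_+ moment (J ℕ.* 2)) (sym (riemannSum-average [1+t²]⁻¹))))
      (average-mono (partial J) (λ t → [1+t²]⁻¹ t + pow t (J ℕ.* 2)) λ 0≤t → proj₂ (geometric-bounds J 0≤t))
    upper : ∀ ρ a m l j j′ y x → ρ ≤ a + m → a ≤ l + j * y → m ≤ x + y → j′ ≡ 1ℚ + j → ρ ≤ l + (j′ * y + x)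
    upper ρ a m l j .(1ℚ + j) y x h₁ h₂ h₃ refl = lin (h₁ ⊕ h₂ ⊕ h₃) (solve (ρ ∷ a ∷ m ∷ l ∷ j ∷ y ∷ x ∷ []) ℚ-ring)
    lower : ∀ ρ a m l j j′ y x → a ≤ ρ + m → l ≤ a + j * y → m ≤ x + y → j′ ≡ 1ℚ + j → l ≤ ρ + (j′ * y + x)
    lower ρ a m l j .(1ℚ + j) y x h₁ h₂ h₃ refl = lin (h₁ ⊕ h₂ ⊕ h₃) (solve (ρ ∷ a ∷ m ∷ l ∷ j ∷ y ∷ x ∷ []) ℚ-ring)

-- The Basel problem by partial fractions

module Basel where

  X : ℕ → ℚ
  X = ∑ (λ k → r (suc (k ℕ.* 2)) * r (suc (k ℕ.* 2)))

  A : ℕ → ℚ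
  A = ∑ (λ i → sgn (suc i) * r (suc i))

  -- Multiplied by sgn (suc m), the alternating tail after the m-th term lies between 0 and 1/(m + 1).
  A-tail : ∀ m j → 0ℚ ≤ sgn (suc m) * (A (m ℕ.+ j) - A m) × sgn (suc m) * (A (m ℕ.+ j) - A m) ≤ r (suc m)
  A-tail m zero    = subst (λ s → 0ℚ ≤ s × s ≤ r (suc m))
    (sym (trans (cong (λ n → sgn (suc m) * (A n - A m)) (ℕₚ.+-identityʳ m)) (vanish (sgn (suc m)) (A m))))
    (≤-refl , 0≤r (suc m))
    where
    vanish : ∀ s a → s * (a - a) ≡ 0ℚ
    vanish = solve-∀ ℚ-ring
  A-tail m (suc j) = subst (λ n → 0ℚ ≤ s * (A n - A m) × s * (A n - A m) ≤ x) (sym (ℕₚ.+-suc m j))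
    (let lo , hi = A-tail (suc m) j in
       lower s x y (A m) (A (suc m ℕ.+ j)) (sgn² (suc m)) hi (r-antitone (ℕₚ.n≤1+n (suc m)))
     , upper s x (A m) (A (suc m ℕ.+ j)) (sgn² (suc m)) lo)
    where
    s = sgn (suc m)
    x = r (suc m)
    y = r (suc (suc m))
    lower : ∀ s x y a b → s * s ≡ 1ℚ → - s * (b - (a + s * x)) ≤ y → y ≤ x → 0ℚ ≤ s * (b - a)
    lower s x y a b ss≡1 h y≤x = lin (h ⊕ y≤x ⊕ ≤-reflexive (cong (x *_) (sym ss≡1))) (solve (s ∷ x ∷ y ∷ a ∷ b ∷ []) ℚ-ring)
    upper : ∀ s x a b → s * s ≡ 1ℚ → 0ℚ ≤ - s * (b - (a + s * x)) → s * (b - a) ≤ x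
    upper s x a b ss≡1 h = lin (h ⊕ ≤-reflexive (cong (x *_) ss≡1)) (solve (s ∷ x ∷ a ∷ b ∷ []) ℚ-ring)

  ∣A-A∣≤ : ∀ m j → ∣ A m - A (m ℕ.+ j) ∣ ≤ r (suc m)
  ∣A-A∣≤ m j = let 0≤ , ≤r = A-tail m j
                   hi , lo = sgn-*-≤ (suc m) 0≤
               in ∣∣≤ (first s a b (sgn² (suc m)) lo ≤r) (second s a b (sgn² (suc m)) hi ≤r)
    where
    s = sgn (suc m)
    a = A m
    b = A (m ℕ.+ j)
    first : ∀ s a b {x} → s * s ≡ 1ℚ → - (s * (b - a)) ≤ s * (s * (b - a)) → s * (b - a) ≤ x → a - b ≤ x
    first s a b {x} ss≡1 h h′ = lin (h ⊕ h′ ⊕ ≤-reflexive (cong ((b - a) *_) ss≡1)) (solve (s ∷ a ∷ b ∷ x ∷ []) ℚ-ring)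
    second : ∀ s a b {x} → s * s ≡ 1ℚ → s * (s * (b - a)) ≤ s * (b - a) → s * (b - a) ≤ x → - (a - b) ≤ x
    second s a b {x} ss≡1 h h′ = lin (h ⊕ h′ ⊕ ≤-reflexive (cong ((b - a) *_) (sym ss≡1))) (solve (s ∷ a ∷ b ∷ x ∷ []) ℚ-ring)

  x : ℕ → ℚ
  x k = r (suc (k ℕ.* 2))

  -- 1/(l − k), read as 0 for l = k.
  d : ℕ → ℕ → ℚ
  d k l = r (l ℕ.∸ k) - r (k ℕ.∸ l)

  -- With u = 2 k + 1 and v = 2 l + 1 this is, off the diagonal, (-1)^(k+l) · 4 v / (u (v² - u²)).
  -- It splits the products in 2 L² unevenly between (k, l) and (l, k), so that for fixed k the
  -- index l occurs only in simple fractions and the row sum collapses.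
  a : ℕ → ℕ → ℚ
  a k l = sgn k * sgn l * (x k * (r (suc (k ℕ.+ l)) + d k l))

  -- With u = 2k + 1 and v = 2l + 1: 1/(uv) = (1/u + 1/v)/(u + v) = (1/u − 1/v)/(v − u).
  a-symmetric : ∀ k t .⦃ _ : ℕ.NonZero t ⦄ → let l = k ℕ.+ t in
    a k l + a l k ≡ fromℕ 4 * (sgn k * x k) * (sgn l * x l)
  a-symmetric k t = trans (cong₂ (λ p q → sgn k * sgn l * (x k * p) + sgn l * sgn k * (x l * q))
      (cong (r (suc (k ℕ.+ l)) +_) dkl)
      (cong₂ _+_ (cong (λ n → r (suc n)) (ℕₚ.+-comm l k)) dlk))
    (trans (factor (sgn k) (sgn l) (x k) (x l) (r (suc (k ℕ.+ l))) (r t))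
    (trans (cong (sgn k * sgn l *_) (reciprocals (fromℕ (suc (k ℕ.* 2))) (fromℕ t) (x k) (x l) (r (suc (k ℕ.+ l))) (r t)
        (n*r (suc (k ℕ.* 2)))
        (trans (cong (_* x l) (sym v≡)) (n*r (suc (l ℕ.* 2))))
        (trans (cong (_* r (suc (k ℕ.+ l))) (sym w≡)) (n*r (suc (k ℕ.+ l))))
        (n*r t)))
      (regroup (sgn k) (sgn l) (x k) (x l))))
    where
    l = k ℕ.+ t
    dkl : d k l ≡ r t
    dkl = trans (cong₂ (λ m n → r m - r n) (ℕₚ.m+n∸m≡n k t) (ℕₚ.m≤n⇒m∸n≡0 (ℕₚ.m≤m+n k t))) (+-identityʳ (r t))
    dlk : d l k ≡ - r t
    dlk = trans (cong₂ (λ m n → r m - r n) (ℕₚ.m≤n⇒m∸n≡0 (ℕₚ.m≤m+n k t)) (ℕₚ.m+n∸m≡n k t)) (+-identityˡ (- r t))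
    twice : ∀ n → fromℕ (n ℕ.* 2) ≡ fromℕ n + fromℕ n
    twice n = trans (cong fromℕ (trans (ℕₚ.*-comm n 2) (cong (n ℕ.+_) (ℕₚ.+-identityʳ n)))) (fromℕ-+ n n)
    v≡ : fromℕ (suc (l ℕ.* 2)) ≡ fromℕ (suc (k ℕ.* 2)) + (fromℕ t + fromℕ t)
    v≡ = trans (fromℕ-suc (l ℕ.* 2)) (trans (cong (1ℚ +_) (trans (twice l) (cong (λ q → q + q) (fromℕ-+ k t))))
      (trans (regroup′ (fromℕ k) (fromℕ t)) (cong (_+ (fromℕ t + fromℕ t))
        (sym (trans (fromℕ-suc (k ℕ.* 2)) (cong (1ℚ +_) (twice k)))))))
      where
      regroup′ : ∀ k t → 1ℚ + (k + t + (k + t)) ≡ 1ℚ + (k + k) + (t + t)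
      regroup′ = solve-∀ ℚ-ring
    w≡ : fromℕ (suc (k ℕ.+ l)) ≡ fromℕ (suc (k ℕ.* 2)) + fromℕ t
    w≡ = trans (cong (fromℕ ∘ suc) (trans (sym (ℕₚ.+-assoc k k t))
        (cong (ℕ._+ t) (sym (trans (ℕₚ.*-comm k 2) (cong (k ℕ.+_) (ℕₚ.+-identityʳ k)))))))
      (fromℕ-+ (suc (k ℕ.* 2)) t)
    factor : ∀ s s′ p q w y → s * s′ * (p * (w + y)) + s′ * s * (q * (w + - y)) ≡ s * s′ * (p * (w + y) + q * (w - y))
    factor = solve-∀ ℚ-ring
    regroup : ∀ s s′ p q → s * s′ * (fromℕ 4 * (p * q)) ≡ fromℕ 4 * (s * p) * (s′ * q)
    regroup = solve-∀ ℚ-ring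
    reciprocals : ∀ u t p q w y → u * p ≡ 1ℚ → (u + (t + t)) * q ≡ 1ℚ → (u + t) * w ≡ 1ℚ → t * y ≡ 1ℚ →
      p * (w + y) + q * (w - y) ≡ fromℕ 4 * (p * q)
    reciprocals u t p q w y up≡1 vq≡1 ow≡1 ty≡1 = elin
      (cong₂ _+_ (cong₂ _+_ (cong₂ _+_
        (cong ((p * w + p * y) *_) (sym vq≡1))
        (cong ((q * w - q * y) *_) (sym up≡1)))
        (cong (fromℕ 2 * (p * q) *_) ow≡1))
        (cong (fromℕ 2 * (p * q) *_) ty≡1))
      (solve (u ∷ t ∷ p ∷ q ∷ w ∷ y ∷ []) ℚ-ring)

  a-diagonal : ∀ k → a k k ≡ x k * x k
  a-diagonal k = trans (cong₂ (λ s p → s * (x k * p)) (sgn² k)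
      (trans (cong₂ _+_ (cong (r ∘ suc) double) (+-inverseʳ (r (k ℕ.∸ k)))) (+-identityʳ (x k))))
    (*-identityˡ (x k * x k))
    where
    double : k ℕ.+ k ≡ k ℕ.* 2
    double = sym (trans (ℕₚ.*-comm k 2) (cong (k ℕ.+_) (ℕₚ.+-identityʳ k)))

  -- Off the diagonal each pair (k, l), (l, k) contributes four products, as in 2 L²; on the
  -- diagonal `a k k` is one square where 2 L² has two, whence - X. The induction adds one row and
  -- one column.
  ∑∑a : ∀ n → ∑ (λ k → ∑ (a k) n) n ≡ L n * L n + L n * L n - X n
  ∑∑a zero    = refl
  ∑∑a (suc n) = trans (cong (_+ (∑ (a n) n + a n n)) (∑-+ (λ k → ∑ (a k) n) (λ k → a k n) n))
    (trans (regroup (∑ (λ k → ∑ (a k) n) n) (∑ (λ k → a k n) n) (∑ (a n) n) (a n n))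
    (trans (cong₂ _+_ (cong₂ _+_ (∑∑a n) cross) (a-diagonal n))
      (finish (L n) (X n) (sgn n) (x n) (sgn² n))))
    where
    regroup : ∀ p q u v → p + q + (u + v) ≡ p + (q + u) + v
    regroup = solve-∀ ℚ-ring
    cross : ∑ (λ k → a k n) n + ∑ (a n) n ≡ L n * (fromℕ 4 * (sgn n * x n))
    cross = trans (sym (∑-+ (λ k → a k n) (a n) n)) (trans (∑-cong< n λ k k<n →
        trans (pair k k<n) (commute (sgn k * x k) (sgn n * x n)))
      (trans (sym (*-∑ (fromℕ 4 * (sgn n * x n)) (λ k → sgn k * x k) n)) (*-comm (fromℕ 4 * (sgn n * x n)) (L n))))
      where
      commute : ∀ p q → fromℕ 4 * p * q ≡ fromℕ 4 * q * p
      commute = solve-∀ ℚ-ring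
      pair : ∀ k → k ℕ.< n → a k n + a n k ≡ fromℕ 4 * (sgn k * x k) * (sgn n * x n)
      pair k k<n = subst (λ l → a k l + a l k ≡ fromℕ 4 * (sgn k * x k) * (sgn l * x l)) (ℕₚ.m+[n∸m]≡n (ℕₚ.<⇒≤ k<n))
        (a-symmetric k (n ℕ.∸ k) ⦃ ℕ.>-nonZero (ℕₚ.m<n⇒0<n∸m k<n) ⦄)
    finish : ∀ l X s x → s * s ≡ 1ℚ → l * l + l * l - X + l * (fromℕ 4 * (s * x)) + x * x ≡
      (l + s * x) * (l + s * x) + (l + s * x) * (l + s * x) - (X + x * x)
    finish l X s x ss≡1 = elin (cong (fromℕ 2 * (x * x) *_) (sym ss≡1)) (solve (l ∷ X ∷ s ∷ x ∷ []) ℚ-ring)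

  -- With the sign of k ± l attached, the fractions 1/(l - k) and 1/(k + l + 1) run through
  -- stretches of the alternating harmonic series. The `A k` from l < k cancels the one from the
  -- sums k + l + 1, leaving a single tail.
  ∑a : ∀ k m → ∑ (a k) (k ℕ.+ suc m) ≡ x k * (A m - A (k ℕ.+ (k ℕ.+ suc m)))
  ∑a k m = trans (∑-cong n λ l → rearrange (sgn k * sgn l) (x k) (r (suc (k ℕ.+ l))) (d k l))
    (trans (sym (*-∑ (x k) (λ l → sgn k * sgn l * d k l + sgn k * sgn l * r (suc (k ℕ.+ l))) n))
    (cong (x k *_) (trans (∑-+ (λ l → sgn k * sgn l * d k l) (λ l → sgn k * sgn l * r (suc (k ℕ.+ l))) n)
      (trans (cong₂ _+_ differences sums) (combine (A k) (A m) (A (k ℕ.+ n)))))))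
    where
    n = k ℕ.+ suc m
    rearrange : ∀ s x w d → s * (x * (w + d)) ≡ x * (s * d + s * w)
    rearrange = solve-∀ ℚ-ring
    combine : ∀ p q t → - p + q + (p - t) ≡ q - t
    combine = solve-∀ ℚ-ring
    sums : ∑ (λ l → sgn k * sgn l * r (suc (k ℕ.+ l))) n ≡ A k - A (k ℕ.+ n)
    sums = isolate {q = A k} {u = ∑ (λ l → sgn k * sgn l * r (suc (k ℕ.+ l))) n} (∑-append (λ i → sgn (suc i) * r (suc i)) k n) (trans
        (∑-cong n λ l → trans (cong (λ s → - s * r (suc (k ℕ.+ l))) (sgn-+ k l)) (move (sgn k * sgn l) (r (suc (k ℕ.+ l)))))
        (sym (*-∑ (- 1ℚ) (λ l → sgn k * sgn l * r (suc (k ℕ.+ l))) n)))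
      where
      move : ∀ s r → - s * r ≡ - 1ℚ * (s * r)
      move = solve-∀ ℚ-ring
      isolate : ∀ {p q t u} → p ≡ q + t → t ≡ - 1ℚ * u → u ≡ q - p
      isolate {q = q} {u = u} refl refl = cancel q u
        where
        cancel : ∀ q u → u ≡ q - (q + - 1ℚ * u)
        cancel = solve-∀ ℚ-ring
    below : ∑ (λ l → sgn k * sgn l * d k l) k ≡ - A k
    below = trans (∑-cong< k term) (trans (∑-reverse (λ t → sgn (suc t) * r t) k)
      (trans (∑-cong k λ i → move (sgn (suc i)) (r (suc i))) (trans (sym (*-∑ (- 1ℚ) (λ i → sgn (suc i) * r (suc i)) k)) (neg-1 (A k)))))
      where
      move : ∀ s r → - s * r ≡ - 1ℚ * (s * r)
      move = solve-∀ ℚ-ring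
      neg-1 : ∀ p → - 1ℚ * p ≡ - p
      neg-1 = solve-∀ ℚ-ring
      term : ∀ l → l ℕ.< k → sgn k * sgn l * d k l ≡ sgn (suc (k ℕ.∸ l)) * r (k ℕ.∸ l)
      term l l<k = trans (cong₂ _*_ signs (cong (λ t → r t - r (k ℕ.∸ l)) (ℕₚ.m≤n⇒m∸n≡0 (ℕₚ.<⇒≤ l<k))))
        (negate (sgn (k ℕ.∸ l)) (r (k ℕ.∸ l)))
        where
        negate : ∀ s r → s * (0ℚ - r) ≡ - s * r
        negate = solve-∀ ℚ-ring
        signs : sgn k * sgn l ≡ sgn (k ℕ.∸ l)
        signs = trans (cong (λ j → sgn j * sgn l) (sym (ℕₚ.m∸n+n≡m (ℕₚ.<⇒≤ l<k))))
          (trans (cong (_* sgn l) (sgn-+ (k ℕ.∸ l) l)) (trans (*-assoc (sgn (k ℕ.∸ l)) (sgn l) (sgn l))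
            (trans (cong (sgn (k ℕ.∸ l) *_) (sgn² l)) (*-identityʳ (sgn (k ℕ.∸ l))))))
    above : ∑ (λ i → sgn k * sgn (k ℕ.+ i) * d k (k ℕ.+ i)) (suc m) ≡ A m
    -- The term i = 0 belongs to l = k and vanishes because `r 0` is 0.
    above = trans (∑-cong (suc m) term) (trans (∑-front (λ i → sgn i * r i) m) (+-identityˡ (A m)))
      where
      term : ∀ i → sgn k * sgn (k ℕ.+ i) * d k (k ℕ.+ i) ≡ sgn i * r i
      term i = cong₂ _*_
        (trans (cong (sgn k *_) (sgn-+ k i)) (trans (sym (*-assoc (sgn k) (sgn k) (sgn i)))
          (trans (cong (_* sgn i) (sgn² k)) (*-identityˡ (sgn i)))))
        (trans (cong₂ (λ p q → r p - r q) (ℕₚ.m+n∸m≡n k i) (ℕₚ.m≤n⇒m∸n≡0 (ℕₚ.m≤m+n k i))) (+-identityʳ (r i)))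
    differences : ∑ (λ l → sgn k * sgn l * d k l) n ≡ - A k + A m
    differences = trans (∑-append (λ l → sgn k * sgn l * d k l) k (suc m)) (cong₂ _+_ below above)

  -- The tail in `∑a` is at most 1/(n - k) and `x k` at most 1/(k + 1); their product is split by
  -- partial fractions with denominator sum n + 1, so that summing over k gives 2 H(n)/(n + 1).
  ∣∑a∣≤ : ∀ n k → k ℕ.< n → ∣ ∑ (a k) n ∣ ≤ r (suc n) * (r (suc k) + r (n ℕ.∸ k))
  ∣∑a∣≤ n k k<n = subst (λ n → ∣ ∑ (a k) n ∣ ≤ r (suc n) * (r (suc k) + r (n ℕ.∸ k))) n≡ bound
    where
    m = n ℕ.∸ suc k
    n≡ : k ℕ.+ suc m ≡ n
    n≡ = trans (ℕₚ.+-suc k m) (ℕₚ.m+[n∸m]≡n k<n)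
    arrange : ∀ k m → m ℕ.+ (k ℕ.+ suc k) ≡ k ℕ.+ (k ℕ.+ suc m)
    arrange k m = trans (ℕₚ.+-comm m (k ℕ.+ suc k)) (trans (ℕₚ.+-assoc k (suc k) m) (cong (k ℕ.+_) (sym (ℕₚ.+-suc k m))))
    n∸k : k ℕ.+ suc m ℕ.∸ k ≡ suc m
    n∸k = ℕₚ.m+n∸m≡n k (suc m)
    fraction : r (suc k) * r (suc m) ≡ r (suc (k ℕ.+ suc m)) * (r (suc k) + r (suc m))
    fraction = fractions (fromℕ (suc k)) (fromℕ (suc m)) (r (suc k)) (r (suc m)) (r (suc (k ℕ.+ suc m)))
      (n*r (suc k)) (n*r (suc m)) (trans (cong (_* r (suc (k ℕ.+ suc m))) (sym (fromℕ-+ (suc k) (suc m)))) (n*r (suc (k ℕ.+ suc m))))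
      where
      fractions : ∀ u v p q w → u * p ≡ 1ℚ → v * q ≡ 1ℚ → (u + v) * w ≡ 1ℚ → p * q ≡ w * (p + q)
      fractions u v p q w up≡1 vq≡1 sw≡1 = elin
        (cong₂ _+_ (cong₂ _+_ (cong (w * q *_) up≡1) (cong (w * p *_) vq≡1)) (cong (p * q *_) (sym sw≡1)))
        (solve (u ∷ v ∷ p ∷ q ∷ w ∷ []) ℚ-ring)
    bound : ∣ ∑ (a k) (k ℕ.+ suc m) ∣ ≤ r (suc (k ℕ.+ suc m)) * (r (suc k) + r (k ℕ.+ suc m ℕ.∸ k))
    bound = subst₂ _≤_ (sym (trans (cong ∣_∣ (∑a k m)) (trans (∣p*q∣≡∣p∣*∣q∣ (x k) (A m - A (k ℕ.+ (k ℕ.+ suc m))))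
        (cong (_* ∣ A m - A (k ℕ.+ (k ℕ.+ suc m)) ∣) (0≤p⇒∣p∣≡p (0≤r (suc (k ℕ.* 2))))))))
      (trans fraction (cong (λ t → r (suc (k ℕ.+ suc m)) * (r (suc k) + r t)) (sym n∸k)))
      (*-mono₂-≤ (0≤r (suc (k ℕ.* 2))) (0≤r (suc m)) (r-antitone (s≤s (ℕₚ.m≤m*n k 2)))
        (subst (λ t → ∣ A m - A t ∣ ≤ r (suc m)) (arrange k m) (∣A-A∣≤ m (k ℕ.+ suc k))))

  ∣2L²-X∣≤ : ∀ n → ∣ L n * L n + L n * L n - X n ∣ ≤ r (suc n) * (H n + H n)
  ∣2L²-X∣≤ n = subst (λ s → ∣ s ∣ ≤ r (suc n) * (H n + H n)) (∑∑a n)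
    (≤-trans (∣∑∣≤∑∣∣ (λ k → ∑ (a k) n) n) (≤-trans (∑-mono n (∣∑a∣≤ n))
      (≤-reflexive (trans (sym (*-∑ (r (suc n)) (λ k → r (suc k) + r (n ℕ.∸ k)) n))
        (cong (r (suc n) *_) (trans (∑-+ (λ k → r (suc k)) (λ k → r (n ℕ.∸ k)) n)
          (cong (H n +_) (∑-reverse r n))))))))

  X-Z : ∀ n → Z (n ℕ.* 2) ≡ X n + ½ * ½ * Z n
  X-Z n = trans (∑-parity (λ i → r (suc i) * r (suc i)) n) (cong (X n +_)
    (trans (∑-cong n λ i → trans (cong (λ s → s * s) (r-* (suc i) 2)) (square (r (suc i))))
      (sym (*-∑ (½ * ½) (λ i → r (suc i) * r (suc i)) n))))
    where
    square : ∀ p → p * ½ * (p * ½) ≡ ½ * ½ * (p * p)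
    square = solve-∀ ℚ-ring

open Basel using (X; ∣2L²-X∣≤; X-Z)

-- The chain is π² ≈ 16 L² ≈ 8 X ≈ 8 (Z - ¼ Z) = 6 Z. The arctangent sum is within 2 η of L, 2 L²
-- within 2 η of X, and Z(2 J) within η of Z(J); 152 η covers the accumulated error in both
-- directions.
π²≈6Z : ∀ η → 0ℚ < η → η ≤ 1ℚ → ∃ λ J → r (suc J) ≤ η × ∃ λ K → ∀ k → K ℕ.≤ k →
  seq π k * seq π k ≤ fromℕ 6 * Z (suc J) + fromℕ 152 * η ×
  fromℕ 6 * Z (suc J) ≤ seq π k * seq π k + fromℕ 152 * η
π²≈6Z η 0<η η≤1 = J′ , rJ≤η , proj₁ limit , close
  where
  0≤η : 0ℚ ≤ η
  0≤η = <⇒≤ 0<η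
  choice : ∃ λ J → H (suc J) * r (suc J) ≤ η
  choice = H/n-small η 0<η
  J′ J : ℕ
  J′ = proj₁ choice
  J = suc J′
  rJ≤η : r J ≤ η
  rJ≤η = ≤-trans (subst (_≤ H J * r J) (*-identityˡ (r J))
    (*-mono₂-≤ (<⇒≤ 0<1) (0≤r J) (H-mono {1} {J} (s≤s z≤n)) ≤-refl)) (proj₂ choice)
  limit : ∃ λ K → ∀ k → K ℕ.≤ k → fromℕ (suc J) * r (suc k) < η
  limit = archimedean (fromℕ (suc J)) η 0<η
  β≤2η : r (suc J) * (H J + H J) ≤ η + η
  β≤2η = ≤-trans (*-mono₂-≤ (0≤r (suc J)) (0≤H J ⊕ 0≤H J) (r-antitone (ℕₚ.n≤1+n J)) ≤-refl)
    (arith (r J) (H J) η (proj₂ choice))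
    where
    arith : ∀ x h η → h * x ≤ η → x * (h + h) ≤ η + η
    arith x h η hx≤ = lin (hx≤ ⊕ hx≤) (solve (x ∷ h ∷ η ∷ []) ℚ-ring)
  -- The square of l is reached through (l - ρ)² ≥ 0, so that bounds on ρ suffice.
  arith-upper : ∀ ρ l X z z₂ η → ρ ≤ l + (η + η) → 0ℚ ≤ ρ → ρ ≤ 1ℚ → 0ℚ ≤ η →
    l * l + l * l - X ≤ η + η → z₂ ≡ X + ½ * ½ * z → z₂ ≤ z + η →
    fromℕ 4 * ρ * (fromℕ 4 * ρ) ≤ fromℕ 6 * z + fromℕ 152 * η
  arith-upper ρ l X z z₂ η ρ≤ 0≤ρ ρ≤1 0≤η D≤ z₂≡ z₂≤ = lin
    (*-nonNeg₂ (0≤fromℕ 32) 0≤ρ ⊛ ρ≤ ⊕ *-nonNeg₂ (0≤fromℕ 64) 0≤η ⊛ ρ≤1 ⊕ 0≤fromℕ 16 ⊛ 0≤p*p (l - ρ)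
      ⊕ 0≤fromℕ 64 ⊛ 0≤η ⊕ 0≤fromℕ 8 ⊛ D≤ ⊕ 0≤fromℕ 8 ⊛ ≤-reflexive (sym z₂≡) ⊕ 0≤fromℕ 8 ⊛ z₂≤)
    (solve (ρ ∷ l ∷ X ∷ z ∷ z₂ ∷ η ∷ []) ℚ-ring)
  -- Here (l - ρ)² must be bounded above; the product of the two closeness hypotheses says (2 η)² -
  -- (l - ρ)² ≥ 0.
  arith-lower : ∀ ρ l X z z₂ η → ρ ≤ l + (η + η) → l ≤ ρ + (η + η) → 0ℚ ≤ ρ → ρ ≤ 1ℚ → 0ℚ ≤ η → η ≤ 1ℚ →
    - (l * l + l * l - X) ≤ η + η → z₂ ≡ X + ½ * ½ * z → z ≤ z₂ →
    fromℕ 6 * z ≤ fromℕ 4 * ρ * (fromℕ 4 * ρ) + fromℕ 152 * η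
  arith-lower ρ l X z z₂ η ρ≤ l≤ 0≤ρ ρ≤1 0≤η η≤1 -D≤ z₂≡ z≤ = lin
    (*-nonNeg₂ (0≤fromℕ 32) 0≤ρ ⊛ l≤ ⊕ *-nonNeg₂ (0≤fromℕ 64) 0≤η ⊛ ρ≤1 ⊕ 0≤fromℕ 16 ⊛ *-nonNeg₂ (0≤diff ρ≤) (0≤diff l≤)
      ⊕ *-nonNeg₂ (0≤fromℕ 64) 0≤η ⊛ η≤1 ⊕ 0≤fromℕ 8 ⊛ -D≤ ⊕ 0≤fromℕ 8 ⊛ ≤-reflexive z₂≡ ⊕ 0≤fromℕ 8 ⊛ z≤ ⊕ 0≤fromℕ 8 ⊛ 0≤η)
    (solve (ρ ∷ l ∷ X ∷ z ∷ z₂ ∷ η ∷ []) ℚ-ring)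
    where
    0≤diff : ∀ {p q} → p ≤ q → 0ℚ ≤ q - p
    0≤diff {p} {q} p≤q = lin p≤q (solve (p ∷ q ∷ []) ℚ-ring)
  close : ∀ k → proj₁ limit ℕ.≤ k →
    seq π k * seq π k ≤ fromℕ 6 * Z J + fromℕ 152 * η × fromℕ 6 * Z J ≤ seq π k * seq π k + fromℕ 152 * η
  close k K≤k =
      arith-upper ρ (L J) (X J) (Z J) (Z (J ℕ.* 2)) η ρ≤ 0≤arctanSum arctanSum≤1 0≤η D≤ (X-Z J) ≤Z
    , arith-lower ρ (L J) (X J) (Z J) (Z (J ℕ.* 2)) η ρ≤ L≤ 0≤arctanSum arctanSum≤1 0≤η η≤1 -D≤ (X-Z J) Z≤
    where
    open Riemann (suc k)
    ρ : ℚ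
    ρ = arctanSum
    error≤ : leibnizError J ≤ η + η
    error≤ = <⇒≤ (proj₂ limit k K≤k) ⊕ ≤-trans (r-antitone (ℕₚ.m≤n⇒m≤1+n (ℕₚ.m≤m*n J 2))) rJ≤η
    ρ≤ : ρ ≤ L J + (η + η)
    ρ≤ = ≤-trans (proj₁ (leibniz J)) (≤-refl {L J} ⊕ error≤)
    L≤ : L J ≤ ρ + (η + η)
    L≤ = ≤-trans (proj₂ (leibniz J)) (≤-refl {ρ} ⊕ error≤)
    D≤ : L J * L J + L J * L J - X J ≤ η + η
    D≤ = ≤-trans (p≤∣p∣ _) (≤-trans (∣2L²-X∣≤ J) β≤2η)
    -D≤ : - (L J * L J + L J * L J - X J) ≤ η + η
    -D≤ = ≤-trans (-p≤∣p∣ _) (≤-trans (∣2L²-X∣≤ J) β≤2η)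
    Z≤ : Z J ≤ Z (J ℕ.* 2)
    Z≤ = Z-mono (ℕₚ.m≤m*n J 2)
    ≤Z : Z (J ℕ.* 2) ≤ Z J + η
    ≤Z = ≤-trans (Z-bound J (J ℕ.* 2)) (≤-refl {Z J} ⊕ rJ≤η)

-- Assembling the estimates

Φ-suc : ∀ n → fromℕ (suc n) * H (suc n) ≤ Φ n + fromℕ 2 * fromℕ (suc n)
Φ-suc n = arith (fromℕ n) (fromℕ (suc n)) (H n) (r (suc n)) (fromℕ-suc n) (n*r (suc n)) (H≤n n) (0≤fromℕ n)
  where
  arith : ∀ n n′ h x → n′ ≡ 1ℚ + n → n′ * x ≡ 1ℚ → h ≤ n → 0ℚ ≤ n → n′ * (h + x) ≤ n * h + fromℕ 2 * n′
  arith n .(1ℚ + n) h x refl n′x≡1 h≤n 0≤n = lin (h≤n ⊕ ≤-reflexive n′x≡1 ⊕ 0≤n ⊕ <⇒≤ 0<1) (solve (n ∷ h ∷ x ∷ []) ℚ-ring)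

-- For one N and one index k: G is the sum up to m = N - 1, n = N, φ = Φ(N - 1), h = H(N), z = Z(J),
-- x = 1/J, and ℓ and P are the k-th terms of `log N` and of π². Abstract rationals keep the
-- certificates polynomial identities in free variables.
record Approximation (G n m φ h ℓ z x P η ε : ℚ) : Set where
  field
    G-upper : z * G - φ ≤ fromℕ 16 * (fromℕ 11 * m + x * φ) + fromℕ 2 * m
    G-lower : - (z * G - φ) ≤ fromℕ 16 * (fromℕ 11 * m + x * φ) + fromℕ 2 * m
    P-upper : P ≤ fromℕ 6 * z + fromℕ 152 * η
    P-lower : fromℕ 6 * z ≤ P + fromℕ 152 * η
    x≤η     : x ≤ η
    1≤z     : 1ℚ ≤ z
    z≤2     : z ≤ fromℕ 2
    ℓ≤h     : ℓ ≤ h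
    h≤ℓ+2   : h ≤ ℓ + fromℕ 2
    φ≤nh    : φ ≤ n * h
    nh≤φ+2n : n * h ≤ φ + fromℕ 2 * n
    m≤n     : m ≤ n
    0≤G     : 0ℚ ≤ G
    0≤φ     : 0ℚ ≤ φ
    1≤n     : 1ℚ ≤ n
    0≤η     : 0ℚ ≤ η
    η-small : fromℕ 152 * η ≤ 1ℚ
    η≪ε     : fromℕ 59472 * η ≤ ε
    4≤h     : fromℕ 4 ≤ h
    1/ε≪h   : fromℕ 1080 ≤ ε * h
    0≤ε     : 0ℚ ≤ ε

  η≤1 : η ≤ 1ℚ
  η≤1 = ≤-trans (subst (_≤ fromℕ 152 * η) (*-identityˡ η) (*-mono₂-≤ (0≤fromℕ 1) 0≤η (fromℕ-mono-≤ {1} {152} (s≤s z≤n)) ≤-refl)) η-small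

  0≤n : 0ℚ ≤ n
  0≤n = ≤-trans (0≤fromℕ 1) 1≤n

  0≤nh : 0ℚ ≤ n * h
  0≤nh = ≤-trans 0≤φ φ≤nh

  -- 178 = 16 · 11 + 2.
  error≤ : fromℕ 16 * (fromℕ 11 * m + x * φ) + fromℕ 2 * m ≤ fromℕ 178 * n + fromℕ 16 * (η * (n * h))
  error≤ = arith m n x φ η (n * h) m≤n (*-mono-≤₀ 0≤φ x≤η) (*-mono-≤₀ 0≤η φ≤nh)
    where
    arith : ∀ m n x φ η u → m ≤ n → φ * x ≤ φ * η → η * φ ≤ η * u →
      fromℕ 16 * (fromℕ 11 * m + x * φ) + fromℕ 2 * m ≤ fromℕ 178 * n + fromℕ 16 * (η * u)
    arith m n x φ η u h₁ h₂ h₃ = lin (0≤fromℕ 178 ⊛ h₁ ⊕ 0≤fromℕ 16 ⊛ h₂ ⊕ 0≤fromℕ 16 ⊛ h₃)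
      (solve (m ∷ n ∷ x ∷ φ ∷ η ∷ u ∷ []) ℚ-ring)

  -- 195 = 1 + 178 + 16, using z ≥ 1, h ≥ 1 and η ≤ 1.
  G≤ : G ≤ fromℕ 195 * (n * h)
  G≤ = arith G n φ h z η _ 0≤G 1≤z G-upper error≤ φ≤nh (*-mono-≤₀ 0≤n (≤-trans (fromℕ-mono-≤ {1} {4} (s≤s z≤n)) 4≤h)) (*-mono-≤₀ 0≤nh η≤1)
    where
    arith : ∀ G n φ h z η e → 0ℚ ≤ G → 1ℚ ≤ z → z * G - φ ≤ e → e ≤ fromℕ 178 * n + fromℕ 16 * (η * (n * h)) →
      φ ≤ n * h → n * 1ℚ ≤ n * h → n * h * η ≤ n * h * 1ℚ → G ≤ fromℕ 195 * (n * h)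
    arith G n φ h z η e 0≤G 1≤z h₁ h₂ h₃ h₄ h₅ = lin
      (0≤G ⊛ 1≤z ⊕ h₁ ⊕ h₂ ⊕ h₃ ⊕ 0≤fromℕ 178 ⊛ h₄ ⊕ 0≤fromℕ 16 ⊛ h₅)
      (solve (G ∷ n ∷ φ ∷ h ∷ z ∷ η ∷ e ∷ []) ℚ-ring)

  -- Split P G - 6 n ℓ as (P - 6 z) G + 6 (z G - φ) + 6 (φ - n ℓ). The constants are 1080 = 6 · 178
  -- + 6 · 2 and 29736 = 152 · 195 + 6 · 16.
  main-upper : P * G - fromℕ 6 * (n * ℓ) ≤ fromℕ 1080 * n + fromℕ 29736 * (η * (n * h))
  main-upper = arith P G z φ η n h ℓ _ 0≤G 0≤η 0≤n P-upper G-upper error≤ G≤ φ≤nh h≤ℓ+2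
    where
    arith : ∀ P G z φ η n h ℓ e → 0ℚ ≤ G → 0ℚ ≤ η → 0ℚ ≤ n → P ≤ fromℕ 6 * z + fromℕ 152 * η → z * G - φ ≤ e →
      e ≤ fromℕ 178 * n + fromℕ 16 * (η * (n * h)) → G ≤ fromℕ 195 * (n * h) → φ ≤ n * h → h ≤ ℓ + fromℕ 2 →
      P * G - fromℕ 6 * (n * ℓ) ≤ fromℕ 1080 * n + fromℕ 29736 * (η * (n * h))
    arith P G z φ η n h ℓ e 0≤G 0≤η 0≤n h₁ h₂ h₃ h₄ h₅ h₆ = lin
      (0≤G ⊛ h₁ ⊕ 0≤fromℕ 6 ⊛ h₂ ⊕ 0≤fromℕ 6 ⊛ h₃ ⊕ *-nonNeg₂ (0≤fromℕ 152) 0≤η ⊛ h₄ ⊕ 0≤fromℕ 6 ⊛ h₅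
        ⊕ *-nonNeg₂ (0≤fromℕ 6) 0≤n ⊛ h₆)
      (solve (P ∷ G ∷ z ∷ φ ∷ η ∷ n ∷ h ∷ ℓ ∷ e ∷ []) ℚ-ring)

  main-lower : - (P * G - fromℕ 6 * (n * ℓ)) ≤ fromℕ 1080 * n + fromℕ 29736 * (η * (n * h))
  main-lower = arith P G z φ η n h ℓ _ 0≤G 0≤η 0≤n P-lower G-lower error≤ G≤ nh≤φ+2n ℓ≤h
    where
    arith : ∀ P G z φ η n h ℓ e → 0ℚ ≤ G → 0ℚ ≤ η → 0ℚ ≤ n → fromℕ 6 * z ≤ P + fromℕ 152 * η → - (z * G - φ) ≤ e →
      e ≤ fromℕ 178 * n + fromℕ 16 * (η * (n * h)) → G ≤ fromℕ 195 * (n * h) → n * h ≤ φ + fromℕ 2 * n → ℓ ≤ h →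
      - (P * G - fromℕ 6 * (n * ℓ)) ≤ fromℕ 1080 * n + fromℕ 29736 * (η * (n * h))
    arith P G z φ η n h ℓ e 0≤G 0≤η 0≤n h₁ h₂ h₃ h₄ h₅ h₆ = lin
      (0≤G ⊛ h₁ ⊕ 0≤fromℕ 6 ⊛ h₂ ⊕ 0≤fromℕ 6 ⊛ h₃ ⊕ *-nonNeg₂ (0≤fromℕ 152) 0≤η ⊛ h₄ ⊕ 0≤fromℕ 6 ⊛ h₅
        ⊕ *-nonNeg₂ (0≤fromℕ 6) 0≤n ⊛ h₆)
      (solve (P ∷ G ∷ z ∷ φ ∷ η ∷ n ∷ h ∷ ℓ ∷ e ∷ []) ℚ-ring)

  -- As h ≥ 4, ℓ ≥ h - 2 ≥ h/2. The two summands are at most ε n h and ½ ε n h, the latter since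
  -- 59472 = 2 · 29736. The factor 3 becomes ½ in `ratio`, where P Y = 6 n ℓ is divided out.
  main-error : fromℕ 1080 * n + fromℕ 29736 * (η * (n * h)) ≤ fromℕ 3 * (ε * (n * ℓ))
  main-error = arith n η h ε ℓ 0≤n 0≤nh (*-nonNeg₂ 0≤ε 0≤n) η≪ε 1/ε≪h h≤ℓ+2 4≤h
    where
    arith : ∀ n η h ε ℓ → 0ℚ ≤ n → 0ℚ ≤ n * h → 0ℚ ≤ ε * n → fromℕ 59472 * η ≤ ε → fromℕ 1080 ≤ ε * h →
      h ≤ ℓ + fromℕ 2 → fromℕ 4 ≤ h →
      fromℕ 1080 * n + fromℕ 29736 * (η * (n * h)) ≤ fromℕ 3 * (ε * (n * ℓ))
    arith n η h ε ℓ 0≤n 0≤nh 0≤εn h₁ h₂ h₃ h₄ = lin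
      (0≤n ⊛ h₂ ⊕ *-nonNeg₂ (<⇒≤ (positive⁻¹ ½)) 0≤nh ⊛ h₁ ⊕ *-nonNeg₂ (0≤fromℕ 3) 0≤εn ⊛ h₃
        ⊕ *-nonNeg₂ (*-nonNeg₂ (0≤fromℕ 3) (<⇒≤ (positive⁻¹ ½))) 0≤εn ⊛ h₄)
      (solve (n ∷ η ∷ h ∷ ε ∷ ℓ ∷ []) ℚ-ring)

  1≤ℓ : 1ℚ ≤ ℓ
  1≤ℓ = arith h ℓ h≤ℓ+2 4≤h
    where
    arith : ∀ h ℓ → h ≤ ℓ + fromℕ 2 → fromℕ 4 ≤ h → 1ℚ ≤ ℓ
    arith h ℓ h₁ h₂ = lin (h₁ ⊕ h₂ ⊕ 0≤fromℕ 1) (solve (h ∷ ℓ ∷ []) ℚ-ring)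

  1≤P : 1ℚ ≤ P
  1≤P = arith z P η 1≤z P-lower η-small
    where
    arith : ∀ z P η → 1ℚ ≤ z → fromℕ 6 * z ≤ P + fromℕ 152 * η → fromℕ 152 * η ≤ 1ℚ → 1ℚ ≤ P
    arith z P η h₁ h₂ h₃ = lin (0≤fromℕ 6 ⊛ h₁ ⊕ h₂ ⊕ h₃ ⊕ 0≤fromℕ 4) (solve (z ∷ P ∷ η ∷ []) ℚ-ring)

  P≤13 : P ≤ fromℕ 13
  P≤13 = arith z P η z≤2 P-upper η-small
    where
    arith : ∀ z P η → z ≤ fromℕ 2 → P ≤ fromℕ 6 * z + fromℕ 152 * η → fromℕ 152 * η ≤ 1ℚ → P ≤ fromℕ 13
    arith z P η h₁ h₂ h₃ = lin (0≤fromℕ 6 ⊛ h₁ ⊕ h₂ ⊕ h₃) (solve (z ∷ P ∷ η ∷ []) ℚ-ring)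

  -- Shaped exactly as the k-th term of 6/π² · N · log N unfolds, so that the bounds below apply to
  -- that sequence definitionally.
  Y : ℚ
  Y = fromℕ 6 * inv P * n * ℓ

  -- From P ≤ 13, n ≥ 1 and ℓ ≥ 1. The bound does not depend on k, as a witness of `#0` requires.
  6/13≤Y : fromℕ 6 * inv (fromℕ 13) * 1ℚ * 1ℚ ≤ Y
  6/13≤Y = *-mono₂-≤ (*-nonNeg₂ 0≤6/13 (0≤fromℕ 1)) (≤-trans (0≤fromℕ 1) 1≤ℓ)
    (*-mono₂-≤ 0≤6/13 0≤n (0≤fromℕ 6 ⊛ inv-antitone (<-≤-trans 0<1 1≤P) P≤13) 1≤n) 1≤ℓ
    where
    0≤6/13 : 0ℚ ≤ fromℕ 6 * inv (fromℕ 13)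
    0≤6/13 = *-nonNeg₂ (0≤fromℕ 6) (0≤r 13)

  0<Y : 0ℚ < Y
  0<Y = <-≤-trans (*-pos₂ (*-pos₂ (*-pos₂ (0<fromℕ 6) (0<r 13)) 0<1) 0<1) 6/13≤Y

  ratio : ∣ G * inv Y - 1ℚ ∣ ≤ ε * ½
  ratio = ∣∣≤
    (upper G P (inv P) n ℓ (inv Y) ε (<⇒≤ (inv-pos 0<Y)) (<⇒≤ (inv-pos 0<P)) (*-inv-pos 0<P) (*-inv-pos 0<Y) (≤-trans main-upper main-error))
    (lower G P (inv P) n ℓ (inv Y) ε (<⇒≤ (inv-pos 0<Y)) (<⇒≤ (inv-pos 0<P)) (*-inv-pos 0<P) (*-inv-pos 0<Y) (≤-trans main-lower main-error))
    where
    0<P : 0ℚ < P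
    0<P = <-≤-trans 0<1 1≤P
    -- i = 1/P and y = 1/Y
    upper : ∀ G P i n ℓ y ε → 0ℚ ≤ y → 0ℚ ≤ i → P * i ≡ 1ℚ → fromℕ 6 * i * n * ℓ * y ≡ 1ℚ →
      P * G - fromℕ 6 * (n * ℓ) ≤ fromℕ 3 * (ε * (n * ℓ)) → G * y - 1ℚ ≤ ε * ½
    upper G P i n ℓ y ε 0≤y 0≤i Pi≡1 Yy≡1 h = lin
      (*-nonNeg₂ 0≤i 0≤y ⊛ h ⊕ ≤-reflexive (cong (G * y *_) (sym Pi≡1)) ⊕ ≤-reflexive (cong ((1ℚ + ε * ½) *_) Yy≡1))
      (solve (G ∷ P ∷ i ∷ n ∷ ℓ ∷ y ∷ ε ∷ []) ℚ-ring)
    lower : ∀ G P i n ℓ y ε → 0ℚ ≤ y → 0ℚ ≤ i → P * i ≡ 1ℚ → fromℕ 6 * i * n * ℓ * y ≡ 1ℚ →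
      - (P * G - fromℕ 6 * (n * ℓ)) ≤ fromℕ 3 * (ε * (n * ℓ)) → - (G * y - 1ℚ) ≤ ε * ½
    lower G P i n ℓ y ε 0≤y 0≤i Pi≡1 Yy≡1 h = lin
      (*-nonNeg₂ 0≤i 0≤y ⊛ h ⊕ ≤-reflexive (cong (G * y *_) Pi≡1) ⊕ ≤-reflexive (cong ((1ℚ - ε * ½) *_) (sym Yy≡1)))
      (solve (G ∷ P ∷ i ∷ n ∷ ℓ ∷ y ∷ ε ∷ []) ℚ-ring)

  δ₀≤∣Y∣ : fromℕ 6 * inv (fromℕ 13) * 1ℚ * 1ℚ ≤ ∣ Y ∣
  δ₀≤∣Y∣ = ≤-trans 6/13≤Y (p≤∣p∣ Y)

  -- `<ᴿ` asks for a positive rational gap; `ratio` spends only half of ε, and the other half is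
  -- that gap.
  ratio+½ε≤ : ∀ {G′ e} → G′ ≡ G → 0ℚ + ε ≤ e → ∣ G′ * inv Y - 1ℚ ∣ + ε * ½ ≤ e
  ratio+½ε≤ refl ε≤e = ≤-trans (ratio ⊕ ≤-refl {ε * ½})
    (≤-trans (≤-reflexive (trans (half+half ε) (sym (+-identityˡ ε)))) ε≤e)

-- N₀ is fixed by ε, while K may grow with n: a term of `log` is compared with H only once its mesh
-- is at most 1.
Approximable : ℚ → Set
Approximable ε = ∃ λ N₀ → ∀ n .⦃ _ : ℕ.NonZero n ⦄ → N₀ ℕ.≤ suc n → ∃ λ K → ∀ k → K ℕ.≤ k → ∃ λ J → ∃ λ η →
  Approximation (fromℕ (Counting.G n)) (fromℕ (suc n)) (fromℕ n) (Φ n) (H (suc n)) (seq (log (suc n)) k)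
    (Z (suc J)) (r (suc J)) (seq π k * seq π k) η ε

approximable : ∀ ε → 0ℚ < ε → Approximable ε
approximable ε 0<ε = choose-η (archimedean (fromℕ 59472) ε 0<ε)
  where
  -- H(N) ≥ C yields both h ≥ 4 and ε h ≥ 1080.
  C : ℚ
  C = fromℕ 4 + fromℕ 1080 * inv ε
  4≤ : ∀ h i → 0ℚ ≤ i → fromℕ 4 + fromℕ 1080 * i ≤ h → fromℕ 4 ≤ h
  4≤ h i 0≤i C≤h = lin (C≤h ⊕ 0≤fromℕ 1080 ⊛ 0≤i) (solve (h ∷ i ∷ []) ℚ-ring)
  1080≤ : ∀ h ε i → ε * i ≡ 1ℚ → 0ℚ ≤ ε → fromℕ 4 + fromℕ 1080 * i ≤ h → fromℕ 1080 ≤ ε * h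
  1080≤ h ε i εi≡1 0≤ε C≤h = lin (0≤ε ⊛ C≤h ⊕ 0≤fromℕ 1080 ⊛ ≤-reflexive (sym εi≡1) ⊕ 0≤fromℕ 4 ⊛ 0≤ε)
    (solve (h ∷ ε ∷ i ∷ []) ℚ-ring)
  choose-N₀ : ∀ η J K → 0ℚ ≤ η → fromℕ 152 * η ≤ 1ℚ → fromℕ 59472 * η ≤ ε → r (suc J) ≤ η →
    (∀ k → K ℕ.≤ k → seq π k * seq π k ≤ fromℕ 6 * Z (suc J) + fromℕ 152 * η ×
                     fromℕ 6 * Z (suc J) ≤ seq π k * seq π k + fromℕ 152 * η) →
    (∃ λ N₀ → ∀ N → N₀ ℕ.≤ N → C ≤ H N) → Approximable ε
  choose-N₀ η J K 0≤η η-small η≪ε rJ≤η π-close (N₀ , C≤H) = N₀ , λ n N₀≤ → K ℕ.⊔ n , λ k K⊔n≤k →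
    let ∣G∣ = Contraction.∣G∣≤ (suc J) n
        P≤ , ≤P = π-close k (ℕₚ.m⊔n≤o⇒m≤o K n K⊔n≤k)
    in J , η , record
      { G-upper = ≤-trans (p≤∣p∣ _) ∣G∣
      ; G-lower = ≤-trans (-p≤∣p∣ _) ∣G∣
      ; P-upper = P≤
      ; P-lower = ≤P
      ; x≤η     = rJ≤η
      ; 1≤z     = 1≤Z (suc J)
      ; z≤2     = Z≤2 (suc J)
      ; ℓ≤h     = log≤H n k
      ; h≤ℓ+2   = H≤log n k (ℕₚ.m≤n⇒m≤1+n (ℕₚ.m⊔n≤o⇒n≤o K n K⊔n≤k))
      ; φ≤nh    = Φ-mono (ℕₚ.n≤1+n n)
      ; nh≤φ+2n = Φ-suc n
      ; m≤n     = fromℕ-mono-≤ (ℕₚ.n≤1+n n)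
      ; 0≤G     = 0≤fromℕ (Counting.G n)
      ; 0≤φ     = 0≤Φ n
      ; 1≤n     = 1≤fromℕ (suc n)
      ; 0≤η     = 0≤η
      ; η-small = η-small
      ; η≪ε     = η≪ε
      ; 4≤h     = 4≤ (H (suc n)) (inv ε) (<⇒≤ (inv-pos 0<ε)) (C≤H (suc n) N₀≤)
      ; 1/ε≪h   = 1080≤ (H (suc n)) ε (inv ε) (*-inv-pos 0<ε) (<⇒≤ 0<ε) (C≤H (suc n) N₀≤)
      ; 0≤ε     = <⇒≤ 0<ε
      }
  choose-J : ∀ η → 0ℚ < η → η ≤ 1ℚ → fromℕ 152 * η ≤ 1ℚ → fromℕ 59472 * η ≤ ε → Approximable ε
  choose-J η 0<η η≤1 η-small η≪ε =
    let J , rJ≤η , K , π-close = π²≈6Z η 0<η η≤1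
    in choose-N₀ η J K (<⇒≤ 0<η) η-small η≪ε rJ≤η π-close (H-unbounded C)
  choose-η : (∃ λ M → ∀ m → M ℕ.≤ m → fromℕ 59472 * r (suc m) < ε) → Approximable ε
  -- With η = 1/(M + 152), the summand M makes 59472 η < ε and the summand 152 makes 152 η ≤ 1.
  choose-η (M , small) = choose-J (r (suc (M ℕ.+ 151))) (0<r (suc (M ℕ.+ 151))) (r≤1 (suc (M ℕ.+ 151)))
    (0≤fromℕ 152 ⊛ r-antitone {152} (subst (152 ℕ.≤_) (ℕₚ.+-suc M 151) (ℕₚ.m≤n+m 152 M)))
    (<⇒≤ (small (M ℕ.+ 151) (ℕₚ.m≤m+n M 151)))

sum-g : ∀ n → fromℕ (sum (map g [1⋯ n ])) ≡ fromℕ (Counting.G n)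
sum-g n = cong fromℕ (Counting.S-sum g suc n)

theorem2 : (λ N → ι (fromℕ (sum (map g [1⋯ N ∸ 1 ])))) ∼ (λ N → 6/π² *ᴿ ι (fromℕ N) *ᴿ log N)
-- Positivity of the real ε provides a rational δ below all its late terms, so rational tolerances
-- suffice.
theorem2 ε (δ , 0<δ , M , δ≤ε) = conclude (approximable δ 0<δ)
  where
  conclude : Approximable δ → ∃ λ N₀ → ∀ N → .⦃ _ : ℕ.NonZero N ⦄ → N₀ ℕ.≤ N →
    Σ ((6/π² *ᴿ ι (fromℕ N) *ᴿ log N) #0) λ gN#0 →
      ∣ ι (fromℕ (sum (map g [1⋯ N ∸ 1 ]))) /ᴿ 6/π² *ᴿ ι (fromℕ N) *ᴿ log N [ gN#0 ] -ᴿ ι 1ℚ ∣ᴿ <ᴿ ε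
  -- The 2 excludes N = 1, where log N = 0 and the denominator is not invertible.
  conclude (N₀ , approx) = N₀ ℕ.⊔ 2 , large
    where
    large : ∀ N → .⦃ _ : ℕ.NonZero N ⦄ → N₀ ℕ.⊔ 2 ℕ.≤ N →
      Σ ((6/π² *ᴿ ι (fromℕ N) *ᴿ log N) #0) λ gN#0 →
        ∣ ι (fromℕ (sum (map g [1⋯ N ∸ 1 ]))) /ᴿ 6/π² *ᴿ ι (fromℕ N) *ᴿ log N [ gN#0 ] -ᴿ ι 1ℚ ∣ᴿ <ᴿ ε
    large (suc zero) N₀≤ = contradiction (ℕₚ.m⊔n≤o⇒n≤o N₀ 2 N₀≤) λ { (s≤s ()) }
    large (suc n@(suc _)) N₀≤ = gN#0 , close
      where
      gN : ℝ
      gN = 6/π² *ᴿ ι (fromℕ (suc n)) *ᴿ log (suc n)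
      K : ℕ
      K = proj₁ (approx n (ℕₚ.m⊔n≤o⇒m≤o N₀ 2 N₀≤))
      bounds = proj₂ (approx n (ℕₚ.m⊔n≤o⇒m≤o N₀ 2 N₀≤))
      δ₀ : ℚ
      δ₀ = fromℕ 6 * inv (fromℕ 13) * 1ℚ * 1ℚ
      gN#0 : gN #0
      gN#0 = δ₀ , positive⁻¹ δ₀ , K , λ k K≤k → Approximation.δ₀≤∣Y∣ (proj₂ (proj₂ (bounds k K≤k)))
      close : ∣ ι (fromℕ (sum (map g [1⋯ n ]))) /ᴿ gN [ gN#0 ] -ᴿ ι 1ℚ ∣ᴿ <ᴿ ε
      close = δ * ½ , 0<half 0<δ , K ℕ.⊔ M , λ k K⊔M≤k →
        Approximation.ratio+½ε≤ (proj₂ (proj₂ (bounds k (ℕₚ.m⊔n≤o⇒m≤o K M K⊔M≤k))))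
          (sum-g n) (δ≤ε k (ℕₚ.m⊔n≤o⇒n≤o K M K⊔M≤k))
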